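{- Let $X$ be a finite lattice-convex subset of $\mathbb{Z}^d$ satisfying one of the following conditions: (a) The points in $X$ represent every residue class in $(\mathbb{Z}/2\mathbb{Z})^d$. (b) The polytope $\operatorname{conv}(X)$ contains interior lattice points, i.e., $\operatorname{int}(\operatorname{conv}(X)) \cap \mathbb{Z}^d \neq \emptyset$. (c) The lattice-width of $X$ is bigger than the finiteness threshold width $w^\infty(d)$. Then $\operatorname{rc}(X)$ and $\operatorname{rc}_{\mathbb{Q}}(X)$ coincide and can be computed algorithmically (i.e., there is an algorithm that, given such an $X$ as input, outputs this number).
   Context: A set $X \subseteq \mathbb{Z}^d$ is lattice-convex if $\operatorname{conv}(X) \cap \mathbb{Z}^d = X$. We say $X$ is described by $k$ linear inequalities within $\mathbb{Z}^d$ if $X = \{x \in \mathbb{Z}^d : Ax \le b,\ Ux = v\}$ for some real matrices $A, U$ and real vectors $b, v$, where $Ax \le b$ consists of $k$ inequalities (the number of equations $Ux=v$ is arbitrary and not counted); if all entries of $A,U,b,v$ can be taken rational, $X$ is described by $k$ rational linear inequalities within $\mathbb{Z}^d$. The relaxation complexity $\operatorname{rc}(X)$ (resp. $\operatorname{rc}_{\mathbb{Q}}(X)$) is the minimal $k$ such that $X$ can be described by $k$ linear inequalities (resp. $k$ rational linear inequalities) within $\mathbb{Z}^d$. For $u \in \mathbb{Z}^d\setminus\{0\}$ and $S \subseteq \mathbb{R}^d$ let $w(S,u) = \max_{x\in S} u^\intercal x - \min_{x \in S} u^\intercal x$; the lattice-width of $S$ is $w(S) = \min_{u \in \mathbb{Z}^d\setminus\{0\}}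 w(S,u)$. A lattice polytope is the convex hull of finitely many points of $\mathbb{Z}^d$. Two sets in $\mathbb{R}^d$ are unimodularly equivalent if one is the image of the other under a map $x \mapsto Ux+t$ with $U$ an integral $d\times d$ matrix of determinant $\pm1$ and $t \in \mathbb{Z}^d$. The finiteness threshold width $w^\infty(d)$ is the smallest non-negative integer such that for every positive integer $n$, up to unimodular equivalence, all but finitely many $d$-dimensional lattice polytopes in $\mathbb{R}^d$ with exactly $n$ lattice points have lattice-width at most $w^\infty(d)$ (this is a finite constant). -}

module Defs where

open import Data.Fin.Base using (Fin; zero; suc; toℕ; punchIn)
open import Data.Integer.Base as ℤ using (ℤ; +_; 0ℤ; 1ℤ; -1ℤ)
open import Data.Integer.Divisibility using (_∣_)
open import Data.List.Base as List using (List; length)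
open import Data.List.Membership.Propositional using (_∈_)
open import Data.List.Relation.Unary.All using (All)
open import Data.List.Relation.Unary.Any using (Any)
open import Data.List.Relation.Unary.Unique.Propositional using (Unique)
open import Data.Maybe.Base using (Maybe; just; nothing)
open import Data.Nat.Base as ℕ using (ℕ; zero; suc)
import Data.Nat.Properties as ℕₚ
open import Data.Product.Base using (Σ-syntax; ∃-syntax; _×_; _,_)
open import Data.Rational.Base as ℚ using (ℚ; 0ℚ; 1ℚ; ½)
import Data.Rational.Properties as ℚₚ
open import Data.Rational.Solver using (module +-*-Solver)
open import Data.Sum.Base using (_⊎_)
open import Data.Vec.Base as Vec using (Vec)
open import Data.Vec.Functional as Vector using (Vector)
open import Function.Bundles using (_⇔_)
open import Level using (0ℓ)
open import Relation.Binary.PropositionalEquality using (_≡_; _≢_; refl; sym; trans; cong; subst)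
open import Relation.Nullary.Negation using (¬_)
open import Relation.Unary using (Pred)

------------------------------------------------------------------------
-- Real numbers: the Cauchy completion of ℚ.  Equality of reals is the
-- relation _≈_, not propositional equality.

IsCauchy : (ℕ → ℚ) → Set
IsCauchy s = ∀ ε → 0ℚ ℚ.< ε →
  ∃[ N ] (∀ m n → N ℕ.≤ m → N ℕ.≤ n → ℚ.∣ s m ℚ.- s n ∣ ℚ.< ε)

record ℝ : Set where
  constructor mkℝ
  field
    seq    : ℕ → ℚ
    cauchy : IsCauchy seq

open ℝ

infix 4 _≈_ _≤_ _<_

_≈_ : ℝ → ℝ → Set
x ≈ y = ∀ ε → 0ℚ ℚ.< ε →
  ∃[ N ] (∀ n → N ℕ.≤ n → ℚ.∣ seq x n ℚ.- seq y n ∣ ℚ.< ε)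

_≤_ : ℝ → ℝ → Set
x ≤ y = ∀ ε → 0ℚ ℚ.< ε →
  ∃[ N ] (∀ n → N ℕ.≤ n → seq x n ℚ.≤ seq y n ℚ.+ ε)

_<_ : ℝ → ℝ → Set
x < y = ∃[ ε ] (0ℚ ℚ.< ε ×
  ∃[ N ] (∀ n → N ℕ.≤ n → seq x n ℚ.+ ε ℚ.≤ seq y n))

private
  open +-*-Solver using (solve; _:+_; _:*_; :-_; _:-_; _:=_)

  half-pos : ∀ {ε} → 0ℚ ℚ.< ε → 0ℚ ℚ.< ½ ℚ.* ε
  half-pos {ε} 0<ε =
    subst (ℚ._< ½ ℚ.* ε) (ℚₚ.*-zeroʳ ½) (ℚₚ.*-monoʳ-<-pos ½ 0<ε)

  half+half : ∀ ε → ½ ℚ.* ε ℚ.+ ½ ℚ.* ε ≡ ε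
  half+half ε = trans (sym (ℚₚ.*-distribʳ-+ ε ½ ½)) (ℚₚ.*-identityˡ ε)

  +-cauchy : ∀ {s t} → IsCauchy s → IsCauchy t → IsCauchy (λ n → s n ℚ.+ t n)
  +-cauchy {s} {t} cs ct ε 0<ε
    with cs (½ ℚ.* ε) (half-pos 0<ε) | ct (½ ℚ.* ε) (half-pos 0<ε)
  ... | M , hs | N , ht = M ℕ.⊔ N , λ m n p q → begin-strict
      ℚ.∣ (s m ℚ.+ t m) ℚ.- (s n ℚ.+ t n) ∣
        ≡⟨ cong ℚ.∣_∣ (regroup (s m) (t m) (s n) (t n)) ⟩
      ℚ.∣ (s m ℚ.- s n) ℚ.+ (t m ℚ.- t n) ∣
        ≤⟨ ℚₚ.∣p+q∣≤∣p∣+∣q∣ (s m ℚ.- s n) (t m ℚ.- t n) ⟩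
      ℚ.∣ s m ℚ.- s n ∣ ℚ.+ ℚ.∣ t m ℚ.- t n ∣
        <⟨ ℚₚ.+-mono-<
             (hs m n (ℕₚ.m⊔n≤o⇒m≤o M N p) (ℕₚ.m⊔n≤o⇒m≤o M N q))
             (ht m n (ℕₚ.m⊔n≤o⇒n≤o M N p) (ℕₚ.m⊔n≤o⇒n≤o M N q)) ⟩
      ½ ℚ.* ε ℚ.+ ½ ℚ.* ε
        ≡⟨ half+half ε ⟩
      ε ∎
    where
    open ℚₚ.≤-Reasoning
    regroup : ∀ a b c d → (a ℚ.+ b) ℚ.- (c ℚ.+ d) ≡ (a ℚ.- c) ℚ.+ (b ℚ.- d)
    regroup = solve 4
      (λ a b c d → (a :+ b) :- (c :+ d) := (a :- c) :+ (b :- d)) refl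

  neg-cauchy : ∀ {s} → IsCauchy s → IsCauchy (λ n → ℚ.- s n)
  neg-cauchy {s} cs ε 0<ε with cs ε 0<ε
  ... | N , h = N , λ m n p q → subst (ℚ._< ε) (flip-sign (s m) (s n)) (h m n p q)
    where
    flip-sign : ∀ a b → ℚ.∣ a ℚ.- b ∣ ≡ ℚ.∣ ℚ.- a ℚ.- ℚ.- b ∣
    flip-sign a b = trans (sym (ℚₚ.∣-p∣≡∣p∣ (a ℚ.- b)))
      (cong ℚ.∣_∣ (solve 2 (λ a b → :- (a :- b) := (:- a) :- (:- b)) refl a b))

  bounded : ∀ {s} → IsCauchy s →
    ∃[ B ] (0ℚ ℚ.< B × ∃[ N ] (∀ n → N ℕ.≤ n → ℚ.∣ s n ∣ ℚ.≤ B))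
  bounded {s} cs with cs 1ℚ (ℚₚ.positive⁻¹ 1ℚ)
  ... | N , h = ℚ.∣ s N ∣ ℚ.+ 1ℚ ,
      ℚₚ.+-mono-≤-< (ℚₚ.0≤∣p∣ (s N)) (ℚₚ.positive⁻¹ 1ℚ) ,
      N , λ n p → begin
      ℚ.∣ s n ∣                          ≡⟨ cong ℚ.∣_∣ (split (s n) (s N)) ⟩
      ℚ.∣ s N ℚ.+ (s n ℚ.- s N) ∣        ≤⟨ ℚₚ.∣p+q∣≤∣p∣+∣q∣ (s N) (s n ℚ.- s N) ⟩
      ℚ.∣ s N ∣ ℚ.+ ℚ.∣ s n ℚ.- s N ∣    ≤⟨ ℚₚ.+-monoʳ-≤ ℚ.∣ s N ∣ (ℚₚ.<⇒≤ (h n N p ℕₚ.≤-refl)) ⟩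
      ℚ.∣ s N ∣ ℚ.+ 1ℚ                   ∎
    where
    open ℚₚ.≤-Reasoning
    split : ∀ a b → a ≡ b ℚ.+ (a ℚ.- b)
    split = solve 2 (λ a b → a := b :+ (a :- b)) refl

  quotient : ∀ {b ε} → 0ℚ ℚ.< b → 0ℚ ℚ.< ε → ∃[ δ ] (0ℚ ℚ.< δ × b ℚ.* δ ≡ ε)
  quotient {b} {ε} 0<b 0<ε = ℚ.1/ b ℚ.* ε ,
      subst (ℚ._< ℚ.1/ b ℚ.* ε) (ℚₚ.*-zeroʳ (ℚ.1/ b))
        (ℚₚ.*-monoʳ-<-pos (ℚ.1/ b) 0<ε) ,
      trans (sym (ℚₚ.*-assoc b (ℚ.1/ b) ε))
        (trans (cong (ℚ._* ε) (ℚₚ.*-inverseʳ b)) (ℚₚ.*-identityˡ ε))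
    where
    instance
      b-pos : ℚ.Positive b
      b-pos = ℚ.positive 0<b
      b-nonZero : ℚ.NonZero b
      b-nonZero = ℚₚ.pos⇒nonZero b
      1/b-pos : ℚ.Positive (ℚ.1/ b)
      1/b-pos = ℚₚ.1/pos⇒pos b

  -- The sequences s and t are bounded by B and C, and vary by less than δ.
  product-estimate : ∀ {s t : ℕ → ℚ} {ε} B C δ K L M N →
    0ℚ ℚ.< B → 0ℚ ℚ.< C → (B ℚ.+ C) ℚ.* δ ≡ ε →
    (∀ n → K ℕ.≤ n → ℚ.∣ s n ∣ ℚ.≤ B) →
    (∀ n → L ℕ.≤ n → ℚ.∣ t n ∣ ℚ.≤ C) →
    (∀ m n → M ℕ.≤ m → M ℕ.≤ n → ℚ.∣ s m ℚ.- s n ∣ ℚ.< δ) →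
    (∀ m n → N ℕ.≤ m → N ℕ.≤ n → ℚ.∣ t m ℚ.- t n ∣ ℚ.< δ) →
    ∀ m n → (K ℕ.⊔ L) ℕ.⊔ (M ℕ.⊔ N) ℕ.≤ m → (K ℕ.⊔ L) ℕ.⊔ (M ℕ.⊔ N) ℕ.≤ n →
    ℚ.∣ s m ℚ.* t m ℚ.- s n ℚ.* t n ∣ ℚ.< ε
  product-estimate {s} {t} {ε} B C δ K L M N 0<B 0<C [B+C]δ≡ε hB hC hs ht m n p q =
    begin-strict
      ℚ.∣ s m ℚ.* t m ℚ.- s n ℚ.* t n ∣
        ≡⟨ cong ℚ.∣_∣ (regroup (s m) (t m) (s n) (t n)) ⟩
      ℚ.∣ s m ℚ.* (t m ℚ.- t n) ℚ.+ t n ℚ.* (s m ℚ.- s n) ∣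
        ≤⟨ ℚₚ.∣p+q∣≤∣p∣+∣q∣ (s m ℚ.* (t m ℚ.- t n)) (t n ℚ.* (s m ℚ.- s n)) ⟩
      ℚ.∣ s m ℚ.* (t m ℚ.- t n) ∣ ℚ.+ ℚ.∣ t n ℚ.* (s m ℚ.- s n) ∣
        <⟨ ℚₚ.+-mono-<
             {ℚ.∣ s m ℚ.* (t m ℚ.- t n) ∣} {B ℚ.* δ}
             {ℚ.∣ t n ℚ.* (s m ℚ.- s n) ∣} {C ℚ.* δ}
             (bound B (s m) (t m ℚ.- t n) 0<B (hB m (K≤ p)) (ht m n (N≤ p) (N≤ q)))
             (bound C (t n) (s m ℚ.- s n) 0<C (hC n (L≤ q)) (hs m n (M≤ p) (M≤ q))) ⟩
      B ℚ.* δ ℚ.+ C ℚ.* δ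
        ≡⟨ ℚₚ.*-distribʳ-+ δ B C ⟨
      (B ℚ.+ C) ℚ.* δ
        ≡⟨ [B+C]δ≡ε ⟩
      ε ∎
    where
    open ℚₚ.≤-Reasoning
    regroup : ∀ a b c d → a ℚ.* b ℚ.- c ℚ.* d ≡ a ℚ.* (b ℚ.- d) ℚ.+ d ℚ.* (a ℚ.- c)
    regroup = solve 4
      (λ a b c d → a :* b :- c :* d := a :* (b :- d) :+ d :* (a :- c)) refl
    bound : ∀ b x y → 0ℚ ℚ.< b → ℚ.∣ x ∣ ℚ.≤ b → ℚ.∣ y ∣ ℚ.< δ →
      ℚ.∣ x ℚ.* y ∣ ℚ.< b ℚ.* δ
    bound b x y 0<b x≤b y<δ = begin-strict
      ℚ.∣ x ℚ.* y ∣
        ≡⟨ ℚₚ.∣p*q∣≡∣p∣*∣q∣ x y ⟩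
      ℚ.∣ x ∣ ℚ.* ℚ.∣ y ∣
        ≤⟨ ℚₚ.*-monoʳ-≤-nonNeg ℚ.∣ y ∣ {{ℚₚ.∣-∣-nonNeg y}} x≤b ⟩
      b ℚ.* ℚ.∣ y ∣
        <⟨ ℚₚ.*-monoʳ-<-pos b {{ℚ.positive 0<b}} y<δ ⟩
      b ℚ.* δ ∎
    KL≤ : ∀ {m} → (K ℕ.⊔ L) ℕ.⊔ (M ℕ.⊔ N) ℕ.≤ m → K ℕ.⊔ L ℕ.≤ m
    KL≤ = ℕₚ.m⊔n≤o⇒m≤o (K ℕ.⊔ L) (M ℕ.⊔ N)
    MN≤ : ∀ {m} → (K ℕ.⊔ L) ℕ.⊔ (M ℕ.⊔ N) ℕ.≤ m → M ℕ.⊔ N ℕ.≤ m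
    MN≤ = ℕₚ.m⊔n≤o⇒n≤o (K ℕ.⊔ L) (M ℕ.⊔ N)
    K≤ : ∀ {m} → (K ℕ.⊔ L) ℕ.⊔ (M ℕ.⊔ N) ℕ.≤ m → K ℕ.≤ m
    K≤ p = ℕₚ.m⊔n≤o⇒m≤o K L (KL≤ p)
    L≤ : ∀ {m} → (K ℕ.⊔ L) ℕ.⊔ (M ℕ.⊔ N) ℕ.≤ m → L ℕ.≤ m
    L≤ p = ℕₚ.m⊔n≤o⇒n≤o K L (KL≤ p)
    M≤ : ∀ {m} → (K ℕ.⊔ L) ℕ.⊔ (M ℕ.⊔ N) ℕ.≤ m → M ℕ.≤ m
    M≤ p = ℕₚ.m⊔n≤o⇒m≤o M N (MN≤ p)
    N≤ : ∀ {m} → (K ℕ.⊔ L) ℕ.⊔ (M ℕ.⊔ N) ℕ.≤ m → N ℕ.≤ m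
    N≤ p = ℕₚ.m⊔n≤o⇒n≤o M N (MN≤ p)

  *-cauchy : ∀ {s t} → IsCauchy s → IsCauchy t → IsCauchy (λ n → s n ℚ.* t n)
  *-cauchy {s} {t} cs ct ε 0<ε =
    let B , 0<B , K , hB = bounded {s} cs
        C , 0<C , L , hC = bounded {t} ct
        δ , 0<δ , [B+C]δ≡ε = quotient (ℚₚ.+-mono-< {0ℚ} {B} {0ℚ} {C} 0<B 0<C) 0<ε
        M , hs = cs δ 0<δ
        N , ht = ct δ 0<δ
    in (K ℕ.⊔ L) ℕ.⊔ (M ℕ.⊔ N) ,
       product-estimate {s} {t} B C δ K L M N 0<B 0<C [B+C]δ≡ε hB hC hs ht

infixl 6 _+_ _-_
infixl 7 _*_
infix  8 -_

_+_ : ℝ → ℝ → ℝ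
x + y = mkℝ (λ n → seq x n ℚ.+ seq y n) (+-cauchy {seq x} {seq y} (cauchy x) (cauchy y))

_*_ : ℝ → ℝ → ℝ
x * y = mkℝ (λ n → seq x n ℚ.* seq y n) (*-cauchy {seq x} {seq y} (cauchy x) (cauchy y))

-_ : ℝ → ℝ
- x = mkℝ (λ n → ℚ.- seq x n) (neg-cauchy {seq x} (cauchy x))

_-_ : ℝ → ℝ → ℝ
x - y = x + - y

fromℚ : ℚ → ℝ
fromℚ q = mkℝ (λ _ → q) λ ε 0<ε →
  0 , λ _ _ _ _ → subst (ℚ._< ε) (sym (cong ℚ.∣_∣ (ℚₚ.+-inverseʳ q))) 0<ε

fromℤ : ℤ → ℝ
fromℤ z = fromℚ (z ℚ./ 1)

0ℝ 1ℝ : ℝ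
0ℝ = fromℚ 0ℚ
1ℝ = fromℚ 1ℚ

------------------------------------------------------------------------
-- Vectors and matrices.  Lattice points are `Vec`s, so that finite sets
-- of them can be given by lists and propositional membership.

ℤ^ ℝ^ : ℕ → Set
ℤ^ d = Vec ℤ d
ℝ^ d = Vector ℝ d

Matrix : Set → ℕ → ℕ → Set
Matrix A m n = Vector (Vector A n) m

∑ : ∀ {n} → Vector ℝ n → ℝ
∑ = Vector.foldr _+_ 0ℝ

_·_ : ∀ {n} → ℝ^ n → ℝ^ n → ℝ
x · y = ∑ λ i → x i * y i

_*ᵥ_ : ∀ {m n} → Matrix ℝ m n → ℝ^ n → ℝ^ m
(A *ᵥ x) i = A i · x

_≈ᵥ_ _≤ᵥ_ : ∀ {n} → ℝ^ n → ℝ^ n → Set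
x ≈ᵥ y = ∀ i → x i ≈ y i
x ≤ᵥ y = ∀ i → x i ≤ y i

ι : ∀ {d} → ℤ^ d → ℝ^ d
ι z i = fromℤ (Vec.lookup z i)

-- Laplace expansion along the first row.
det : ∀ {n} → Matrix ℤ n n → ℤ
det {zero}  _ = 1ℤ
det {suc n} M = Vector.foldr ℤ._+_ 0ℤ λ j →
  (-1ℤ ℤ.^ toℕ j) ℤ.* M zero j ℤ.* det (λ r c → M (suc r) (punchIn j c))

------------------------------------------------------------------------
-- Convexity

⟦_⟧ : ∀ {d} → List (ℤ^ d) → Pred (ℝ^ d) 0ℓ
⟦ X ⟧ p = ∃[ x ] (x ∈ X × p ≈ᵥ ι x)

combination : ∀ {d} (X : List (ℤ^ d)) → ℝ^ (length X) → ℝ^ d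
combination X c i = ∑ λ k → c k * ι (List.lookup X k) i

aff conv : ∀ {d} → List (ℤ^ d) → Pred (ℝ^ d) 0ℓ
aff  X p = ∃[ c ] (∑ c ≈ 1ℝ × p ≈ᵥ combination X c)
conv X p = ∃[ c ] ((∀ k → 0ℝ ≤ c k) × ∑ c ≈ 1ℝ × p ≈ᵥ combination X c)

-- The boxes form a base of the Euclidean topology.
interior : ∀ {d} → Pred (ℝ^ d) 0ℓ → Pred (ℝ^ d) 0ℓ
interior S p = ∃[ ε ] (0ℝ < ε ×
  (∀ q → (∀ i → p i - ε < q i × q i < p i + ε) → S q))

LatticeConvex : ∀ {d} → List (ℤ^ d) → Set
LatticeConvex X = ∀ z → conv X (ι z) ⇔ z ∈ X

------------------------------------------------------------------------
-- Relaxation complexity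

Describes : ∀ {d m k} → Matrix ℝ k d → ℝ^ k → Matrix ℝ m d → ℝ^ m →
  List (ℤ^ d) → Set
Describes A b U v X = ∀ x → x ∈ X ⇔ ((A *ᵥ ι x) ≤ᵥ b × (U *ᵥ ι x) ≈ᵥ v)

DescribedBy : ∀ {d} → List (ℤ^ d) → ℕ → Set
DescribedBy {d} X k =
  ∃[ m ] Σ[ A ∈ Matrix ℝ k d ] Σ[ b ∈ Vector ℝ k ]
         Σ[ U ∈ Matrix ℝ m d ] Σ[ v ∈ Vector ℝ m ] Describes A b U v X

DescribedByℚ : ∀ {d} → List (ℤ^ d) → ℕ → Set
DescribedByℚ {d} X k =
  ∃[ m ] Σ[ A ∈ Matrix ℚ k d ] Σ[ b ∈ Vector ℚ k ]
         Σ[ U ∈ Matrix ℚ m d ] Σ[ v ∈ Vector ℚ m ]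
    Describes (λ i j → fromℚ (A i j)) (λ i → fromℚ (b i))
              (λ i j → fromℚ (U i j)) (λ i → fromℚ (v i)) X

IsLeast : Pred ℕ 0ℓ → ℕ → Set
IsLeast P k = P k × (∀ j → P j → k ℕ.≤ j)

IsRc IsRcℚ : ∀ {d} → List (ℤ^ d) → ℕ → Set
IsRc  X = IsLeast (DescribedBy X)
IsRcℚ X = IsLeast (DescribedByℚ X)

------------------------------------------------------------------------
-- Lattice-width and the finiteness threshold width

IsWidthAlong : ∀ {d} → Pred (ℝ^ d) 0ℓ → ℤ^ d → ℝ → Set
IsWidthAlong S u r = ∃[ p ] ∃[ q ] (S p × S q ×
  (∀ x → S x → ι u · x ≤ ι u · p) ×
  (∀ x → S x → ι u · q ≤ ι u · x) ×
  r ≈ ι u · p - ι u · q)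

NonZeroᵥ : ∀ {d} → ℤ^ d → Set
NonZeroᵥ {d} u = u ≢ Vec.replicate d 0ℤ

IsLatticeWidth : ∀ {d} → Pred (ℝ^ d) 0ℓ → ℝ → Set
IsLatticeWidth S r =
  (∃[ u ] (NonZeroᵥ u × IsWidthAlong S u r)) ×
  (∀ u r′ → NonZeroᵥ u → IsWidthAlong S u r′ → r ≤ r′)

LatticeWidth≤ LatticeWidth> : ∀ {d} → Pred (ℝ^ d) 0ℓ → ℕ → Set
LatticeWidth≤ S w = ∃[ r ] (IsLatticeWidth S r × r ≤ fromℤ (+ w))
LatticeWidth> S w = ∃[ r ] (IsLatticeWidth S r × fromℤ (+ w) < r)

UnimodularlyEquivalent : ∀ {d} → Pred (ℝ^ d) 0ℓ → Pred (ℝ^ d) 0ℓ → Set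
UnimodularlyEquivalent {d} S T =
  Σ[ U ∈ Matrix ℤ d d ] Σ[ t ∈ ℤ^ d ]
    ((det U ≡ 1ℤ ⊎ det U ≡ -1ℤ) ×
     (∀ p → T p ⇔ (∃[ q ] (S q × (∀ i → p i ≈ (λ j → fromℤ (U i j)) · q + ι t i)))))

-- A list V stands for the lattice polytope conv V.  Since aff V is also the
-- affine hull of conv V, this says that dim (conv V) = d.
FullDimensional : ∀ {d} → List (ℤ^ d) → Set
FullDimensional V = ∀ p → aff V p

LatticePointCount : ∀ {d} → List (ℤ^ d) → ℕ → Set
LatticePointCount V n = ∃[ L ]
  (Unique L × length L ≡ n × (∀ z → z ∈ L ⇔ conv V (ι z)))

FinitelyManyUpToEquivalence : ∀ {d} → Pred (List (ℤ^ d)) 0ℓ → Set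
FinitelyManyUpToEquivalence P = ∃[ Vs ]
  (All P Vs × (∀ V → P V → Any (λ W → UnimodularlyEquivalent (conv V) (conv W)) Vs))

IsFinitenessThresholdWidth : ℕ → ℕ → Set
IsFinitenessThresholdWidth d = IsLeast λ w → ∀ n → 1 ℕ.≤ n →
  FinitelyManyUpToEquivalence {d} λ V →
    FullDimensional V × LatticePointCount V n × ¬ LatticeWidth≤ (conv V) w

------------------------------------------------------------------------
-- The three conditions

RepresentsAllParities : ∀ {d} → List (ℤ^ d) → Set
RepresentsAllParities X =
  ∀ z → ∃[ x ] (x ∈ X × (∀ i → + 2 ∣ (Vec.lookup x i ℤ.- Vec.lookup z i)))

HasInteriorLatticePoint : ∀ {d} → List (ℤ^ d) → Set
HasInteriorLatticePoint X = ∃[ z ] interior (conv X) (ι z)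

WiderThanThreshold : ∀ {d} → List (ℤ^ d) → Set
WiderThanThreshold {d} X =
  ∃[ w ] (IsFinitenessThresholdWidth d w × LatticeWidth> ⟦ X ⟧ w)

------------------------------------------------------------------------
-- Algorithms.  A closed Agda function is computable, and a possibly
-- non-terminating computation is a closed function of its input and a
-- number of steps; it outputs b if b is the first value it produces.

Algorithm : Set → Set → Set
Algorithm A B = A → ℕ → Maybe B

_outputs_on_ : ∀ {A B} → Algorithm A B → B → A → Set
alg outputs b on a = ∃[ t ] (alg a t ≡ just b × (∀ s → s ℕ.< t → alg a s ≡ nothing))

{-# OPTIONS --safe #-}

-- Call z ∉ X an observer of X if X ∪ {z} is lattice-convex.  If z ∉ X is not an observer and is
-- larger than all points of X, then the hull of X ∪ {z} contains another lattice point outside X,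
-- and that point is smaller than z.  By descent, if all observers lie in a box, then half-spaces
-- that contain X and together exclude the rest of the box exclude all of ℤᵈ ∖ X.  By the Farkas
-- lemma a finite set that is separated from X by a real half-space is separated by an integral one,
-- and as X affinely spans the space, equations exclude nothing.  So both complexities equal the
-- least number of half-spaces that separate X from the rest of the box.  The algorithm runs through
-- the boxes of growing size, computes such a minimal family, and stops as soon as the family
-- describes X in all of ℤᵈ, which is decidable; hence no bound on the observers has to be computed.
--
-- The observers are bounded in all three cases.  (a) If z is congruent to x ∈ X modulo 2, then the
-- midpoint of x and z lies in X.  (b) If p is interior, then Dirichlet's theorem gives a
-- lattice point p + v so close to the segment from p to z that it lies in the hull of X ∪ {z}, hence
-- in X ∪ {z}; this bounds v, and with it z.  (c) An observer z makes conv (X ∪ {z}) one of finitely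
-- many polytopes up to unimodular equivalence, and z is determined by its image and the images of
-- the points of X.

module Submission where

open import Algebra.Bundles using (CommutativeRing)
open import Data.Empty using (⊥)
open import Data.Fin.Base using (Fin; zero; suc; toℕ; fromℕ<; funToFin; finToFun; punchIn; punchOut)
import Data.Fin.Properties as Finₚ
open import Data.Integer.Base as ℤ using (ℤ; +_; 0ℤ; 1ℤ; -1ℤ)
import Data.Integer.DivMod as ℤ/
import Data.Integer.Divisibility as ℤ∣
import Data.Integer.Divisibility.Signed as Signed
import Data.Integer.Properties as ℤₚ
open import Data.Integer.Tactic.RingSolver using (solve-∀)
open import Data.List.Base as List using (List; []; _∷_; _++_; length)
import Data.List.Membership.DecPropositional as DecMembership
open import Data.List.Membership.Propositional using (_∈_; _∉_)
open import Data.List.Membership.Propositional.Properties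
import Data.List.Properties as Listₚ
open import Data.List.Relation.Unary.All as All using (All; []; _∷_)
open import Data.List.Relation.Unary.Any as Any using (here; there)
import Data.List.Relation.Unary.AllPairs as AllPairs
import Data.List.Relation.Unary.Any.Properties as Anyₚ
import Data.List.Relation.Unary.Unique.DecPropositional.Properties as Uniqueₚ
open import Data.Maybe.Base using (just; nothing)
open import Data.Nat.Base as ℕ using (ℕ; zero; suc)
import Data.Nat.DivMod as ℕ/
open import Data.Nat.Induction using (<-rec)
import Data.Nat.Properties as ℕₚ
open import Data.Product.Base using (∃-syntax; _×_; _,_; proj₁; proj₂; Σ-syntax)
open import Data.Rational.Base as ℚ using (ℚ; 0ℚ; 1ℚ; ½)
import Data.Rational.Properties as ℚₚ
open import Data.Rational.Solver using (module +-*-Solver)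
import Data.Rational.Unnormalised.Base as ℚᵘ
import Data.Rational.Unnormalised.Properties as ℚᵘₚ
open import Data.Sum.Base as Sum using (_⊎_; inj₁; inj₂)
open import Data.Vec.Base as Vec using ([]; _∷_)
open import Data.Vec.Functional as Vector using (Vector)
import Data.Vec.Functional.Properties as Vectorₚ
import Data.Vec.Properties as Vecₚ
open import Function.Base using (_∘_; id)
open import Function.Bundles using (_⇔_; mk⇔; Equivalence)
open import Level using (0ℓ)
open import Relation.Binary.Definitions using (DecidableEquality)
open import Relation.Binary.PropositionalEquality
open import Relation.Nullary using (yes; no; Dec)
open import Relation.Nullary.Decidable using (¬?; _×-dec_; _→-dec_; map′; decidable-stable)
open import Relation.Nullary.Negation using (¬_; contradiction)
open import Relation.Unary using (Pred; _⊆_; Decidable)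
open import Algebra.Properties.Semiring.Sum (CommutativeRing.semiring ℚₚ.+-*-commutativeRing) using (sum; sum-cong-≗; ∑-distrib-+; ∑-comm; *-distribˡ-sum; *-distribʳ-sum; sum-replicate-zero)
open import Defs
open +-*-Solver using (solve; _:+_; _:*_; :-_; _:-_; _:=_; con)
open ℝ

-- Points are homogenised by `hat`, so that half-spaces become integral linear functionals and hulls
-- become integer cones, with a positive factor `suc k` in place of denominators. Membership in a
-- hull, separability of two lists, boundedness of a polyhedron and affine dependence are then all
-- decided by one constructive Farkas lemma over ℤ.
--
-- The obstacle is the reals. Their order is undecidable, so it cannot be found out which inequality
-- of a real description a given point violates, and the coefficients cannot simply be rounded. Two
-- devices avoid this. An integral Farkas certificate is a nonnegative combination, which can be
-- applied to a real functional through its rational approximations. And the statement that j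
-- half-spaces suffice for a box is decidable, so that it may be derived by double negation.
--
-- Each of the three conditions also has to yield that X is nonempty and affinely spanning. The
-- lower bound on the complexities then holds for every box, since a description of X excludes in
-- particular the points of the box; hence the first output is correct even if the box does not yet
-- contain all observers.

private variable
  n d k : ℕ
  I : Set

-- Integer vectors and their inner product

infixl 6 _⊕_
infixr 7 _⊛_
infix  9 ⊝_
infix  7 _∙_

_⊕_ : ℤ^ n → ℤ^ n → ℤ^ n
_⊕_ = Vec.zipWith ℤ._+_

_⊛_ : ℤ → ℤ^ n → ℤ^ n
k ⊛ v = Vec.map (k ℤ.*_) v

⊝_ : ℤ^ n → ℤ^ n
⊝_ = Vec.map (ℤ.-_)

𝟘 : ℤ^ n
𝟘 = Vec.replicate _ 0ℤ

_∙_ : ℤ^ n → ℤ^ n → ℤ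
[]      ∙ []      = 0ℤ
(a ∷ u) ∙ (b ∷ v) = a ℤ.* b ℤ.+ u ∙ v

⊕-identityˡ : (u : ℤ^ n) → 𝟘 ⊕ u ≡ u
⊕-identityˡ []      = refl
⊕-identityˡ (a ∷ u) = cong₂ _∷_ (ℤₚ.+-identityˡ a) (⊕-identityˡ u)

⊕-assoc : (u v w : ℤ^ n) → (u ⊕ v) ⊕ w ≡ u ⊕ (v ⊕ w)
⊕-assoc []      []      []      = refl
⊕-assoc (a ∷ u) (b ∷ v) (c ∷ w) = cong₂ _∷_ (ℤₚ.+-assoc a b c) (⊕-assoc u v w)

⊕-comm : (u v : ℤ^ n) → u ⊕ v ≡ v ⊕ u
⊕-comm []      []      = refl
⊕-comm (a ∷ u) (b ∷ v) = cong₂ _∷_ (ℤₚ.+-comm a b) (⊕-comm u v)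

⊕-identityʳ : (u : ℤ^ n) → u ⊕ 𝟘 ≡ u
⊕-identityʳ u = trans (⊕-comm u 𝟘) (⊕-identityˡ u)

⊛-zero : (v : ℤ^ n) → 0ℤ ⊛ v ≡ 𝟘
⊛-zero []      = refl
⊛-zero (a ∷ v) = cong₂ _∷_ (ℤₚ.*-zeroˡ a) (⊛-zero v)

⊛-𝟘 : ∀ k → k ⊛ 𝟘 {n} ≡ 𝟘
⊛-𝟘 {zero}  k = refl
⊛-𝟘 {suc n} k = cong₂ _∷_ (ℤₚ.*-zeroʳ k) (⊛-𝟘 k)

⊛-identity : (v : ℤ^ n) → 1ℤ ⊛ v ≡ v
⊛-identity []      = refl
⊛-identity (a ∷ v) = cong₂ _∷_ (ℤₚ.*-identityˡ a) (⊛-identity v)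

⊛-suc : ∀ k (v : ℤ^ n) → + suc k ⊛ v ≡ v ⊕ (+ k ⊛ v)
⊛-suc k []      = refl
⊛-suc k (a ∷ v) = cong₂ _∷_ (ℤₚ.suc-* (+ k) a) (⊛-suc k v)

⊛-assoc : ∀ k l (v : ℤ^ n) → (k ℤ.* l) ⊛ v ≡ k ⊛ l ⊛ v
⊛-assoc k l []      = refl
⊛-assoc k l (a ∷ v) = cong₂ _∷_ (ℤₚ.*-assoc k l a) (⊛-assoc k l v)

⊛-distribˡ : ∀ k (u v : ℤ^ n) → k ⊛ (u ⊕ v) ≡ k ⊛ u ⊕ k ⊛ v
⊛-distribˡ k []      []      = refl
⊛-distribˡ k (a ∷ u) (b ∷ v) = cong₂ _∷_ (ℤₚ.*-distribˡ-+ k a b) (⊛-distribˡ k u v)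

⊕-cancelˡ : (u v : ℤ^ n) → u ⊕ v ≡ u → v ≡ 𝟘
⊕-cancelˡ []      []      _  = refl
⊕-cancelˡ (a ∷ u) (b ∷ v) eq = cong₂ _∷_
  (trans (recover a b) (trans (cong (ℤ._- a) (Vecₚ.∷-injectiveˡ eq)) (ℤₚ.+-inverseʳ a))) (⊕-cancelˡ u v (Vecₚ.∷-injectiveʳ eq))
  where
  recover : ∀ a b → b ≡ (a ℤ.+ b) ℤ.- a
  recover = solve-∀

⊕-inverseʳ : (v : ℤ^ n) → v ⊕ ⊝ v ≡ 𝟘
⊕-inverseʳ []      = refl
⊕-inverseʳ (a ∷ v) = cong₂ _∷_ (ℤₚ.+-inverseʳ a) (⊕-inverseʳ v)

⊕-inverse-unique : (u v : ℤ^ n) → u ⊕ v ≡ 𝟘 → v ≡ ⊝ u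
⊕-inverse-unique []      []      _  = refl
⊕-inverse-unique (a ∷ u) (b ∷ v) eq = cong₂ _∷_
  (trans (recover a b) (trans (cong (ℤ._- a) (Vecₚ.∷-injectiveˡ eq)) (ℤₚ.+-identityˡ _))) (⊕-inverse-unique u v (Vecₚ.∷-injectiveʳ eq))
  where
  recover : ∀ a b → b ≡ (a ℤ.+ b) ℤ.- a
  recover = solve-∀

⊝-as-⊛ : (v : ℤ^ n) → ⊝ v ≡ -1ℤ ⊛ v
⊝-as-⊛ []      = refl
⊝-as-⊛ (a ∷ v) = cong₂ _∷_ (sym (ℤₚ.-1*i≡-i a)) (⊝-as-⊛ v)

∙-comm : (u v : ℤ^ n) → u ∙ v ≡ v ∙ u
∙-comm []      []      = refl
∙-comm (a ∷ u) (b ∷ v) = cong₂ ℤ._+_ (ℤₚ.*-comm a b) (∙-comm u v)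

∙-⊕ʳ : (u v w : ℤ^ n) → u ∙ (v ⊕ w) ≡ u ∙ v ℤ.+ u ∙ w
∙-⊕ʳ []      []      []      = refl
∙-⊕ʳ (a ∷ u) (b ∷ v) (c ∷ w) rewrite ∙-⊕ʳ u v w = lemma a b c (u ∙ v) (u ∙ w)
  where
  lemma : ∀ a b c x y → a ℤ.* (b ℤ.+ c) ℤ.+ (x ℤ.+ y) ≡ (a ℤ.* b ℤ.+ x) ℤ.+ (a ℤ.* c ℤ.+ y)
  lemma = solve-∀

∙-⊛ʳ : ∀ k (u v : ℤ^ n) → u ∙ (k ⊛ v) ≡ k ℤ.* (u ∙ v)
∙-⊛ʳ k []      []      = sym (ℤₚ.*-zeroʳ k)
∙-⊛ʳ k (a ∷ u) (b ∷ v) rewrite ∙-⊛ʳ k u v = lemma k a b (u ∙ v)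
  where
  lemma : ∀ k a b x → a ℤ.* (k ℤ.* b) ℤ.+ k ℤ.* x ≡ k ℤ.* (a ℤ.* b ℤ.+ x)
  lemma = solve-∀

∙-𝟘ʳ : (u : ℤ^ n) → u ∙ 𝟘 ≡ 0ℤ
∙-𝟘ʳ []      = refl
∙-𝟘ʳ (a ∷ u) rewrite ∙-𝟘ʳ u = trans (ℤₚ.+-identityʳ _) (ℤₚ.*-zeroʳ a)

∙-⊝ʳ : (u v : ℤ^ n) → u ∙ ⊝ v ≡ ℤ.- (u ∙ v)
∙-⊝ʳ u v rewrite ⊝-as-⊛ v = trans (∙-⊛ʳ -1ℤ u v) (ℤₚ.-1*i≡-i (u ∙ v))

∙-⊕ˡ : (u v w : ℤ^ n) → (u ⊕ v) ∙ w ≡ u ∙ w ℤ.+ v ∙ w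
∙-⊕ˡ u v w rewrite ∙-comm (u ⊕ v) w | ∙-comm u w | ∙-comm v w = ∙-⊕ʳ w u v

∙-⊛ˡ : ∀ k (u v : ℤ^ n) → (k ⊛ u) ∙ v ≡ k ℤ.* (u ∙ v)
∙-⊛ˡ k u v rewrite ∙-comm (k ⊛ u) v | ∙-comm u v = ∙-⊛ʳ k v u

∙-⊝ˡ : (u v : ℤ^ n) → (⊝ u) ∙ v ≡ ℤ.- (u ∙ v)
∙-⊝ˡ u v rewrite ∙-comm (⊝ u) v | ∙-comm u v = ∙-⊝ʳ v u

∙-𝟘ˡ : (u : ℤ^ n) → 𝟘 ∙ u ≡ 0ℤ
∙-𝟘ˡ u = trans (∙-comm 𝟘 u) (∙-𝟘ʳ u)

0≤i+j : ∀ {i j} → 0ℤ ℤ.≤ i → 0ℤ ℤ.≤ j → 0ℤ ℤ.≤ i ℤ.+ j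
0≤i+j p q = ℤₚ.+-mono-≤ p q

0≤i*j : ∀ {i j} → 0ℤ ℤ.≤ i → 0ℤ ℤ.≤ j → 0ℤ ℤ.≤ i ℤ.* j
0≤i*j {i} {j} p q = subst (ℤ._≤ i ℤ.* j) (ℤₚ.*-zeroʳ i) (ℤₚ.*-monoˡ-≤-nonNeg i {{ℤ.nonNegative p}} q)

0≤i*i : ∀ i → 0ℤ ℤ.≤ i ℤ.* i
0≤i*i (+ n)      = 0≤i*j {+ n} {+ n} (ℤ.+≤+ ℕ.z≤n) (ℤ.+≤+ ℕ.z≤n)
0≤i*i ℤ.-[1+ n ] = ℤ.+≤+ ℕ.z≤n

0≤-i : ∀ {i} → i ℤ.≤ 0ℤ → 0ℤ ℤ.≤ ℤ.- i
0≤-i = ℤₚ.neg-mono-≤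

∙-self-nonneg : (v : ℤ^ n) → 0ℤ ℤ.≤ v ∙ v
∙-self-nonneg []      = ℤₚ.≤-refl
∙-self-nonneg (a ∷ v) = 0≤i+j (0≤i*i a) (∙-self-nonneg v)

sum≡0 : ∀ {i j} → 0ℤ ℤ.≤ i → 0ℤ ℤ.≤ j → i ℤ.+ j ≡ 0ℤ → i ≡ 0ℤ × j ≡ 0ℤ
sum≡0 {+ m} {+ k} _ _ eq =
  cong +_ (ℕₚ.m+n≡0⇒m≡0 m (ℤₚ.+-injective eq)) , cong +_ (ℕₚ.m+n≡0⇒n≡0 m (ℤₚ.+-injective eq))
  where import Data.Nat.Properties as ℕₚ

∙-self-zero : (v : ℤ^ n) → v ∙ v ≡ 0ℤ → v ≡ 𝟘
∙-self-zero []      _  = refl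
∙-self-zero (a ∷ v) eq =
  let p , q = sum≡0 (0≤i*i a) (∙-self-nonneg v) eq
  in cong₂ _∷_ (Sum.[ id , id ] (ℤₚ.i*j≡0⇒i≡0∨j≡0 a p)) (∙-self-zero v q)

-- Integer cones and the Farkas lemma

data Cone (G : Pred (ℤ^ n) 0ℓ) : Pred (ℤ^ n) 0ℓ where
  origin : Cone G 𝟘
  _◂_    : ∀ {g v} → G g → Cone G v → Cone G (g ⊕ v)

infixr 5 _◂_

module _ {G : Pred (ℤ^ n) 0ℓ} where

  cone-generator : ∀ {g} → G g → Cone G g
  cone-generator {g} p = subst (Cone G) (⊕-identityʳ g) (p ◂ origin)

  cone-⊕ : ∀ {u v} → Cone G u → Cone G v → Cone G (u ⊕ v)
  cone-⊕ {v = v} origin d = subst (Cone G) (sym (⊕-identityˡ v)) d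
  cone-⊕ {v = v} (_◂_ {g} {u} p c) d = subst (Cone G) (sym (⊕-assoc g u v)) (p ◂ cone-⊕ c d)

  cone-⊛ℕ : ∀ k {v} → Cone G v → Cone G (+ k ⊛ v)
  cone-⊛ℕ zero    {v} c = subst (Cone G) (sym (⊛-zero v)) origin
  cone-⊛ℕ (suc k) {v} c = subst (Cone G) (sym (⊛-suc k v)) (cone-⊕ c (cone-⊛ℕ k c))

  cone-⊛ : ∀ {k v} → 0ℤ ℤ.≤ k → Cone G v → Cone G (k ⊛ v)
  cone-⊛ {+ k} _ = cone-⊛ℕ k

  cone-fold : (P : Pred (ℤ^ n) 0ℓ) → P 𝟘 → (∀ {g v} → G g → P v → P (g ⊕ v)) → Cone G ⊆ P
  cone-fold P z s origin  = z
  cone-fold P z s (p ◂ c) = s p (cone-fold P z s c)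

  cone-nonneg : ∀ h → (∀ {g} → G g → 0ℤ ℤ.≤ h ∙ g) → ∀ {v} → Cone G v → 0ℤ ℤ.≤ h ∙ v
  cone-nonneg h nn = cone-fold (λ v → 0ℤ ℤ.≤ h ∙ v) (ℤₚ.≤-reflexive (sym (∙-𝟘ʳ h)))
    λ {g} {v} p q → subst (0ℤ ℤ.≤_) (sym (∙-⊕ʳ h g v)) (0≤i+j (nn p) q)

cone-bind : {G H : Pred (ℤ^ n) 0ℓ} → G ⊆ Cone H → Cone G ⊆ Cone H
cone-bind f = cone-fold _ origin (λ p c → cone-⊕ (f p) c)

-- Bartl's proof of the Farkas lemma: the induction eliminates the newest generator a by replacing
-- every other vector v by (v ∙ x) a − (a ∙ x) v, where x separates γ from the remaining generators
-- but not from a.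
private
  eliminate : ℤ^ n → ℤ^ n → ℤ^ n → ℤ^ n
  eliminate a x v = (ℤ.- (a ∙ x)) ⊛ v ⊕ (v ∙ x) ⊛ a

  pivot : ℤ^ n → ℤ^ n → ℤ^ n → ℤ^ n
  pivot a x y = (ℤ.- (a ∙ x)) ⊛ y ⊕ (a ∙ y) ⊛ x

  -- `pivot` is the transpose of `eliminate`: it carries a functional that separates the eliminated
  -- vectors back to the original ones, and by `pivot-self` it vanishes on a itself.
  eliminate-pivot : ∀ (a x v y : ℤ^ n) → v ∙ pivot a x y ≡ eliminate a x v ∙ y
  eliminate-pivot a x v y
    rewrite ∙-⊕ʳ v ((ℤ.- (a ∙ x)) ⊛ y) ((a ∙ y) ⊛ x)
          | ∙-⊛ʳ (ℤ.- (a ∙ x)) v y | ∙-⊛ʳ (a ∙ y) v x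
          | ∙-⊕ˡ ((ℤ.- (a ∙ x)) ⊛ v) ((v ∙ x) ⊛ a) y
          | ∙-⊛ˡ (ℤ.- (a ∙ x)) v y | ∙-⊛ˡ (v ∙ x) a y
    = cong (λ t → ℤ.- (a ∙ x) ℤ.* (v ∙ y) ℤ.+ t) (ℤₚ.*-comm (a ∙ y) (v ∙ x))

  pivot-self : ∀ (a x y : ℤ^ n) → a ∙ pivot a x y ≡ 0ℤ
  pivot-self a x y
    rewrite ∙-⊕ʳ a ((ℤ.- (a ∙ x)) ⊛ y) ((a ∙ y) ⊛ x)
          | ∙-⊛ʳ (ℤ.- (a ∙ x)) a y | ∙-⊛ʳ (a ∙ y) a x
    = lemma (a ∙ x) (a ∙ y)
    where
    lemma : ∀ p q → ℤ.- p ℤ.* q ℤ.+ q ℤ.* p ≡ 0ℤ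
    lemma = solve-∀

  eliminate-inverse : ∀ (a x v : ℤ^ n) →
    (ℤ.- (a ∙ x)) ⊛ v ≡ eliminate a x v ⊕ (ℤ.- (v ∙ x)) ⊛ a
  eliminate-inverse a x v = lemma (ℤ.- (a ∙ x)) (v ∙ x) v a
    where
    entry : ∀ p q b c → p ℤ.* b ≡ (p ℤ.* b ℤ.+ q ℤ.* c) ℤ.+ ℤ.- q ℤ.* c
    entry = solve-∀
    lemma : ∀ {n} p q (v a : ℤ^ n) → p ⊛ v ≡ (p ⊛ v ⊕ q ⊛ a) ⊕ (ℤ.- q) ⊛ a
    lemma p q []      []      = refl
    lemma p q (b ∷ v) (c ∷ a) = cong₂ _∷_ (entry p q b c) (lemma p q v a)

-- The generators form a family over a list of indices, so that the induction can replace all of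
-- them by their eliminated versions while it recurses on the list alone.
Image : (I → ℤ^ n) → List I → Pred (ℤ^ n) 0ℓ
Image f is v = ∃[ i ] (i ∈ is × v ≡ f i)

farkas : ∀ (f : I → ℤ^ n) is γ →
  (∃[ x ] ((∀ {i} → i ∈ is → 0ℤ ℤ.≤ f i ∙ x) × γ ∙ x ℤ.< 0ℤ)) ⊎
  (∃[ k ] Cone (Image f is) (+ suc k ⊛ γ))
-- Without generators the cone contains only 𝟘; a nonzero γ is cut off by -γ, because γ ∙ γ > 0.
farkas f [] γ with γ ∙ γ ℤₚ.≟ 0ℤ
... | yes eq = inj₂ (0 , subst (Cone _) (sym (trans (⊛-identity γ) (∙-self-zero γ eq))) origin)
... | no neq = inj₁ (⊝ γ , (λ ()) , subst (ℤ._< 0ℤ) (sym (∙-⊝ʳ γ γ))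
    (ℤₚ.neg-mono-< (ℤₚ.≤∧≢⇒< (∙-self-nonneg γ) (neq ∘ sym))))
farkas f (j ∷ is) γ with farkas f is γ
... | inj₂ (k , c) = inj₂ (k , cone-bind (λ (i , p , e) → cone-generator (i , there p , e)) c)
... | inj₁ (x , nn , neg) with 0ℤ ℤₚ.≤? f j ∙ x
...   | yes 0≤ = inj₁ (x , (λ { (here refl) → 0≤ ; (there p) → nn p }) , neg)
...   | no 0≰ with farkas (eliminate (f j) x ∘ f) is (eliminate (f j) x γ)
...     | inj₁ (y , nn′ , neg′) = inj₁ (pivot a x y ,
            (λ { {_} (here refl) → ℤₚ.≤-reflexive (sym (pivot-self a x y))
               ; {i} (there p) → subst (0ℤ ℤ.≤_) (sym (eliminate-pivot a x (f i) y)) (nn′ p) }) ,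
            subst (ℤ._< 0ℤ) (sym (eliminate-pivot a x γ y)) neg′)
  where a = f j
...     | inj₂ (k , c) = inj₂ (l , subst (Cone _) eq sum-cone)
  where
  a = f j
  -- Both -(a ∙ x) and -(γ ∙ x) are positive and all f i ∙ x are nonnegative, so undoing the
  -- elimination adds only nonnegative multiples of generators.
  0<-ax : 0ℤ ℤ.< ℤ.- (a ∙ x)
  0<-ax = ℤₚ.neg-mono-< (ℤₚ.≰⇒> 0≰)
  0≤-ax = ℤₚ.<⇒≤ 0<-ax
  eliminated : ∀ {g} → Image (eliminate a x ∘ f) is g → Cone (Image f (j ∷ is)) g
  eliminated (i , p , refl) = cone-⊕
    (cone-⊛ 0≤-ax (cone-generator (i , there p , refl)))
    (cone-⊛ (nn p) (cone-generator (j , here refl , refl)))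
  sum-cone = cone-⊕ (cone-bind eliminated c)
    (cone-⊛ {k = + suc k ℤ.* ℤ.- (γ ∙ x)}
      (0≤i*j {+ suc k} (ℤ.+≤+ ℕ.z≤n) (ℤₚ.<⇒≤ (ℤₚ.neg-mono-< neg)))
      (cone-generator (j , here refl , refl)))
  positive : ∀ {i} → 0ℤ ℤ.< i → ∃[ m ] i ≡ + suc m
  positive {+ suc m} _ = m , refl
  positive {+ zero} (ℤ.+<+ ())
  m = proj₁ (positive 0<-ax)
  -- `suc l` is the product of `suc k` and `suc m`, where `+ suc m` is -(a ∙ x).
  l = m ℕ.+ k ℕ.* suc m
  open ≡-Reasoning
  eq : + suc k ⊛ eliminate a x γ ⊕ (+ suc k ℤ.* ℤ.- (γ ∙ x)) ⊛ a ≡ + suc l ⊛ γ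
  eq = begin
    + suc k ⊛ eliminate a x γ ⊕ (+ suc k ℤ.* ℤ.- (γ ∙ x)) ⊛ a
      ≡⟨ cong (+ suc k ⊛ eliminate a x γ ⊕_) (⊛-assoc (+ suc k) (ℤ.- (γ ∙ x)) a) ⟩
    + suc k ⊛ eliminate a x γ ⊕ + suc k ⊛ (ℤ.- (γ ∙ x)) ⊛ a
      ≡⟨ ⊛-distribˡ (+ suc k) (eliminate a x γ) ((ℤ.- (γ ∙ x)) ⊛ a) ⟨
    + suc k ⊛ (eliminate a x γ ⊕ (ℤ.- (γ ∙ x)) ⊛ a)
      ≡⟨ cong ((+ suc k) ⊛_) (eliminate-inverse a x γ) ⟨
    + suc k ⊛ (ℤ.- (a ∙ x)) ⊛ γ
      ≡⟨ ⊛-assoc (+ suc k) (ℤ.- (a ∙ x)) γ ⟨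
    (+ suc k ℤ.* ℤ.- (a ∙ x)) ⊛ γ
      ≡⟨ cong (λ t → (+ suc k ℤ.* t) ⊛ γ) (proj₂ (positive 0<-ax)) ⟩
    (+ suc k ℤ.* + suc m) ⊛ γ
      ≡⟨ cong (_⊛ γ) (ℤₚ.pos-* (suc k) (suc m)) ⟨
    + suc l ⊛ γ ∎

farkas-list : ∀ (G : List (ℤ^ n)) γ →
  (∃[ h ] ((∀ {g} → g ∈ G → 0ℤ ℤ.≤ h ∙ g) × h ∙ γ ℤ.< 0ℤ)) ⊎
  (∃[ k ] Cone (_∈ G) (+ suc k ⊛ γ))
farkas-list G γ with farkas id G γ
... | inj₁ (h , nn , neg) = inj₁ (h ,
        (λ {g} p → subst (0ℤ ℤ.≤_) (∙-comm g h) (nn p)) ,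
        subst (ℤ._< 0ℤ) (∙-comm γ h) neg)
... | inj₂ (k , c) = inj₂ (k , cone-bind (λ { (_ , p , refl) → cone-generator p }) c)

-- Hulls and integral half-spaces

infix 4 _≟_ _∈?_

_≟_ : DecidableEquality (ℤ^ d)
_≟_ = Vecₚ.≡-dec ℤₚ._≟_

_∈?_ : ∀ (z : ℤ^ d) X → Dec (z ∈ X)
_∈?_ = DecMembership._∈?_ _≟_

-- Homogenisation: an affine functional on ℤᵈ is a linear one on these vectors, with its constant
-- term at the head.
hat : ℤ^ d → ℤ^ (suc d)
hat x = 1ℤ ∷ x

Hat : List (ℤ^ d) → Pred (ℤ^ (suc d)) 0ℓ
Hat X g = ∃[ x ] (x ∈ X × g ≡ hat x)

-- A convex combination with rational weights over the common denominator `suc k`: the first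
-- coordinate of `+ suc k ⊛ hat z` counts the generators used, so the weights sum to 1.
InHull : List (ℤ^ d) → ℤ^ d → Set
InHull X z = ∃[ k ] Cone (Hat X) (+ suc k ⊛ hat z)

Separates : ℤ^ (suc d) → List (ℤ^ d) → List (ℤ^ d) → Set
Separates h X Y = (∀ {x} → x ∈ X → 0ℤ ℤ.≤ h ∙ hat x) × (∀ {y} → y ∈ Y → h ∙ hat y ℤ.< 0ℤ)

Separable : List (ℤ^ d) → List (ℤ^ d) → Set
Separable X Y = ∃[ h ] Separates h X Y

SignedHat : List (ℤ^ d) → List (ℤ^ d) → Pred (ℤ^ (suc d)) 0ℓ
SignedHat X Y g = Hat X g ⊎ (∃[ y ] (y ∈ Y × g ≡ ⊝ hat y))

-- The Farkas certificate against separation: a functional that is nonnegative on X and negative on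
-- Y would be nonnegative on the signed cone, hence at y. Being a nonnegative combination, it
-- refutes real functionals as well.
Obstruction : List (ℤ^ d) → List (ℤ^ d) → Set
Obstruction X Y = ∃[ y ] (y ∈ Y × (∃[ k ] Cone (SignedHat X Y) (+ suc k ⊛ hat y)))

neg*-neg : ∀ k {i} → i ℤ.< 0ℤ → + suc k ℤ.* i ℤ.< 0ℤ
neg*-neg k {i} p = subst (+ suc k ℤ.* i ℤ.<_) (ℤₚ.*-zeroʳ (+ suc k)) (ℤₚ.*-monoˡ-<-pos (+ suc k) p)

separates⇒¬obstruction : ∀ {X Y : List (ℤ^ d)} → Separable X Y → ¬ Obstruction X Y
separates⇒¬obstruction (h , nn , neg) (y , y∈Y , k , c) =
  ℤₚ.<⇒≱ (neg*-neg k (neg y∈Y)) (subst (0ℤ ℤ.≤_) (∙-⊛ʳ (+ suc k) h (hat y)) (cone-nonneg h signed c))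
  where
  signed : ∀ {g} → SignedHat _ _ g → 0ℤ ℤ.≤ h ∙ g
  signed (inj₁ (x , p , refl)) = nn p
  signed (inj₂ (y , p , refl)) = subst (0ℤ ℤ.≤_) (sym (∙-⊝ʳ h (hat y))) (0≤-i (ℤₚ.<⇒≤ (neg p)))

-- Farkas gives, for one y at a time, a functional that is ≥ 0 on X, ≤ 0 on Y and < 0 at y. The sum
-- of these functionals over Y is negative on all of Y, as each summand is ≤ 0 there and one of them
-- is strict.
separable-or-obstruction : ∀ (X Y : List (ℤ^ d)) → Separable X Y ⊎ Obstruction X Y
separable-or-obstruction X Y with partial Y id
  where
  Partial : List _ → Set
  Partial L = ∃[ h ] ((∀ {x} → x ∈ X → 0ℤ ℤ.≤ h ∙ hat x) ×
    (∀ {y} → y ∈ Y → h ∙ hat y ℤ.≤ 0ℤ) × (∀ {y} → y ∈ L → h ∙ hat y ℤ.< 0ℤ))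
  G = List.map hat X ++ List.map (⊝_ ∘ hat) Y
  signed : ∀ {g} → g ∈ G → SignedHat X Y g
  signed = Sum.map (∈-map⁻ hat) (∈-map⁻ (⊝_ ∘ hat)) ∘ ∈-++⁻ (List.map hat X)
  partial : ∀ L → (∀ {y} → y ∈ L → y ∈ Y) → Partial L ⊎ Obstruction X Y
  partial []      _   = inj₁ (𝟘 , (λ {x} _ → ℤₚ.≤-reflexive (sym (∙-𝟘ˡ (hat x)))) ,
                                  (λ {y} _ → ℤₚ.≤-reflexive (∙-𝟘ˡ (hat y))) , λ ())
  partial (y ∷ L) L⊆Y with partial L (L⊆Y ∘ there) | farkas-list G (hat y)
  ... | inj₂ o | _ = inj₂ o
  ... | inj₁ _ | inj₂ (k , c) =
    inj₂ (y , L⊆Y (here refl) , k , cone-bind (cone-generator ∘ signed) c)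
  ... | inj₁ (h , nn , np , neg) | inj₁ (h′ , nn′ , neg′) = inj₁ (h ⊕ h′ ,
    (λ {x} p → subst (0ℤ ℤ.≤_) (sym (∙-⊕ˡ h h′ (hat x)))
      (0≤i+j (nn p) (nn′ (∈-++⁺ˡ (∈-map⁺ hat p))))) ,
    (λ {x} p → subst (ℤ._≤ 0ℤ) (sym (∙-⊕ˡ h h′ (hat x))) (ℤₚ.+-mono-≤ (np p) (np′ p))) ,
    λ { (here refl) → subst (ℤ._< 0ℤ) (sym (∙-⊕ˡ h h′ (hat y)))
          (ℤₚ.+-mono-≤-< (np (L⊆Y (here refl))) neg′)
      ; {x} (there p) → subst (ℤ._< 0ℤ) (sym (∙-⊕ˡ h h′ (hat x)))
          (ℤₚ.+-mono-<-≤ (neg p) (np′ (L⊆Y (there p)))) })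
    where
    np′ : ∀ {x} → x ∈ Y → h′ ∙ hat x ℤ.≤ 0ℤ
    np′ {x} p = ℤₚ.neg-cancel-≤ (subst (0ℤ ℤ.≤_) (∙-⊝ʳ h′ (hat x))
      (nn′ (∈-++⁺ʳ (List.map hat X) (∈-map⁺ (⊝_ ∘ hat) p))))
... | inj₁ (h , nn , _ , neg) = inj₁ (h , nn , neg)
... | inj₂ o                  = inj₂ o

separable? : ∀ (X Y : List (ℤ^ d)) → Dec (Separable X Y)
separable? X Y with separable-or-obstruction X Y
... | inj₁ s = yes s
... | inj₂ o = no λ s → separates⇒¬obstruction s o

-- Coverings of a list by k lists with a given property

module _ {A : Set} where

  -- A finite search tree: each point in turn chooses one of the k bins, and `Q` is tested on the
  -- finished bins only. Hence `Cover` is decidable as soon as `Q` is.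
  Cover : Pred (List A) 0ℓ → Vector (List A) k → List A → Set
  Cover Q bins []       = ∀ i → Q (bins i)
  Cover Q bins (y ∷ ys) = ∃[ i ] Cover Q (Vector.updateAt bins i (y ∷_)) ys

  cover? : ∀ {Q} → Decidable Q → (bins : Vector (List A) k) → Decidable (Cover Q bins)
  cover? Q? bins []       = Finₚ.all? (Q? ∘ bins)
  cover? Q? bins (y ∷ ys) = Finₚ.any? λ i → cover? Q? (Vector.updateAt bins i (y ∷_)) ys

  -- The sets `V i` may be infinite and undecidable; each point only has to name one of them. Every
  -- finished bin then lies within its `V i`.
  cover-intro : ∀ {Q} (V : Fin k → Pred A 0ℓ) → (∀ i L → (∀ {y} → y ∈ L → V i y) → Q L) →
    ∀ bins → (∀ i {y} → y ∈ bins i → V i y) →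
    ∀ ys → (∀ {y} → y ∈ ys → ∃[ i ] V i y) → Cover Q bins ys
  cover-intro V q bins b []       c = λ i → q i (bins i) (b i)
  cover-intro V q bins b (y ∷ ys) c with c (here refl)
  ... | i , v = i , cover-intro V q (Vector.updateAt bins i (y ∷_)) b′ ys (c ∘ there)
    where
    b′ : ∀ j {x} → x ∈ Vector.updateAt bins i (y ∷_) j → V j x
    b′ j p with j Finₚ.≟ i
    b′ j p | no j≢i rewrite Vectorₚ.updateAt-minimal j i {y ∷_} bins j≢i = b j p
    b′ j p | yes refl rewrite Vectorₚ.updateAt-updates i {y ∷_} bins with p
    ... | here refl = v
    ... | there p   = b i p

  -- The inclusion of `bins i` in `bins′ i` is the invariant that keeps a point in its bin while
  -- later points are distributed.
  cover-elim : ∀ {Q : Pred (List A) 0ℓ} (bins : Vector (List A) k) ys → Cover Q bins ys →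
    Σ[ bins′ ∈ Vector (List A) k ] ((∀ i → Q (bins′ i)) ×
      (∀ i {y} → y ∈ bins i → y ∈ bins′ i) × (∀ {y} → y ∈ ys → ∃[ i ] y ∈ bins′ i))
  cover-elim bins []       c       = bins , c , (λ i → id) , λ ()
  cover-elim bins (y ∷ ys) (i , c) with cover-elim (Vector.updateAt bins i (y ∷_)) ys c
  ... | bins′ , q , sub , cov = bins′ , q , (λ j p → sub j (grow j p)) ,
      λ { (here refl) → i , sub i (subst (y ∈_) (sym (Vectorₚ.updateAt-updates i bins)) (here refl))
        ; (there p)   → cov p }
    where
    grow : ∀ j {x} → x ∈ bins j → x ∈ Vector.updateAt bins i (y ∷_) j
    grow j p with j Finₚ.≟ i
    ... | no j≢i rewrite Vectorₚ.updateAt-minimal j i {y ∷_} bins j≢i = p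
    ... | yes refl rewrite Vectorₚ.updateAt-updates i {y ∷_} bins = there p

least : ∀ {P : Pred ℕ 0ℓ} → Decidable P → ∀ n → P n → ∃[ k ] IsLeast P k
least P? n p with P? 0
... | yes p₀ = 0 , p₀ , λ _ _ → ℕ.z≤n
least P? zero    p | no ¬p₀ = contradiction p ¬p₀
least {P} P? (suc n) p | no ¬p₀ with least (P? ∘ suc) n p
... | k , pₖ , min = suc k , pₖ , λ { zero q → contradiction q ¬p₀ ; (suc j) q → ℕ.s≤s (min j q) }

-- Integer polyhedra

∥_∥ : ℤ^ d → ℕ
∥ [] ∥    = 0
∥ a ∷ z ∥ = ℤ.∣ a ∣ ℕ.⊔ ∥ z ∥

entry≤norm : (z : ℤ^ d) (c : Fin d) → ℤ.∣ Vec.lookup z c ∣ ℕ.≤ ∥ z ∥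
entry≤norm (a ∷ z) zero    = ℕₚ.m≤m⊔n ℤ.∣ a ∣ ∥ z ∥
entry≤norm (a ∷ z) (suc c) = ℕₚ.≤-trans (entry≤norm z c) (ℕₚ.m≤n⊔m ℤ.∣ a ∣ ∥ z ∥)

norm≤ : ∀ {R} (z : ℤ^ d) → (∀ c → ℤ.∣ Vec.lookup z c ∣ ℕ.≤ R) → ∥ z ∥ ℕ.≤ R
norm≤ []      _ = ℕ.z≤n
norm≤ (a ∷ z) b = ℕₚ.⊔-lub (b zero) (norm≤ z (b ∘ suc))

norm< : ∀ {R} (z : ℤ^ d) → 0 ℕ.< R → (∀ c → ℤ.∣ Vec.lookup z c ∣ ℕ.< R) → ∥ z ∥ ℕ.< R
norm< {R = suc R} z _ b = ℕ.s≤s (norm≤ z (ℕ.s≤s⁻¹ ∘ b))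

maxNorm : List (ℤ^ d) → ℕ
maxNorm []      = 0
maxNorm (x ∷ X) = ∥ x ∥ ℕ.⊔ maxNorm X

norm≤maxNorm : ∀ {X : List (ℤ^ d)} {x} → x ∈ X → ∥ x ∥ ℕ.≤ maxNorm X
norm≤maxNorm {X = y ∷ X} (here refl) = ℕₚ.m≤m⊔n ∥ y ∥ (maxNorm X)
norm≤maxNorm {X = y ∷ X} (there p)   = ℕₚ.≤-trans (norm≤maxNorm p) (ℕₚ.m≤n⊔m ∥ y ∥ (maxNorm X))

range : ℕ → List ℤ
range R = List.map +_ (List.upTo (suc R)) ++ List.map (ℤ.-_ ∘ +_) (List.upTo (suc R))

∈-range : ∀ {R} i → ℤ.∣ i ∣ ℕ.≤ R → i ∈ range R
∈-range (+ m)      p = ∈-++⁺ˡ (∈-map⁺ +_ (∈-upTo⁺ (ℕ.s≤s p)))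
∈-range {R} ℤ.-[1+ m ] p =
  ∈-++⁺ʳ (List.map +_ (List.upTo (suc R))) (∈-map⁺ (ℤ.-_ ∘ +_) (∈-upTo⁺ {i = suc m} (ℕ.s≤s p)))

box : ∀ d → ℕ → List (ℤ^ d)
box zero    R = [] ∷ []
box (suc d) R = List.cartesianProductWith _∷_ (range R) (box d R)

∈-box : ∀ {R} (z : ℤ^ d) → ∥ z ∥ ℕ.≤ R → z ∈ box d R
∈-box []      _ = here refl
∈-box (a ∷ z) p = ∈-cartesianProductWith⁺ _∷_
  (∈-range a (ℕₚ.m⊔n≤o⇒m≤o ℤ.∣ a ∣ ∥ z ∥ p)) (∈-box z (ℕₚ.m⊔n≤o⇒n≤o ℤ.∣ a ∣ ∥ z ∥ p))

Polyhedron : Vector (ℤ^ (suc d)) k → Pred (ℤ^ d) 0ℓ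
Polyhedron H z = ∀ i → 0ℤ ℤ.≤ H i ∙ hat z

Exact : Vector (ℤ^ (suc d)) k → List (ℤ^ d) → Set
Exact H X = ∀ z → (z ∈ X → Polyhedron H z) × (Polyhedron H z → z ∈ X)

polyhedron-convex : ∀ (H : Vector (ℤ^ (suc d)) k) {X z} →
  (∀ {x} → x ∈ X → Polyhedron H x) → InHull X z → Polyhedron H z
polyhedron-convex H {X} {z} X⊆H (l , c) i = ℤₚ.*-cancelˡ-≤-pos 0ℤ (H i ∙ hat z) (+ suc l)
  (subst₂ ℤ._≤_ (sym (ℤₚ.*-zeroʳ (+ suc l))) (∙-⊛ʳ (+ suc l) (H i) (hat z))
    (cone-nonneg (H i) (λ { (x , p , refl) → X⊆H p i }) c))

unit : Fin d → ℤ^ d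
unit zero    = 1ℤ ∷ 𝟘
unit (suc c) = 0ℤ ∷ unit c

unit-∙ : ∀ (c : Fin d) z → unit c ∙ z ≡ Vec.lookup z c
unit-∙ zero    (a ∷ z) rewrite ∙-𝟘ˡ z = trans (ℤₚ.+-identityʳ _) (ℤₚ.*-identityˡ a)
unit-∙ (suc c) (a ∷ z) rewrite ℤₚ.*-zeroˡ a = trans (ℤₚ.+-identityˡ _) (unit-∙ c z)

uniform : ∀ {A : Set} {P : A → ℕ → Set} → (∀ {a l m} → l ℕ.≤ m → P a l → P a m) →
  ∀ L → (∀ {a} → a ∈ L → ∃[ B ] P a B) → ∃[ B ] (∀ {a} → a ∈ L → P a B)
uniform mono []      f = 0 , λ ()
uniform mono (a ∷ L) f with f (here refl) | uniform mono L (f ∘ there)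
... | B , p | C , q = B ℕ.⊔ C ,
  λ { (here refl) → mono (ℕₚ.m≤m⊔n B C) p ; (there r) → mono (ℕₚ.m≤n⊔m B C) (q r) }

-∣i∣≤i : ∀ i → ℤ.- + ℤ.∣ i ∣ ℤ.≤ i
-∣i∣≤i (+ n)      = ℤₚ.neg-≤-pos
-∣i∣≤i ℤ.-[1+ n ] = ℤₚ.≤-refl

i≤∣i∣ : ∀ i → i ℤ.≤ + ℤ.∣ i ∣
i≤∣i∣ (+ n)      = ℤₚ.≤-refl
i≤∣i∣ ℤ.-[1+ n ] = ℤ.-≤+

abs≤ : ∀ {i B} → ℤ.- + B ℤ.≤ i → i ℤ.≤ + B → ℤ.∣ i ∣ ℕ.≤ B
abs≤ {+ n}       _ q = ℤₚ.drop‿+≤+ q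
abs≤ {ℤ.-[1+ n ]} {suc B} (ℤ.-≤- p) _ = ℕ.s≤s p

LowerBound : Pred (ℤ^ d) 0ℓ → ℤ^ d → ℕ → Set
LowerBound S v β = ∀ {z} → S z → ℤ.- + β ℤ.≤ v ∙ z

lowerBound-mono : ∀ {S : Pred (ℤ^ d) 0ℓ} {v β γ} → β ℕ.≤ γ → LowerBound S v β → LowerBound S v γ
lowerBound-mono β≤γ b p = ℤₚ.≤-trans (ℤₚ.neg-mono-≤ (ℤ.+≤+ β≤γ)) (b p)

lowerBound-list : ∀ (X : List (ℤ^ d)) v → ∃[ β ] LowerBound (_∈ X) v β
lowerBound-list X v = uniform {P = λ x β → ℤ.- + β ℤ.≤ v ∙ x}
  (λ l≤m b → ℤₚ.≤-trans (ℤₚ.neg-mono-≤ (ℤ.+≤+ l≤m)) b) X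
  (λ {x} _ → ℤ.∣ v ∙ x ∣ , -∣i∣≤i (v ∙ x))

bounded-by-signed-units : ∀ {S : Pred (ℤ^ d) 0ℓ} {B} →
  (∀ c → LowerBound S (unit c) B × LowerBound S (⊝ unit c) B) → ∀ {z} → S z → ∥ z ∥ ℕ.≤ B
bounded-by-signed-units {B = B} b {z} s = norm≤ z λ c → abs≤
  (subst (ℤ.- + B ℤ.≤_) (unit-∙ c z) (proj₁ (b c) s))
  (ℤₚ.neg-cancel-≤ (subst (ℤ.- + B ℤ.≤_) (trans (∙-⊝ˡ (unit c) z) (cong ℤ.-_ (unit-∙ c z))) (proj₂ (b c) s)))

module _ (H : Vector (ℤ^ (suc d)) k) where

  private
    slopes : List (ℤ^ d)
    slopes = List.map (Vec.tail ∘ H) (List.allFin k)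

  -- A constraint h₀ + h ∙ z ≥ 0 bounds its own slope h from below by -|h₀|, and such bounds add up
  -- along the cone.
  cone-lowerBound : ∀ {v} → Cone (_∈ slopes) v → ∃[ β ] LowerBound (Polyhedron H) v β
  cone-lowerBound = cone-fold (λ v → ∃[ β ] LowerBound (Polyhedron H) v β) (0 , λ {z} _ → ℤₚ.≤-reflexive (sym (∙-𝟘ˡ z))) step
    where
    tail-bound : ∀ h z → 0ℤ ℤ.≤ h ∙ hat z → ℤ.- + ℤ.∣ Vec.head h ∣ ℤ.≤ Vec.tail h ∙ z
    tail-bound (a ∷ h) z p = ℤₚ.≤-trans (ℤₚ.neg-mono-≤ (i≤∣i∣ a)) (ℤₚ.0≤i-j⇒j≤i
      (subst (0ℤ ℤ.≤_) (lemma a (h ∙ z)) p))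
      where
      lemma : ∀ a b → a ℤ.* 1ℤ ℤ.+ b ≡ b ℤ.- ℤ.- a
      lemma = solve-∀
    step : ∀ {g v} → g ∈ slopes → ∃[ β ] LowerBound (Polyhedron H) v β →
      ∃[ β ] LowerBound (Polyhedron H) (g ⊕ v) β
    step {v = v} p (β , b) with ∈-map⁻ (Vec.tail ∘ H) p
    ... | i , _ , refl = ℤ.∣ Vec.head (H i) ∣ ℕ.+ β , λ {z} z∈H →
      subst₂ ℤ._≤_
        (trans (sym (ℤₚ.neg-distrib-+ (+ ℤ.∣ Vec.head (H i) ∣) (+ β))) (cong ℤ.-_ (sym (ℤₚ.pos-+ ℤ.∣ Vec.head (H i) ∣ β))))
        (sym (∙-⊕ˡ (Vec.tail (H i)) v z))
        (ℤₚ.+-mono-≤ (tail-bound (H i) z (z∈H i)) (b z∈H))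

  unscale : ∀ l β i → ℤ.- + β ℤ.≤ + suc l ℤ.* i → ℤ.- + β ℤ.≤ i
  unscale l β (+ m)       _ = ℤₚ.neg-≤-pos
  unscale l β i@(ℤ.-[1+ m ]) p = ℤₚ.≤-trans p (subst (+ suc l ℤ.* i ℤ.≤_) (ℤₚ.*-identityˡ i)
    (ℤₚ.*-monoʳ-≤-nonPos i (ℤ.+≤+ (ℕ.s≤s (ℕ.z≤n {l})))))

  module _ {X : List (ℤ^ d)} {x₀} (x₀∈X : x₀ ∈ X) where

    -- If X were the polyhedron, the ray from x₀ in direction w would stay in X, but v is unbounded
    -- below on the ray and bounded on the finite X.
    recession⇒¬exact : ∀ v w → (∀ i → 0ℤ ℤ.≤ Vec.tail (H i) ∙ w) → v ∙ w ℤ.< 0ℤ → ¬ Exact H X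
    recession⇒¬exact v w rec neg exact = ℤₚ.<⇒≱ below (proj₂ (lowerBound-list X v) z∈X)
      where
      β = proj₁ (lowerBound-list X v)
      -- As v ∙ w ≤ -1, this many steps along w bring v from at most |v ∙ x₀| to below -β.
      m = suc (ℤ.∣ v ∙ x₀ ∣ ℕ.+ β)
      z = x₀ ⊕ + m ⊛ w
      head-tail : ∀ h → h ∙ hat z ≡ h ∙ hat x₀ ℤ.+ + m ℤ.* (Vec.tail h ∙ w)
      head-tail (a ∷ h) = trans
        (cong (λ t → a ℤ.* 1ℤ ℤ.+ t)
          (trans (∙-⊕ʳ h x₀ (+ m ⊛ w)) (cong (λ t → h ∙ x₀ ℤ.+ t) (∙-⊛ʳ (+ m) h w))))
        (sym (ℤₚ.+-assoc (a ℤ.* 1ℤ) (h ∙ x₀) (+ m ℤ.* (h ∙ w))))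
      z∈X : z ∈ X
      z∈X = proj₂ (exact z) λ i → subst (0ℤ ℤ.≤_) (sym (head-tail (H i)))
        (0≤i+j (proj₁ (exact x₀) x₀∈X i) (0≤i*j {+ m} (ℤ.+≤+ ℕ.z≤n) (rec i)))
      open ℤₚ.≤-Reasoning
      cancel : ∀ a b → a ℤ.+ (1ℤ ℤ.+ (a ℤ.+ b)) ℤ.* -1ℤ ≡ -1ℤ ℤ.+ ℤ.- b
      cancel = solve-∀
      below : v ∙ z ℤ.< ℤ.- + β
      below = begin-strict
        v ∙ z                                     ≡⟨ ∙-⊕ʳ v x₀ (+ m ⊛ w) ⟩
        v ∙ x₀ ℤ.+ v ∙ (+ m ⊛ w)                  ≡⟨ cong (λ t → v ∙ x₀ ℤ.+ t) (∙-⊛ʳ (+ m) v w) ⟩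
        v ∙ x₀ ℤ.+ + m ℤ.* (v ∙ w)                ≤⟨ ℤₚ.+-mono-≤ (i≤∣i∣ (v ∙ x₀))
                                                       (ℤₚ.*-monoˡ-≤-nonNeg (+ m) (ℤₚ.i<j⇒i≤pred[j] neg)) ⟩
        + ℤ.∣ v ∙ x₀ ∣ ℤ.+ + m ℤ.* -1ℤ            ≡⟨ cancel (+ ℤ.∣ v ∙ x₀ ∣) (+ β) ⟩
        -1ℤ ℤ.+ ℤ.- + β                           <⟨ ℤₚ.+-monoˡ-< (ℤ.- + β) (ℤ.-<+ {0} {0}) ⟩
        0ℤ ℤ.+ ℤ.- + β                            ≡⟨ ℤₚ.+-identityˡ _ ⟩
        ℤ.- + β                                   ∎

    -- Linear programming duality: a positive multiple of v in the cone of the slopes certifies a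
    -- lower bound; otherwise Farkas yields a recession direction along which v decreases.
    lowerBound-or-¬exact : ∀ v → (∃[ β ] LowerBound (Polyhedron H) v β) ⊎ ¬ Exact H X
    lowerBound-or-¬exact v with farkas-list slopes v
    ... | inj₁ (w , nn , neg) = inj₂ (recession⇒¬exact v w
            (λ i → subst (0ℤ ℤ.≤_) (∙-comm w (Vec.tail (H i))) (nn (∈-map⁺ (Vec.tail ∘ H) (∈-allFin i))))
            (subst (ℤ._< 0ℤ) (∙-comm w v) neg))
    ... | inj₂ (l , c) with cone-lowerBound c
    ...   | β , b = inj₁ (β , λ {z} p → unscale l β (v ∙ z)
                (subst (ℤ.- + β ℤ.≤_) (∙-⊛ˡ (+ suc l) v z) (b p)))

    lowerBounds-or-¬exact : ∀ vs → (∃[ β ] (∀ {v} → v ∈ vs → LowerBound (Polyhedron H) v β)) ⊎ ¬ Exact H X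
    lowerBounds-or-¬exact []       = inj₁ (0 , λ ())
    lowerBounds-or-¬exact (v ∷ vs) with lowerBound-or-¬exact v | lowerBounds-or-¬exact vs
    ... | inj₂ ¬e      | _            = inj₂ ¬e
    ... | _            | inj₂ ¬e      = inj₂ ¬e
    ... | inj₁ (β , b) | inj₁ (γ , c) = inj₁ (β ℕ.⊔ γ , λ
      { (here refl) {z} → lowerBound-mono {S = Polyhedron H} {v} (ℕₚ.m≤m⊔n β γ) b {z}
      ; {u} (there p) {z} → lowerBound-mono {S = Polyhedron H} {u} (ℕₚ.m≤n⊔m β γ) (c p) {z} })

    private
      polyhedron? : Decidable (Polyhedron H)
      polyhedron? z = Finₚ.all? λ i → 0ℤ ℤₚ.≤? H i ∙ hat z

    -- If all signed unit vectors are bounded below, the polyhedron lies in a computed box, and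
    -- equality with X is checked point by point. Otherwise a recession direction shows that it is
    -- not the finite nonempty set X.
    exact? : Dec (Exact H X)
    exact? with lowerBounds-or-¬exact (List.map unit (List.allFin d) ++ List.map (⊝_ ∘ unit) (List.allFin d))
    ... | inj₂ ¬e = no ¬e
    ... | inj₁ (B , b) = map′
          (λ (p , q) z → All.lookup p , λ r → All.lookup q (∈-box z (bounded r)) r)
          (λ e → All.tabulate (λ {z} → proj₁ (e z)) , All.tabulate (λ {z} _ → proj₂ (e z)))
          (All.all? polyhedron? X ×-dec All.all? (λ z → polyhedron? z →-dec (z ∈? X)) (box d B))
      where
      bounded : ∀ {z} → Polyhedron H z → ∥ z ∥ ℕ.≤ B
      bounded = bounded-by-signed-units λ c →
        (λ {z} → b (∈-++⁺ˡ (∈-map⁺ unit (∈-allFin c))) {z}) ,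
        (λ {z} → b (∈-++⁺ʳ (List.map unit (List.allFin d)) (∈-map⁺ (⊝_ ∘ unit) (∈-allFin c))) {z})

-- The algorithm

CoverNumber≤ : List (ℤ^ d) → List (ℤ^ d) → ℕ → Set
CoverNumber≤ X Y k = Cover {k = k} (Separable X) (λ _ → []) Y

coverNumber≤? : ∀ (X Y : List (ℤ^ d)) → Decidable (CoverNumber≤ X Y)
coverNumber≤? X Y k = cover? (separable? X) (λ _ → []) Y

outside : ∀ {d} → List (ℤ^ d) → ℕ → List (ℤ^ d)
outside {d} X R = List.filter (λ z → ¬? (z ∈? X)) (box d R)

∈-outside : ∀ {X : List (ℤ^ d)} {R z} → ∥ z ∥ ℕ.≤ R → z ∉ X → z ∈ outside X R
∈-outside {X = X} {z = z} p q = ∈-filter⁺ (λ z → ¬? (z ∈? X)) (∈-box z p) q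

outside-∉ : ∀ (X : List (ℤ^ d)) R {z} → z ∈ outside X R → z ∉ X
outside-∉ {d} X R p = proj₂ (∈-filter⁻ (λ z → ¬? (z ∈? X)) {xs = box d R} p)

-- `Exact` is the upper bound k on the complexity. The minimality concerns the box only, but it is a
-- lower bound on the complexity too, because half-spaces that describe X cover in particular the
-- rest of the box.
Certificate : List (ℤ^ d) → ℕ → ℕ → Set
Certificate {d} X R k = Σ[ H ∈ Vector (ℤ^ (suc d)) k ]
  (Exact H X × (∀ j → CoverNumber≤ X (outside X R) j → k ℕ.≤ j))

SeparatesOutside : ∀ {d k} → Vector (ℤ^ (suc d)) k → List (ℤ^ d) → ℕ → Set
SeparatesOutside H X R = (∀ {x} → x ∈ X → Polyhedron H x) ×
  (∀ {z} → ∥ z ∥ ℕ.≤ R → z ∉ X → ¬ Polyhedron H z)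

-- The two reasons for which a box gives no output. The first contradicts lattice-convexity, since
-- one half-space per point always suffices for points outside the hull; the second contradicts a
-- bound R on the observers.
Failure : List (ℤ^ d) → ℕ → Set
Failure {d} X R = (¬ (CoverNumber≤ X (outside X R) (length (outside X R)))) ⊎
  (∃[ k ] Σ[ H ∈ Vector (ℤ^ (suc d)) k ] (SeparatesOutside H X R × ¬ Exact H X))

cover⇒separators : ∀ {d} {X : List (ℤ^ d)} {R k} → CoverNumber≤ X (outside X R) k →
  Σ[ H ∈ Vector (ℤ^ (suc d)) k ] SeparatesOutside H X R
cover⇒separators {X = X} {R} c with cover-elim (λ _ → []) (outside X R) c
... | bins , sep , _ , cov = proj₁ ∘ sep , (λ p i → proj₁ (proj₂ (sep i)) p) ,
  λ z≤R z∉X r → let i , p = cov (∈-outside z≤R z∉X) in ℤₚ.<⇒≱ (proj₂ (proj₂ (sep i)) p) (r i)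

certificate-or-failure : ∀ (X : List (ℤ^ d)) {x₀} → x₀ ∈ X → ∀ R →
  (∃[ k ] Certificate X R k) ⊎ Failure X R
-- One half-space per point is the crudest covering; its existence bounds the search for the least
-- number.
certificate-or-failure X x₀∈X R with coverNumber≤? X (outside X R) (length (outside X R))
... | no ¬c = inj₂ (inj₁ ¬c)
... | yes c with least (coverNumber≤? X (outside X R)) _ c
... | k , cₖ , min with cover⇒separators cₖ
... | H , sep with exact? H x₀∈X
... | yes e = inj₁ (k , H , e , min)
... | no ¬e = inj₂ (inj₂ (k , H , sep , ¬e))

algorithm : Algorithm (Σ[ d ∈ ℕ ] List (ℤ^ d)) ℕ
-- No output is owed here: each of the three conditions provides a point of X.
algorithm (d , [])        R = nothing
algorithm (d , X@(_ ∷ _)) R = Sum.[ just ∘ proj₁ , (λ _ → nothing) ] (certificate-or-failure X (here refl) R)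

algorithm-sound : ∀ (X : List (ℤ^ d)) R {k} → algorithm (d , X) R ≡ just k → Certificate X R k
algorithm-sound X@(_ ∷ _) R eq with certificate-or-failure X (here refl) R
algorithm-sound X@(_ ∷ _) R refl | inj₁ (k , c) = c

algorithm-complete : ∀ (X : List (ℤ^ d)) {x₀} → x₀ ∈ X → ∀ R → ¬ Failure X R →
  ∃[ k ] algorithm (d , X) R ≡ just k
algorithm-complete X@(_ ∷ _) _ R ¬f with certificate-or-failure X (here refl) R
... | inj₁ (k , _) = k , refl
... | inj₂ f       = contradiction f ¬f

-- The first successful box may be smaller than the box for which success is proved. As all boxes
-- that succeed give the same value, the first one does so too.
first-output : ∀ {A : Set} (alg : Algorithm A ℕ) a {k} → (∀ t {l} → alg a t ≡ just l → l ≡ k) →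
  ∀ t → alg a t ≡ just k → alg outputs k on a
first-output alg a {k} unique t eq with least produces? t (k , eq)
  where
  produces? : Decidable (λ t → ∃[ l ] alg a t ≡ just l)
  produces? t with alg a t
  ... | just l  = yes (l , refl)
  ... | nothing = no λ ()
... | s , (l , eq′) , min = s , trans eq′ (cong just (unique s eq′)) , silent
  where
  silent : ∀ r → r ℕ.< s → alg a r ≡ nothing
  silent r r<s with alg a r in eq″
  ... | nothing = refl
  ... | just m  = contradiction (min r (m , eq″)) (ℕₚ.<⇒≱ r<s)

-- Observers

singleton-separable : ∀ {X : List (ℤ^ d)} {y} → ¬ InHull X y → Separable X (y ∷ [])
singleton-separable {X = X} {y} ∉hull with farkas-list (List.map hat X) (hat y)
... | inj₁ (h , nn , neg) = h , (λ p → nn (∈-map⁺ hat p)) , λ { (here refl) → neg }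
... | inj₂ (k , c) = contradiction (k , cone-bind (cone-generator ∘ ∈-map⁻ hat) c) ∉hull

coverNumber≤length : ∀ {X : List (ℤ^ d)} Y → (∀ {y} → y ∈ Y → ¬ InHull X y) →
  CoverNumber≤ X Y (length Y)
coverNumber≤length {X = X} Y ∉hull = cover-intro (λ i y → y ≡ List.lookup Y i) singles
  (λ _ → []) (λ _ ()) Y (λ p → Any.index p , Anyₚ.lookup-index p)
  where
  singles : ∀ i L → (∀ {y} → y ∈ L → y ≡ List.lookup Y i) → Separable X L
  singles i L all with singleton-separable (∉hull (∈-lookup {xs = Y} i))
  ... | h , nn , neg = h , nn , λ {y} p → subst (λ y → h ∙ hat y ℤ.< 0ℤ) (sym (all p)) (neg (here refl))

-- The negative form, without a witness for the further hull point, suffices for the descent, whose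
-- goal is itself a contradiction.
ObserversWithin : List (ℤ^ d) → ℕ → Set
ObserversWithin X R = ∀ z → z ∉ X → R ℕ.< ∥ z ∥ →
  ¬ (∀ z′ → InHull (z ∷ X) z′ → z′ ∈ X ⊎ z′ ≡ z)

-- Invariant of a sum of a copies of `hat z` and b hats of points of X. The field `pure` keeps track
-- of the only case, b = 0, in which the norm estimate is not strict.
record Combination (X : List (ℤ^ d)) (z : ℤ^ d) (v : ℤ^ (suc d)) : Set where
  constructor comb
  field
    a b   : ℕ
    weight : Vec.head v ≡ + (a ℕ.+ b)
    bound : ∀ c → ℤ.∣ Vec.lookup (Vec.tail v) c ∣ ℕ.≤ a ℕ.* ∥ z ∥ ℕ.+ b ℕ.* maxNorm X
    pure  : b ≡ 0 → Vec.tail v ≡ + a ⊛ z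

combination-of-cone : ∀ {X : List (ℤ^ d)} {z v} → Cone (Hat (z ∷ X)) v → Combination X z v
combination-of-cone {X = X} {z} = cone-fold (Combination X z) zero-combination (λ {_} {v} → step {v = v})
  where
  zero-combination : Combination X z 𝟘
  zero-combination = comb 0 0 refl (λ c → ℕₚ.≤-reflexive (cong ℤ.∣_∣ (Vecₚ.lookup-replicate c 0ℤ)))
    (λ _ → sym (⊛-zero z))
  step : ∀ {g v} → Hat (z ∷ X) g → Combination X z v → Combination X z (g ⊕ v)
  step {v = v₀ ∷ v} (x , here refl , refl) (comb a b w bd p) = comb (suc a) b
    (trans (cong (ℤ._+_ 1ℤ) w) refl)
    (λ c → begin
      ℤ.∣ Vec.lookup (x ⊕ v) c ∣                        ≡⟨ cong ℤ.∣_∣ (Vecₚ.lookup-zipWith ℤ._+_ c x v) ⟩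
      ℤ.∣ Vec.lookup x c ℤ.+ Vec.lookup v c ∣           ≤⟨ ℤₚ.∣i+j∣≤∣i∣+∣j∣ (Vec.lookup x c) (Vec.lookup v c) ⟩
      ℤ.∣ Vec.lookup x c ∣ ℕ.+ ℤ.∣ Vec.lookup v c ∣     ≤⟨ ℕₚ.+-mono-≤ (entry≤norm x c) (bd c) ⟩
      ∥ x ∥ ℕ.+ (a ℕ.* ∥ x ∥ ℕ.+ b ℕ.* maxNorm X)       ≡⟨ ℕₚ.+-assoc ∥ x ∥ _ _ ⟨
      (∥ x ∥ ℕ.+ a ℕ.* ∥ x ∥) ℕ.+ b ℕ.* maxNorm X       ∎)
    (λ b≡0 → trans (cong (x ⊕_) (p b≡0)) (sym (⊛-suc a x)))
    where open ℕₚ.≤-Reasoning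
  step {v = v₀ ∷ v} (x , there x∈X , refl) (comb a b w bd p) = comb a (suc b)
    (trans (cong (ℤ._+_ 1ℤ) w) (cong +_ (sym (ℕₚ.+-suc a b))))
    (λ c → begin
      ℤ.∣ Vec.lookup (x ⊕ v) c ∣                        ≡⟨ cong ℤ.∣_∣ (Vecₚ.lookup-zipWith ℤ._+_ c x v) ⟩
      ℤ.∣ Vec.lookup x c ℤ.+ Vec.lookup v c ∣           ≤⟨ ℤₚ.∣i+j∣≤∣i∣+∣j∣ (Vec.lookup x c) (Vec.lookup v c) ⟩
      ℤ.∣ Vec.lookup x c ∣ ℕ.+ ℤ.∣ Vec.lookup v c ∣     ≤⟨ ℕₚ.+-mono-≤ (ℕₚ.≤-trans (entry≤norm x c) (norm≤maxNorm x∈X)) (bd c) ⟩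
      M ℕ.+ (a ℕ.* ∥ z ∥ ℕ.+ b ℕ.* M)                   ≡⟨ ℕₚ.+-assoc M _ _ ⟨
      (M ℕ.+ a ℕ.* ∥ z ∥) ℕ.+ b ℕ.* M                   ≡⟨ cong (ℕ._+ b ℕ.* M) (ℕₚ.+-comm M (a ℕ.* ∥ z ∥)) ⟩
      (a ℕ.* ∥ z ∥ ℕ.+ M) ℕ.+ b ℕ.* M                   ≡⟨ ℕₚ.+-assoc (a ℕ.* ∥ z ∥) M _ ⟩
      a ℕ.* ∥ z ∥ ℕ.+ suc b ℕ.* M                       ∎)
    λ ()
    where
    open ℕₚ.≤-Reasoning
    M = maxNorm X

⊛-cancel : ∀ k (u v : ℤ^ n) → + suc k ⊛ u ≡ + suc k ⊛ v → u ≡ v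
⊛-cancel k []      []      _  = refl
⊛-cancel k (a ∷ u) (b ∷ v) eq = cong₂ _∷_
  (ℤₚ.*-cancelˡ-≡ (+ suc k) a b (Vecₚ.∷-injectiveˡ eq)) (⊛-cancel k u v (Vecₚ.∷-injectiveʳ eq))

-- The maximum norm is convex, and a combination other than z itself gives positive weight to a
-- point of X, whose norm is smaller than that of z.
hull-shrinks : ∀ {X : List (ℤ^ d)} {z z′} → maxNorm X ℕ.< ∥ z ∥ → InHull (z ∷ X) z′ → z′ ≢ z →
  ∥ z′ ∥ ℕ.< ∥ z ∥
hull-shrinks {X = X} {z} {z′} M<z (k , c) z′≢z with combination-of-cone c
... | comb a zero w bd p = contradiction (⊛-cancel k z′ z (trans (p refl)
        (cong (_⊛ z) (sym (trans (sym (ℤₚ.*-identityʳ (+ suc k))) (trans w (cong +_ (ℕₚ.+-identityʳ a)))))))) z′≢z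
... | comb a b@(suc _) w bd p = norm< z′ (ℕₚ.≤-<-trans ℕ.z≤n M<z) λ c →
  ℕₚ.*-cancelˡ-< (suc k) _ _ (begin-strict
    suc k ℕ.* ℤ.∣ Vec.lookup z′ c ∣               ≡⟨ ℤₚ.abs-* (+ suc k) (Vec.lookup z′ c) ⟨
    ℤ.∣ + suc k ℤ.* Vec.lookup z′ c ∣             ≡⟨ cong ℤ.∣_∣ (Vecₚ.lookup-map c (ℤ._*_ (+ suc k)) z′) ⟨
    ℤ.∣ Vec.lookup (+ suc k ⊛ z′) c ∣             ≤⟨ bd c ⟩
    a ℕ.* ∥ z ∥ ℕ.+ b ℕ.* maxNorm X               <⟨ ℕₚ.+-monoʳ-< (a ℕ.* ∥ z ∥) (ℕₚ.*-monoʳ-< b M<z) ⟩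
    a ℕ.* ∥ z ∥ ℕ.+ b ℕ.* ∥ z ∥                   ≡⟨ ℕₚ.*-distribʳ-+ ∥ z ∥ a b ⟨
    (a ℕ.+ b) ℕ.* ∥ z ∥                           ≡⟨ cong (ℕ._* ∥ z ∥) (ℤₚ.+-injective (trans (sym w) (ℤₚ.*-identityʳ (+ suc k)))) ⟩
    suc k ℕ.* ∥ z ∥                               ∎)
  where open ℕₚ.≤-Reasoning

separatesOutside⇒exact : ∀ {d k} {H : Vector (ℤ^ (suc d)) k} {X R} → maxNorm X ℕ.≤ R →
  ObserversWithin X R → SeparatesOutside H X R → Exact H X
separatesOutside⇒exact {d} {H = H} {X} {R} M≤R observers (X⊆H , sep) z = X⊆H , member
  where
  Excluded : ℕ → Set
  Excluded m = ∀ z → ∥ z ∥ ≡ m → z ∉ X → ¬ Polyhedron H z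
  excluded : ∀ m → Excluded m
  excluded = <-rec Excluded λ { _ rec z refl z∉X z∈H → go rec z∉X z∈H (∥ z ∥ ℕₚ.≤? R) }
    where
    go : ∀ {z} → (∀ {m} → m ℕ.< ∥ z ∥ → Excluded m) → z ∉ X → Polyhedron H z → Dec (∥ z ∥ ℕ.≤ R) → ⊥
    go         rec z∉X z∈H (yes z≤R) = sep z≤R z∉X z∈H
    go {z = z} rec z∉X z∈H (no z≰R) = observers z z∉X R<z λ z′ hull → case z′ hull
      where
      R<z = ℕₚ.≰⇒> z≰R
      case : ∀ z′ → InHull (z ∷ X) z′ → z′ ∈ X ⊎ z′ ≡ z
      case z′ hull with z′ ∈? X | z′ ≟ z
      ... | yes p | _     = inj₁ p
      ... | no _  | yes p = inj₂ p
      -- By convexity z′ lies in the polyhedron, although the induction hypothesis excludes it as a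
      -- smaller point outside X.
      ... | no ∉X | no ≢z = contradiction
        (polyhedron-convex H {X = z ∷ X} {z′} (λ { (here refl) → z∈H ; (there p) → X⊆H p }) hull)
        (rec (hull-shrinks (ℕₚ.≤-<-trans M≤R R<z) hull ≢z) z′ refl ∉X)
  member : Polyhedron H z → z ∈ X
  member p with z ∈? X
  ... | yes q = q
  ... | no ∉X = contradiction p (excluded ∥ z ∥ z refl ∉X)

¬failure : ∀ {X : List (ℤ^ d)} {R} → (∀ {z} → InHull X z → z ∈ X) → maxNorm X ℕ.≤ R →
  ObserversWithin X R → ¬ Failure X R
¬failure {X = X} {R} closed M≤R obs (inj₁ ¬c) =
  ¬c (coverNumber≤length (outside X R) λ y∈Y hull → outside-∉ X R y∈Y (closed hull))
¬failure {X = X} {R} closed M≤R obs (inj₂ (k , H , sep , ¬e)) = ¬e (separatesOutside⇒exact {H = H} M≤R obs sep)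

-- Real numbers

opaque
  toℚ : ℤ → ℚ
  toℚ i = i ℚ./ 1

  toℚ-def : ∀ i → i ℚ./ 1 ≡ toℚ i
  toℚ-def i = refl

  toℚ-0 : toℚ 0ℤ ≡ 0ℚ
  toℚ-0 = refl

  toℚ-1 : toℚ 1ℤ ≡ 1ℚ
  toℚ-1 = refl

  toℚᵘ-toℚ : ∀ i → ℚ.toℚᵘ (toℚ i) ℚᵘ.≃ ℚᵘ.mkℚᵘ i 0
  toℚᵘ-toℚ i = ℚₚ.toℚᵘ-fromℚᵘ (ℚᵘ.mkℚᵘ i 0)

  toℚ-+ : ∀ i j → toℚ (i ℤ.+ j) ≡ toℚ i ℚ.+ toℚ j
  toℚ-+ i j = ℚₚ.toℚᵘ-injective (begin
    ℚ.toℚᵘ (toℚ (i ℤ.+ j))                      ≈⟨ toℚᵘ-toℚ (i ℤ.+ j) ⟩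
    ℚᵘ.mkℚᵘ (i ℤ.+ j) 0                         ≈⟨ ℚᵘ.*≡* (cong (ℤ._* 1ℤ) (cong₂ ℤ._+_ (sym (ℤₚ.*-identityʳ i)) (sym (ℤₚ.*-identityʳ j)))) ⟩
    ℚᵘ.mkℚᵘ i 0 ℚᵘ.+ ℚᵘ.mkℚᵘ j 0                ≈⟨ ℚᵘₚ.+-cong (toℚᵘ-toℚ i) (toℚᵘ-toℚ j) ⟨
    ℚ.toℚᵘ (toℚ i) ℚᵘ.+ ℚ.toℚᵘ (toℚ j)          ≈⟨ ℚₚ.toℚᵘ-homo-+ (toℚ i) (toℚ j) ⟨
    ℚ.toℚᵘ (toℚ i ℚ.+ toℚ j)                    ∎)
    where open ℚᵘₚ.≃-Reasoning

  toℚ-* : ∀ i j → toℚ (i ℤ.* j) ≡ toℚ i ℚ.* toℚ j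
  toℚ-* i j = ℚₚ.toℚᵘ-injective (begin
    ℚ.toℚᵘ (toℚ (i ℤ.* j))                      ≈⟨ toℚᵘ-toℚ (i ℤ.* j) ⟩
    ℚᵘ.mkℚᵘ i 0 ℚᵘ.* ℚᵘ.mkℚᵘ j 0                ≈⟨ ℚᵘₚ.*-cong (toℚᵘ-toℚ i) (toℚᵘ-toℚ j) ⟨
    ℚ.toℚᵘ (toℚ i) ℚᵘ.* ℚ.toℚᵘ (toℚ j)          ≈⟨ ℚₚ.toℚᵘ-homo-* (toℚ i) (toℚ j) ⟨
    ℚ.toℚᵘ (toℚ i ℚ.* toℚ j)                    ∎)
    where open ℚᵘₚ.≃-Reasoning

  toℚ-neg : ∀ i → toℚ (ℤ.- i) ≡ ℚ.- toℚ i
  toℚ-neg i = begin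
    toℚ (ℤ.- i)          ≡⟨ cong toℚ (ℤₚ.-1*i≡-i i) ⟨
    toℚ (-1ℤ ℤ.* i)      ≡⟨ toℚ-* -1ℤ i ⟩
    toℚ -1ℤ ℚ.* toℚ i    ≡⟨ solve 1 (λ a → con (toℚ -1ℤ) :* a := :- a) refl (toℚ i) ⟩
    ℚ.- toℚ i            ∎
    where open ≡-Reasoning

  toℚ-mono-≤ : ∀ {i j} → i ℤ.≤ j → toℚ i ℚ.≤ toℚ j
  toℚ-mono-≤ {i} {j} p = ℚₚ.toℚᵘ-cancel-≤ (begin
    ℚ.toℚᵘ (toℚ i)  ≃⟨ toℚᵘ-toℚ i ⟩
    ℚᵘ.mkℚᵘ i 0     ≤⟨ ℚᵘ.*≤* (ℤₚ.*-monoʳ-≤-nonNeg 1ℤ p) ⟩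
    ℚᵘ.mkℚᵘ j 0     ≃⟨ toℚᵘ-toℚ j ⟨
    ℚ.toℚᵘ (toℚ j)  ∎)
    where open ℚᵘₚ.≤-Reasoning

  toℚ-mono-< : ∀ {i j} → i ℤ.< j → toℚ i ℚ.< toℚ j
  toℚ-mono-< {i} {j} p = ℚₚ.toℚᵘ-cancel-< (begin-strict
    ℚ.toℚᵘ (toℚ i)  ≃⟨ toℚᵘ-toℚ i ⟩
    ℚᵘ.mkℚᵘ i 0     <⟨ ℚᵘ.*<* (ℤₚ.*-monoʳ-<-pos 1ℤ p) ⟩
    ℚᵘ.mkℚᵘ j 0     ≃⟨ toℚᵘ-toℚ j ⟨
    ℚ.toℚᵘ (toℚ j)  ∎)
    where open ℚᵘₚ.≤-Reasoning

<⇒≱ : ∀ {p q} → p ℚ.< q → ¬ (q ℚ.≤ p)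
<⇒≱ p<q q≤p = ℚₚ.<-irrefl refl (ℚₚ.<-≤-trans p<q q≤p)

toℚ-cancel-≤ : ∀ {i j} → toℚ i ℚ.≤ toℚ j → i ℤ.≤ j
toℚ-cancel-≤ {i} {j} p with i ℤₚ.≤? j
... | yes q = q
... | no q  = contradiction p (<⇒≱ (toℚ-mono-< (ℤₚ.≰⇒> q)))

toℚ-injective : ∀ {i j} → toℚ i ≡ toℚ j → i ≡ j
toℚ-injective eq = ℤₚ.≤-antisym (toℚ-cancel-≤ (ℚₚ.≤-reflexive eq)) (toℚ-cancel-≤ (ℚₚ.≤-reflexive (sym eq)))

toℚ-∙ : (h z : ℤ^ n) → toℚ (h ∙ z) ≡ sum (λ j → toℚ (Vec.lookup h j) ℚ.* toℚ (Vec.lookup z j))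
toℚ-∙ []      []      = toℚ-0
toℚ-∙ (a ∷ h) (b ∷ z) = trans (toℚ-+ (a ℤ.* b) (h ∙ z)) (cong₂ ℚ._+_ (toℚ-* a b) (toℚ-∙ h z))

seq-∑ : ∀ (v : Vector ℝ n) m → seq (∑ v) m ≡ sum (λ i → seq (v i) m)
seq-∑ {zero}  v m = refl
seq-∑ {suc n} v m = cong (seq (v zero) m ℚ.+_) (seq-∑ (v ∘ suc) m)

p≤∣p∣ : ∀ p → p ℚ.≤ ℚ.∣ p ∣
p≤∣p∣ p with ℚₚ.≤-total 0ℚ p
... | inj₁ 0≤p = ℚₚ.≤-reflexive (sym (ℚₚ.0≤p⇒∣p∣≡p 0≤p))
... | inj₂ p≤0 = ℚₚ.≤-trans p≤0 (ℚₚ.0≤∣p∣ p)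

½-pos : ∀ {ε} → 0ℚ ℚ.< ε → 0ℚ ℚ.< ½ ℚ.* ε
½-pos {ε} p = subst (ℚ._< ½ ℚ.* ε) (ℚₚ.*-zeroʳ ½) (ℚₚ.*-monoʳ-<-pos ½ p)

½+½ : ∀ ε → ½ ℚ.* ε ℚ.+ ½ ℚ.* ε ≡ ε
½+½ ε = trans (sym (ℚₚ.*-distribʳ-+ ε ½ ½)) (ℚₚ.*-identityˡ ε)

infix 3 0≲_

-- The limit is nonnegative. Stated for bare sequences, so that identities between real expressions
-- become identities in ℚ at each index.
record 0≲_ (s : ℕ → ℚ) : Set where
  constructor eventually
  field bound : ∀ ε → 0ℚ ℚ.< ε → ∃[ N ] (∀ n → N ℕ.≤ n → 0ℚ ℚ.≤ s n ℚ.+ ε)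

open 0≲_ using (bound)

module _ {s t : ℕ → ℚ} where

  0≲-resp : (∀ n → s n ≡ t n) → 0≲ s → 0≲ t
  0≲-resp eq p = eventually λ ε 0<ε → let N , h = bound p ε 0<ε in
    N , λ n q → subst (λ x → 0ℚ ℚ.≤ x ℚ.+ ε) (eq n) (h n q)

  0≲-+ : 0≲ s → 0≲ t → 0≲ λ n → s n ℚ.+ t n
  0≲-+ p q = eventually λ ε 0<ε →
    let M , f = bound p (½ ℚ.* ε) (½-pos 0<ε) ; N , g = bound q (½ ℚ.* ε) (½-pos 0<ε)
    in M ℕ.⊔ N , λ n r → subst (0ℚ ℚ.≤_) (trans (regroup (s n) (t n) (½ ℚ.* ε)) (cong (λ e → (s n ℚ.+ t n) ℚ.+ e) (½+½ ε)))
         (ℚₚ.+-mono-≤ (f n (ℕₚ.m⊔n≤o⇒m≤o M N r)) (g n (ℕₚ.m⊔n≤o⇒n≤o M N r)))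
    where
    regroup : ∀ a b e → (a ℚ.+ e) ℚ.+ (b ℚ.+ e) ≡ (a ℚ.+ b) ℚ.+ (e ℚ.+ e)
    regroup = solve 3 (λ a b e → (a :+ e) :+ (b :+ e) := (a :+ b) :+ (e :+ e)) refl

0≲-nonneg : ∀ {s} → (∀ n → 0ℚ ℚ.≤ s n) → 0≲ s
0≲-nonneg p = eventually λ ε 0<ε → 0 , λ n _ → ℚₚ.+-mono-≤ (p n) (ℚₚ.<⇒≤ 0<ε)

0≲-const : ∀ {q} → 0≲ (λ _ → q) → 0ℚ ℚ.≤ q
0≲-const {q} p with 0ℚ ℚₚ.≤? q
... | yes 0≤q = 0≤q
... | no 0≰q  = contradiction (h N ℕₚ.≤-refl) (<⇒≱ below)
  where
  q<0 = ℚₚ.≰⇒> 0≰q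
  -- With this choice q + ε = q / 2 is still negative.
  ε = ½ ℚ.* (ℚ.- q)
  0<ε = ½-pos (ℚₚ.neg-antimono-< q<0)
  N = proj₁ (bound p ε 0<ε)
  h = proj₂ (bound p ε 0<ε)
  below : q ℚ.+ ε ℚ.< 0ℚ
  below = subst (ℚ._< 0ℚ) (solve 1 (λ q → :- (con ½ :* (:- q)) := q :+ con ½ :* (:- q)) refl q)
    (ℚₚ.neg-antimono-< 0<ε)

toℚ-suc : ∀ k → toℚ (+ suc k) ≡ 1ℚ ℚ.+ toℚ (+ k)
toℚ-suc k = trans (toℚ-+ 1ℤ (+ k)) (cong (ℚ._+ toℚ (+ k)) toℚ-1)

0≲-scale : ∀ k {s} → 0≲ s → 0≲ λ n → toℚ (+ k) ℚ.* s n
0≲-scale zero    {s} p = 0≲-nonneg λ n → ℚₚ.≤-reflexive (sym (trans (cong (ℚ._* s n) toℚ-0) (ℚₚ.*-zeroˡ (s n))))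
0≲-scale (suc k) {s} p = 0≲-resp
  (λ n → sym (begin
    toℚ (1ℤ ℤ.+ + k) ℚ.* s n               ≡⟨ cong (ℚ._* s n) (toℚ-suc k) ⟩
    (1ℚ ℚ.+ toℚ (+ k)) ℚ.* s n             ≡⟨ ℚₚ.*-distribʳ-+ (s n) 1ℚ (toℚ (+ k)) ⟩
    1ℚ ℚ.* s n ℚ.+ toℚ (+ k) ℚ.* s n       ≡⟨ cong (ℚ._+ toℚ (+ k) ℚ.* s n) (ℚₚ.*-identityˡ (s n)) ⟩
    s n ℚ.+ toℚ (+ k) ℚ.* s n              ∎))
  (0≲-+ p (0≲-scale k p))
  where open ≡-Reasoning

0≲-unscale : ∀ k {s} → 0≲ (λ n → toℚ (+ suc k) ℚ.* s n) → 0≲ s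
0≲-unscale k {s} p = eventually λ ε 0<ε → let N , h = bound p ε 0<ε in N , λ n q → unscaled ε 0<ε n (h n q)
  where
  unscaled : ∀ ε → 0ℚ ℚ.< ε → ∀ n → 0ℚ ℚ.≤ toℚ (+ suc k) ℚ.* s n ℚ.+ ε → 0ℚ ℚ.≤ s n ℚ.+ ε
  unscaled ε 0<ε n h with 0ℚ ℚₚ.≤? s n
  ... | yes 0≤s = ℚₚ.+-mono-≤ 0≤s (ℚₚ.<⇒≤ 0<ε)
  ... | no 0≰s  = ℚₚ.≤-trans h (ℚₚ.+-monoˡ-≤ ε (subst (toℚ (+ suc k) ℚ.* s n ℚ.≤_) (trans (cong (ℚ._* s n) toℚ-1) (ℚₚ.*-identityˡ (s n)))
      (ℚₚ.*-monoʳ-≤-nonPos (s n) {{ℚ.nonPositive (ℚₚ.<⇒≤ (ℚₚ.≰⇒> 0≰s))}}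
        (toℚ-mono-≤ {1ℤ} {+ suc k} (ℤ.+≤+ (ℕ.s≤s ℕ.z≤n))))))

-- From an index N on, the sequence varies by less than ε / 2, and the rational s N can be compared
-- with -ε / 2. If it is not smaller, all later terms are at least -ε; if it is smaller, all later
-- terms are at most 0, which is excluded.
0≲-of-¬ : ∀ {s} → IsCauchy s → ¬ (0≲ λ n → ℚ.- s n) → 0≲ s
0≲-of-¬ {s} cauchy ¬p = eventually λ ε 0<ε → go ε 0<ε (cauchy (½ ℚ.* ε) (½-pos 0<ε))
  where
  open ℚₚ.≤-Reasoning
  cancel : ∀ ε → 0ℚ ≡ (ℚ.- (½ ℚ.* ε) ℚ.- ½ ℚ.* ε) ℚ.+ ε
  cancel = solve 1 (λ ε → con 0ℚ := (:- (con ½ :* ε) :- con ½ :* ε) :+ ε) refl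
  go : ∀ ε → 0ℚ ℚ.< ε → ∃[ N ] (∀ m n → N ℕ.≤ m → N ℕ.≤ n → ℚ.∣ s m ℚ.- s n ∣ ℚ.< ½ ℚ.* ε) →
    ∃[ N ] (∀ n → N ℕ.≤ n → 0ℚ ℚ.≤ s n ℚ.+ ε)
  go ε 0<ε (N , h) with ℚ.- (½ ℚ.* ε) ℚₚ.≤? s N
  ... | yes q = N , λ n N≤n → begin
    0ℚ                                      ≡⟨ cancel ε ⟩
    (ℚ.- (½ ℚ.* ε) ℚ.- ½ ℚ.* ε) ℚ.+ ε       ≤⟨ ℚₚ.+-monoˡ-≤ ε (ℚₚ.+-mono-≤ q (ℚₚ.neg-antimono-≤ (difference n N≤n))) ⟩
    (s N ℚ.- (s N ℚ.- s n)) ℚ.+ ε           ≡⟨ cong (ℚ._+ ε) (solve 2 (λ a b → a :- (a :- b) := b) refl (s N) (s n)) ⟩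
    s n ℚ.+ ε                               ∎
    where
    difference : ∀ n → N ℕ.≤ n → s N ℚ.- s n ℚ.≤ ½ ℚ.* ε
    difference n N≤n = ℚₚ.≤-trans (p≤∣p∣ (s N ℚ.- s n)) (ℚₚ.<⇒≤ (h N n ℕₚ.≤-refl N≤n))
  ... | no q = contradiction
    (eventually λ δ 0<δ → N , λ n N≤n → ℚₚ.+-mono-≤ (ℚₚ.neg-antimono-≤ (negative n N≤n)) (ℚₚ.<⇒≤ 0<δ)) ¬p
    where
    negative : ∀ n → N ℕ.≤ n → s n ℚ.≤ 0ℚ
    negative n N≤n = begin
      s n                               ≡⟨ solve 2 (λ a b → b := a :+ (b :- a)) refl (s N) (s n) ⟩
      s N ℚ.+ (s n ℚ.- s N)             ≤⟨ ℚₚ.+-mono-≤ (ℚₚ.<⇒≤ (ℚₚ.≰⇒> q))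
                                             (ℚₚ.≤-trans (p≤∣p∣ (s n ℚ.- s N)) (ℚₚ.<⇒≤ (h n N N≤n ℕₚ.≤-refl))) ⟩
      ℚ.- (½ ℚ.* ε) ℚ.+ ½ ℚ.* ε         ≡⟨ ℚₚ.+-inverseˡ (½ ℚ.* ε) ⟩
      0ℚ                                ∎

≤⇒0≲ : ∀ {x y} → x ≤ y → 0≲ λ n → seq y n ℚ.- seq x n
≤⇒0≲ {x} {y} p = eventually λ ε 0<ε → let N , h = p ε 0<ε in N , λ n q →
  subst₂ ℚ._≤_ (ℚₚ.+-inverseʳ (seq x n)) (regroup (seq x n) (seq y n) ε) (ℚₚ.+-monoˡ-≤ (ℚ.- seq x n) (h n q))
  where
  regroup : ∀ a b e → (b ℚ.+ e) ℚ.- a ≡ (b ℚ.- a) ℚ.+ e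
  regroup = solve 3 (λ a b e → (b :+ e) :- a := (b :- a) :+ e) refl

0≲⇒≤ : ∀ {x y} → (0≲ λ n → seq y n ℚ.- seq x n) → x ≤ y
0≲⇒≤ {x} {y} p ε 0<ε = let N , h = bound p ε 0<ε in N , λ n q →
  subst₂ ℚ._≤_ (ℚₚ.+-identityˡ (seq x n)) (regroup (seq x n) (seq y n) ε) (ℚₚ.+-monoˡ-≤ (seq x n) (h n q))
  where
  regroup : ∀ a b e → ((b ℚ.- a) ℚ.+ e) ℚ.+ a ≡ b ℚ.+ e
  regroup = solve 3 (λ a b e → ((b :- a) :+ e) :+ a := b :+ e) refl

≈-sym : ∀ {x y} → x ≈ y → y ≈ x
≈-sym {x} {y} p ε 0<ε = let N , h = p ε 0<ε in N , λ n q →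
  subst (ℚ._< ε) (trans (sym (ℚₚ.∣-p∣≡∣p∣ (seq x n ℚ.- seq y n)))
    (cong ℚ.∣_∣ (solve 2 (λ a b → :- (a :- b) := b :- a) refl (seq x n) (seq y n)))) (h n q)

≈⇒≤ : ∀ {x y} → x ≈ y → x ≤ y
≈⇒≤ {x} {y} p ε 0<ε = let N , h = p ε 0<ε in N , λ n q → begin
  seq x n                                   ≡⟨ solve 2 (λ a b → a := b :+ (a :- b)) refl (seq x n) (seq y n) ⟩
  seq y n ℚ.+ (seq x n ℚ.- seq y n)         ≤⟨ ℚₚ.+-monoʳ-≤ (seq y n)
                                                 (ℚₚ.≤-trans (p≤∣p∣ (seq x n ℚ.- seq y n)) (ℚₚ.<⇒≤ (h n q))) ⟩
  seq y n ℚ.+ ε                             ∎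
  where open ℚₚ.≤-Reasoning

½<1 : ∀ {ε} → 0ℚ ℚ.< ε → ½ ℚ.* ε ℚ.< ε
½<1 {ε} p = subst₂ ℚ._<_ (ℚₚ.+-identityʳ (½ ℚ.* ε)) (½+½ ε) (ℚₚ.+-monoʳ-< (½ ℚ.* ε) (½-pos p))

∣∣≤ : ∀ {p e} → p ℚ.≤ e → ℚ.- p ℚ.≤ e → ℚ.∣ p ∣ ℚ.≤ e
∣∣≤ {p} a b with ℚₚ.∣p∣≡p∨∣p∣≡-p p
... | inj₁ eq = subst (ℚ._≤ _) (sym eq) a
... | inj₂ eq = subst (ℚ._≤ _) (sym eq) b

≤-antisym : ∀ {x y} → x ≤ y → y ≤ x → x ≈ y
≤-antisym {x} {y} p q ε 0<ε =
  let M , f = p (½ ℚ.* ε) (½-pos 0<ε) ; N , g = q (½ ℚ.* ε) (½-pos 0<ε)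
  in M ℕ.⊔ N , λ n r → ℚₚ.≤-<-trans
    (∣∣≤ (subst (seq x n ℚ.- seq y n ℚ.≤_) (cancel (seq y n) (½ ℚ.* ε))
            (ℚₚ.+-monoˡ-≤ (ℚ.- seq y n) (f n (ℕₚ.m⊔n≤o⇒m≤o M N r))))
         (subst₂ ℚ._≤_ (swap (seq x n) (seq y n)) (cancel (seq x n) (½ ℚ.* ε))
            (ℚₚ.+-monoˡ-≤ (ℚ.- seq x n) (g n (ℕₚ.m⊔n≤o⇒n≤o M N r)))))
    (½<1 0<ε)
  where
  cancel : ∀ a e → (a ℚ.+ e) ℚ.- a ≡ e
  cancel = solve 2 (λ a e → (a :+ e) :- a := e) refl
  swap : ∀ a b → b ℚ.- a ≡ ℚ.- (a ℚ.- b)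
  swap = solve 2 (λ a b → b :- a := :- (a :- b)) refl

≗⇒≈ : ∀ {x y} → (∀ n → seq x n ≡ seq y n) → x ≈ y
≗⇒≈ {x} {y} eq ε 0<ε = 0 , λ n _ → subst (ℚ._< ε)
  (sym (cong ℚ.∣_∣ (trans (cong (ℚ._- seq y n) (eq n)) (ℚₚ.+-inverseʳ (seq y n))))) 0<ε

-- Real inequalities as functionals on integer vectors

record Additive (φ : ℕ → ℤ^ n → ℚ) : Set where
  constructor mkAdditive
  field additive : ∀ m u v → φ m (u ⊕ v) ≡ φ m u ℚ.+ φ m v

module _ {φ : ℕ → ℤ^ n → ℚ} (φ-additive : Additive φ) where

  open Additive φ-additive

  additive-𝟘 : ∀ m → φ m 𝟘 ≡ 0ℚ
  additive-𝟘 m = begin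
    φ m 𝟘                          ≡⟨ solve 1 (λ a → a := (a :+ a) :- a) refl (φ m 𝟘) ⟩
    (φ m 𝟘 ℚ.+ φ m 𝟘) ℚ.- φ m 𝟘    ≡⟨ cong (ℚ._- φ m 𝟘) (additive m 𝟘 𝟘) ⟨
    φ m (𝟘 ⊕ 𝟘) ℚ.- φ m 𝟘          ≡⟨ cong (λ v → φ m v ℚ.- φ m 𝟘) (⊕-identityˡ 𝟘) ⟩
    φ m 𝟘 ℚ.- φ m 𝟘                ≡⟨ ℚₚ.+-inverseʳ (φ m 𝟘) ⟩
    0ℚ                             ∎
    where open ≡-Reasoning

  additive-⊛ : ∀ m k v → φ m (+ k ⊛ v) ≡ toℚ (+ k) ℚ.* φ m v
  additive-⊛ m zero    v = trans (cong (φ m) (⊛-zero v)) (trans (additive-𝟘 m) (sym (trans (cong (ℚ._* φ m v) toℚ-0) (ℚₚ.*-zeroˡ (φ m v)))))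
  additive-⊛ m (suc k) v = begin
    φ m (+ suc k ⊛ v)                       ≡⟨ cong (φ m) (⊛-suc k v) ⟩
    φ m (v ⊕ (+ k ⊛ v))                     ≡⟨ additive m v (+ k ⊛ v) ⟩
    φ m v ℚ.+ φ m (+ k ⊛ v)                 ≡⟨ cong₂ ℚ._+_ (sym (ℚₚ.*-identityˡ (φ m v))) (additive-⊛ m k v) ⟩
    1ℚ ℚ.* φ m v ℚ.+ toℚ (+ k) ℚ.* φ m v    ≡⟨ ℚₚ.*-distribʳ-+ (φ m v) 1ℚ (toℚ (+ k)) ⟨
    (1ℚ ℚ.+ toℚ (+ k)) ℚ.* φ m v            ≡⟨ cong (ℚ._* φ m v) (toℚ-suc k) ⟨
    toℚ (+ suc k) ℚ.* φ m v                 ∎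
    where open ≡-Reasoning

  additive-⊝ : ∀ m v → φ m (⊝ v) ≡ ℚ.- φ m v
  additive-⊝ m v = begin
    φ m (⊝ v)                               ≡⟨ solve 2 (λ a b → b := (a :+ b) :- a) refl (φ m v) (φ m (⊝ v)) ⟩
    (φ m v ℚ.+ φ m (⊝ v)) ℚ.- φ m v         ≡⟨ cong (ℚ._- φ m v) (additive m v (⊝ v)) ⟨
    φ m (v ⊕ ⊝ v) ℚ.- φ m v                 ≡⟨ cong (λ u → φ m u ℚ.- φ m v) (⊕-inverseʳ v) ⟩
    φ m 𝟘 ℚ.- φ m v                         ≡⟨ cong (ℚ._- φ m v) (additive-𝟘 m) ⟩
    0ℚ ℚ.- φ m v                            ≡⟨ ℚₚ.+-identityˡ _ ⟩
    ℚ.- φ m v                               ∎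
    where
    open ≡-Reasoning

  -- This is how an integral Farkas certificate acts on a real functional, which φ represents by its
  -- approximations: nonnegativity passes along the sum of generators, and the factor `suc k` is
  -- cancelled.
  cone-0≲ : ∀ {G} → (∀ {g} → G g → 0≲ λ m → φ m g) → ∀ {v} → ∃[ k ] Cone G (+ suc k ⊛ v) → 0≲ λ m → φ m v
  cone-0≲ gens {v} (k , c) = 0≲-unscale k (0≲-resp (λ m → additive-⊛ m (suc k) v)
    (cone-fold (λ v → 0≲ λ m → φ m v)
      (0≲-nonneg λ m → ℚₚ.≤-reflexive (sym (additive-𝟘 m)))
      (λ {g} {v} p q → 0≲-resp (λ m → sym (additive m g v)) (0≲-+ (gens p) q)) c))

opaque
  -- The slack of the inequality a · x ≤ b, homogenised and approximated at index m.
  row : ℝ → ℝ^ d → ℕ → ℤ^ (suc d) → ℚ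
  row b a m v = seq b m ℚ.* toℚ (Vec.head v) ℚ.- sum (λ j → seq (a j) m ℚ.* toℚ (Vec.lookup (Vec.tail v) j))

  row-additive : ∀ b (a : ℝ^ d) → Additive (row b a)
  row-additive {d} b a = mkAdditive add
    where
    add : ∀ m u v → row b a m (u ⊕ v) ≡ row b a m u ℚ.+ row b a m v
    add m (u₀ ∷ u) (v₀ ∷ v) = begin
      seq b m ℚ.* toℚ (u₀ ℤ.+ v₀) ℚ.- sum (λ j → seq (a j) m ℚ.* toℚ (Vec.lookup (u ⊕ v) j))
        ≡⟨ cong₂ (λ s t → seq b m ℚ.* s ℚ.- t) (toℚ-+ u₀ v₀) (trans (sum-cong-≗ entry) (∑-distrib-+ f g)) ⟩
      seq b m ℚ.* (toℚ u₀ ℚ.+ toℚ v₀) ℚ.- (sum f ℚ.+ sum g)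
        ≡⟨ solve 5 (λ b u v s t → b :* (u :+ v) :- (s :+ t) := (b :* u :- s) :+ (b :* v :- t)) refl
             (seq b m) (toℚ u₀) (toℚ v₀) (sum f) (sum g) ⟩
      (seq b m ℚ.* toℚ u₀ ℚ.- sum f) ℚ.+ (seq b m ℚ.* toℚ v₀ ℚ.- sum g) ∎
      where
      open ≡-Reasoning
      f g : Vector ℚ d
      f = λ j → seq (a j) m ℚ.* toℚ (Vec.lookup u j)
      g = λ j → seq (a j) m ℚ.* toℚ (Vec.lookup v j)
      entry : ∀ j → seq (a j) m ℚ.* toℚ (Vec.lookup (u ⊕ v) j) ≡ f j ℚ.+ g j
      entry j = begin
        seq (a j) m ℚ.* toℚ (Vec.lookup (u ⊕ v) j)
          ≡⟨ cong (λ t → seq (a j) m ℚ.* toℚ t) (Vecₚ.lookup-zipWith ℤ._+_ j u v) ⟩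
        seq (a j) m ℚ.* toℚ (Vec.lookup u j ℤ.+ Vec.lookup v j)
          ≡⟨ cong (seq (a j) m ℚ.*_) (toℚ-+ (Vec.lookup u j) (Vec.lookup v j)) ⟩
        seq (a j) m ℚ.* (toℚ (Vec.lookup u j) ℚ.+ toℚ (Vec.lookup v j))
          ≡⟨ ℚₚ.*-distribˡ-+ (seq (a j) m) _ _ ⟩
        f j ℚ.+ g j ∎

  row-hat : ∀ b (a : ℝ^ d) m z → row b a m (hat z) ≡ seq b m ℚ.- seq (a · ι z) m
  row-hat b a m z = cong₂ ℚ._-_
    (trans (cong (seq b m ℚ.*_) toℚ-1) (ℚₚ.*-identityʳ (seq b m)))
    (sym (trans (seq-∑ (λ j → a j * ι z j) m)
      (sum-cong-≗ λ j → cong (seq (a j) m ℚ.*_) (toℚ-def (Vec.lookup z j)))))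

row-≤ : ∀ b (a : ℝ^ d) z → a · ι z ≤ b → 0≲ λ m → row b a m (hat z)
row-≤ b a z p = 0≲-resp (λ m → sym (row-hat b a m z)) (≤⇒0≲ {a · ι z} {b} p)

≤-row : ∀ b (a : ℝ^ d) z → (0≲ λ m → row b a m (hat z)) → a · ι z ≤ b
≤-row b a z p = 0≲⇒≤ {a · ι z} {b} (0≲-resp (λ m → row-hat b a m z) p)

row-⊝ : ∀ b (a : ℝ^ d) z m → seq (a · ι z) m ℚ.- seq b m ≡ row b a m (⊝ hat z)
row-⊝ b a z m = begin
  seq (a · ι z) m ℚ.- seq b m       ≡⟨ solve 2 (λ s t → s :- t := :- (t :- s)) refl (seq (a · ι z) m) (seq b m) ⟩
  ℚ.- (seq b m ℚ.- seq (a · ι z) m) ≡⟨ cong ℚ.-_ (row-hat b a m z) ⟨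
  ℚ.- row b a m (hat z)             ≡⟨ additive-⊝ (row-additive b a) m (hat z) ⟨
  row b a m (⊝ hat z)               ∎
  where open ≡-Reasoning

-row-≤ : ∀ b (a : ℝ^ d) z → b ≤ a · ι z → 0≲ λ m → row b a m (⊝ hat z)
-row-≤ b a z p = 0≲-resp (row-⊝ b a z) (≤⇒0≲ {b} {a · ι z} p)

≤--row : ∀ b (a : ℝ^ d) z → (0≲ λ m → row b a m (⊝ hat z)) → b ≤ a · ι z
≤--row b a z p = 0≲⇒≤ {b} {a · ι z} (0≲-resp (λ m → sym (row-⊝ b a z m)) p)

-- Failure of a · z ≤ b yields only the weak inequality b ≤ a · z, without a positive gap. Weak
-- signs suffice to apply an obstruction to the row.
row-¬ : ∀ b (a : ℝ^ d) z → ¬ (0≲ λ m → row b a m (hat z)) → 0≲ λ m → row b a m (⊝ hat z)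
row-¬ b a z ¬p = 0≲-resp (row-⊝ b a z) (0≲-of-¬ (cauchy (a · ι z - b)) λ q → ¬p (0≲-resp negate q))
  where
  negate : ∀ m → ℚ.- (seq (a · ι z) m ℚ.- seq b m) ≡ row b a m (hat z)
  negate m = trans (solve 2 (λ s t → :- (s :- t) := t :- s) refl (seq (a · ι z) m) (seq b m)) (sym (row-hat b a m z))

-- The integer form of "the affine hull of X is the whole space".
Spanning : List (ℤ^ d) → Set
Spanning {d} X = ∀ (h : ℤ^ (suc d)) → (∀ {x} → x ∈ X → h ∙ hat x ≡ 0ℤ) → ∀ y → h ∙ hat y ≡ 0ℤ

-- A functional that is nonnegative on the hats of X and on their negatives vanishes on X, hence
-- everywhere; so Farkas cannot separate `hat y` from the signed cone.
spanning-cone : ∀ {X : List (ℤ^ d)} → Spanning X → ∀ y → ∃[ k ] Cone (SignedHat X X) (+ suc k ⊛ hat y)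
spanning-cone {X = X} spanning y with farkas-list (List.map hat X ++ List.map (⊝_ ∘ hat) X) (hat y)
... | inj₂ (k , c) = k , cone-bind (cone-generator ∘ Sum.map (∈-map⁻ hat) (∈-map⁻ (⊝_ ∘ hat)) ∘ ∈-++⁻ (List.map hat X)) c
... | inj₁ (h , nn , neg) = contradiction (spanning h zero-on-X y) (ℤₚ.<⇒≢ neg)
  where
  zero-on-X : ∀ {x} → x ∈ X → h ∙ hat x ≡ 0ℤ
  zero-on-X {x} p = ℤₚ.≤-antisym
    (ℤₚ.neg-cancel-≤ (subst (0ℤ ℤ.≤_) (∙-⊝ʳ h (hat x)) (nn (∈-++⁺ʳ (List.map hat X) (∈-map⁺ (⊝_ ∘ hat) p)))))
    (nn (∈-++⁺ˡ (∈-map⁺ hat p)))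

-- No coefficient is rounded. An obstruction to integral separation, applied to the real row, would
-- force the row to hold at a point of Y where it is violated.
row-violated⇒separable : ∀ b (a : ℝ^ d) {X Y} → (∀ {x} → x ∈ X → 0≲ λ m → row b a m (hat x)) →
  (∀ {y} → y ∈ Y → ¬ (0≲ λ m → row b a m (hat y))) → Separable X Y
row-violated⇒separable b a {X} {Y} sat viol with separable-or-obstruction X Y
... | inj₁ s = s
... | inj₂ (y , y∈Y , k , c) = contradiction (cone-0≲ (row-additive b a) signed (k , c)) (viol y∈Y)
  where
  signed : ∀ {g} → SignedHat X Y g → 0≲ λ m → row b a m g
  signed (inj₁ (x , p , refl)) = sat {x} p
  signed (inj₂ (y , p , refl)) = row-¬ b a y (viol {y} p)

-- An equation is a pair of opposite inequalities. Both are nonnegative on the signed hats of X, and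
-- the signed cone contains a positive multiple of every `hat y`.
row-vanishes : ∀ b (a : ℝ^ d) {X} → Spanning X →
  (∀ {x} → x ∈ X → (0≲ λ m → row b a m (hat x)) × (0≲ λ m → row b a m (⊝ hat x))) →
  ∀ y → (0≲ λ m → row b a m (hat y)) × (0≲ λ m → row b a m (⊝ hat y))
row-vanishes b a {X} spanning zero-on y =
  cone-0≲ (row-additive b a) signed (spanning-cone spanning y) ,
  cone-0≲ negated-additive negated (spanning-cone spanning y)
  where
  ⊝-⊕ : ∀ {n} (u v : ℤ^ n) → ⊝ (u ⊕ v) ≡ ⊝ u ⊕ ⊝ v
  ⊝-⊕ []      []      = refl
  ⊝-⊕ (a ∷ u) (b ∷ v) = cong₂ _∷_ (ℤₚ.neg-distrib-+ a b) (⊝-⊕ u v)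
  ⊝-⊝ : ∀ {n} (u : ℤ^ n) → ⊝ ⊝ u ≡ u
  ⊝-⊝ []      = refl
  ⊝-⊝ (a ∷ u) = cong₂ _∷_ (ℤₚ.neg-involutive a) (⊝-⊝ u)
  signed : ∀ {g} → SignedHat X X g → 0≲ λ m → row b a m g
  signed (inj₁ (x , p , refl)) = proj₁ (zero-on {x} p)
  signed (inj₂ (x , p , refl)) = proj₂ (zero-on {x} p)
  negated-additive : Additive λ m v → row b a m (⊝ v)
  negated-additive = mkAdditive λ m u v → trans (cong (row b a m) (⊝-⊕ u v)) (Additive.additive (row-additive b a) m (⊝ u) (⊝ v))
  negated : ∀ {g} → SignedHat X X g → 0≲ λ m → row b a m (⊝ g)
  negated (inj₁ (x , p , refl)) = proj₂ (zero-on {x} p)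
  negated (inj₂ (x , p , refl)) = subst (λ v → 0≲ λ m → row b a m v) (sym (⊝-⊝ (hat x))) (proj₁ (zero-on {x} p))

¬¬-∀Fin : ∀ {k} {P : Pred (Fin k) 0ℓ} → (∀ i → ¬ ¬ P i) → ¬ ¬ (∀ i → P i)
¬¬-∀Fin {zero}  p ¬q = ¬q λ ()
¬¬-∀Fin {suc k} p ¬q = p zero λ p₀ → ¬¬-∀Fin (p ∘ suc) λ q → ¬q λ { zero → p₀ ; (suc i) → q i }

¬¬-∀∈ : ∀ {A : Set} {P : Pred A 0ℓ} L → (∀ {x} → x ∈ L → ¬ ¬ P x) → ¬ ¬ (∀ {x} → x ∈ L → P x)
¬¬-∀∈ []      p ¬q = ¬q λ ()
¬¬-∀∈ (x ∷ L) p ¬q = p (here refl) λ p₀ → ¬¬-∀∈ L (p ∘ there) λ q →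
  ¬q λ { (here refl) → p₀ ; (there r) → q r }

-- A point outside X violates some inequality, as it satisfies the equations, but only the double
-- negation of this is available. It is shifted through the finite box and removed at the end, where
-- the goal is decidable. Bin i collects points that violate inequality i.
described⇒coverNumber≤ : ∀ {X : List (ℤ^ d)} {j} → Spanning X → DescribedBy X j → ∀ R →
  CoverNumber≤ X (outside X R) j
described⇒coverNumber≤ {X = X} {j} spanning (_ , A , b , U , v , described) R =
  decidable-stable (coverNumber≤? X (outside X R) j) λ ¬cover →
    ¬¬-∀∈ (outside X R) (λ p → violated (outside-∉ X R p)) λ viol →
      ¬cover (cover-intro (λ i y → ¬ Row i y) (λ i L → row-violated⇒separable (b i) (A i) (λ p → sat p i))
        (λ _ → []) (λ _ ()) (outside X R) viol)
  where
  Row : Fin j → ℤ^ _ → Set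
  Row i z = 0≲ λ m → row (b i) (A i) m (hat z)
  sat : ∀ {x} → x ∈ X → ∀ i → Row i x
  sat {x} p i = row-≤ (b i) (A i) x (proj₁ (Equivalence.to (described x) p) i)
  equations : ∀ y i → U i · ι y ≈ v i
  equations y i = let p , q = row-vanishes (v i) (U i) {X} spanning zero-on y in
    ≤-antisym {U i · ι y} {v i} (≤-row (v i) (U i) y p) (≤--row (v i) (U i) y q)
    where
    zero-on : ∀ {x} → x ∈ X → (0≲ λ m → row (v i) (U i) m (hat x)) × (0≲ λ m → row (v i) (U i) m (⊝ hat x))
    zero-on {x} p = let eq = proj₂ (Equivalence.to (described x) p) i in
      row-≤ (v i) (U i) x (≈⇒≤ {U i · ι x} {v i} eq) ,
      -row-≤ (v i) (U i) x (≈⇒≤ {v i} {U i · ι x} (≈-sym {U i · ι x} {v i} eq))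
  violated : ∀ {y} → y ∉ X → ¬ ¬ (∃[ i ] ¬ Row i y)
  violated {y} y∉X ¬∃ = ¬¬-∀Fin (λ i ¬p → ¬∃ (i , ¬p)) λ all → y∉X (Equivalence.from (described y)
    ((λ i → ≤-row (b i) (A i) y (all i)) , equations y))

exact⇒describedℚ : ∀ {d k} {H : Vector (ℤ^ (suc d)) k} {X} → Exact H X → DescribedByℚ X k
-- There are no equations, and h₀ + h ∙ z ≥ 0 is read as (-h) · z ≤ h₀.
exact⇒describedℚ {d} {k} {H} exact = 0 , A , b , (λ ()) , (λ ()) , λ z → mk⇔
  (λ p → (λ i → ≤-row (fromℚ (b i)) (fromℚ ∘ A i) z
            (0≲-resp (λ m → value i z) (0≲-nonneg λ _ → nonneg (proj₁ (exact z) p i)))) , λ ())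
  (λ (p , _) → proj₂ (exact z) λ i → toℚ-cancel-≤ (ℚₚ.≤-trans (ℚₚ.≤-reflexive toℚ-0) (0≲-const
            (0≲-resp (λ m → sym (value i z)) (row-≤ (fromℚ (b i)) (fromℚ ∘ A i) z (p i))))))
  where
  A : Matrix ℚ k d
  A i j = ℚ.- toℚ (Vec.lookup (Vec.tail (H i)) j)
  b : Vector ℚ k
  b i = toℚ (Vec.head (H i))
  nonneg : ∀ {i} → 0ℤ ℤ.≤ i → 0ℚ ℚ.≤ toℚ i
  nonneg p = ℚₚ.≤-trans (ℚₚ.≤-reflexive (sym toℚ-0)) (toℚ-mono-≤ p)
  open ≡-Reasoning
  value : ∀ i z {m} → toℚ (H i ∙ hat z) ≡ row (fromℚ (b i)) (fromℚ ∘ A i) m (hat z)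
  value i z {m} = trans (value′ (H i)) (sym (trans (row-hat (fromℚ (b i)) (fromℚ ∘ A i) m z) (cong (λ t → b i ℚ.- t)
    (trans (seq-∑ (λ j → fromℚ (A i j) * ι z j) m) (sum-cong-≗ λ j → cong (A i j ℚ.*_) (toℚ-def (Vec.lookup z j)))))))
    where
    value′ : ∀ (h : ℤ^ (suc d)) → toℚ (h ∙ hat z) ≡ toℚ (Vec.head h) ℚ.-
      sum (λ j → (ℚ.- toℚ (Vec.lookup (Vec.tail h) j)) ℚ.* toℚ (Vec.lookup z j))
    value′ (h₀ ∷ h) = begin
      toℚ (h₀ ℤ.* 1ℤ ℤ.+ h ∙ z)             ≡⟨ cong (λ t → toℚ (t ℤ.+ h ∙ z)) (ℤₚ.*-identityʳ h₀) ⟩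
      toℚ (h₀ ℤ.+ h ∙ z)                    ≡⟨ toℚ-+ h₀ (h ∙ z) ⟩
      toℚ h₀ ℚ.+ toℚ (h ∙ z)                ≡⟨ cong (toℚ h₀ ℚ.+_) (toℚ-∙ h z) ⟩
      toℚ h₀ ℚ.+ sum f                      ≡⟨ cong (toℚ h₀ ℚ.+_) (solve 1 (λ s → s := :- (con (ℚ.- 1ℚ) :* s)) refl (sum f)) ⟩
      toℚ h₀ ℚ.- (ℚ.- 1ℚ ℚ.* sum f)         ≡⟨ cong (λ t → toℚ h₀ ℚ.- t) (*-distribˡ-sum (ℚ.- 1ℚ) f) ⟩
      toℚ h₀ ℚ.- sum (λ j → ℚ.- 1ℚ ℚ.* f j)
        ≡⟨ cong (λ t → toℚ h₀ ℚ.- t) (sum-cong-≗ λ j →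
             solve 2 (λ a b → con (ℚ.- 1ℚ) :* (a :* b) := (:- a) :* b) refl (toℚ (Vec.lookup h j)) (toℚ (Vec.lookup z j))) ⟩
      toℚ h₀ ℚ.- sum (λ j → (ℚ.- toℚ (Vec.lookup h j)) ℚ.* toℚ (Vec.lookup z j)) ∎
      where f = λ j → toℚ (Vec.lookup h j) ℚ.* toℚ (Vec.lookup z j)

-- The upper bound comes from a rational description and the lower bound holds for real ones, so a
-- single certificate settles both complexities.
certificate⇒rc : ∀ {X : List (ℤ^ d)} {R k} → Spanning X → Certificate X R k → IsRc X k × IsRcℚ X k
certificate⇒rc {X = X} {R} spanning (H , exact , min) =
  (real (exact⇒describedℚ {H = H} exact) , minimal) ,
  (exact⇒describedℚ {H = H} exact , λ j → minimal j ∘ real)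
  where
  real : ∀ {j} → DescribedByℚ X j → DescribedBy X j
  real (m , A , b , U , v , p) = m , (λ i j → fromℚ (A i j)) , (λ i → fromℚ (b i)) ,
    (λ i j → fromℚ (U i j)) , (λ i → fromℚ (v i)) , p
  minimal : ∀ j → DescribedBy X j → _ ℕ.≤ j
  minimal j p = min j (described⇒coverNumber≤ spanning p R)

isLeast-unique : ∀ {P : Pred ℕ 0ℓ} {k l} → IsLeast P k → IsLeast P l → l ≡ k
isLeast-unique (p , min) (q , min′) = ℕₚ.≤-antisym (min′ _ p) (min _ q)

Solvable : List (ℤ^ d) → Set
Solvable {d} X = ∃[ k ] (IsRc X k × IsRcℚ X k × algorithm outputs k on (d , X))

solvable : ∀ {X : List (ℤ^ d)} {x₀ R} → x₀ ∈ X → (∀ {z} → InHull X z → z ∈ X) → Spanning X →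
  maxNorm X ℕ.≤ R → ObserversWithin X R → Solvable X
solvable {d} {X} {R = R} x₀∈X closed spanning M≤R observers = output (algorithm-complete X x₀∈X R (¬failure {X = X} closed M≤R observers))
  where
  output : ∃[ k ] algorithm (d , X) R ≡ just k → Solvable X
  output (k , eq) = k , proj₁ (rc R eq) , proj₂ (rc R eq) ,
    first-output algorithm (d , X) (λ t eq′ → isLeast-unique {DescribedBy X} (proj₁ (rc R eq)) (proj₁ (rc t eq′))) R eq
    where
    rc : ∀ t {l} → algorithm (d , X) t ≡ just l → IsRc X l × IsRcℚ X l
    rc t eq = certificate⇒rc {X = X} {R = t} spanning (algorithm-sound X t eq)

-- Integer hulls and real convex hulls

sum-bump : ∀ (q g : Vector ℚ n) i → sum (λ j → Vector.updateAt q i (1ℚ ℚ.+_) j ℚ.* g j) ≡ g i ℚ.+ sum (λ j → q j ℚ.* g j)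
sum-bump q g zero    = solve 3 (λ q g s → (con 1ℚ :+ q) :* g :+ s := g :+ (q :* g :+ s)) refl (q zero) (g zero) _
sum-bump q g (suc i) = trans (cong (q zero ℚ.* g zero ℚ.+_) (sum-bump (q ∘ suc) (g ∘ suc) i))
  (solve 3 (λ a b s → a :+ (b :+ s) := b :+ (a :+ s)) refl (q zero ℚ.* g zero) (g (suc i)) _)

bump-nonneg : ∀ (q : Vector ℚ n) i → (∀ j → 0ℚ ℚ.≤ q j) → ∀ j → 0ℚ ℚ.≤ Vector.updateAt q i (1ℚ ℚ.+_) j
bump-nonneg q zero    p zero    = ℚₚ.+-mono-≤ (ℚₚ.nonNegative⁻¹ 1ℚ) (p zero)
bump-nonneg q zero    p (suc j) = p (suc j)
bump-nonneg q (suc i) p zero    = p zero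
bump-nonneg q (suc i) p (suc j) = bump-nonneg (q ∘ suc) i (p ∘ suc) j

sum-zero : ∀ (f : Vector ℚ n) → (∀ i → f i ≡ 0ℚ) → sum f ≡ 0ℚ
sum-zero {n} f eq = trans (sum-cong-≗ eq) (sum-replicate-zero n)

toℚ-nonneg : ∀ {i} → 0ℤ ℤ.≤ i → 0ℚ ℚ.≤ toℚ i
toℚ-nonneg p = ℚₚ.≤-trans (ℚₚ.≤-reflexive (sym toℚ-0)) (toℚ-mono-≤ p)

-- Since hat x has the leading entry 1, the index zero gives the sum of the coefficients.
weighted : ∀ {d} (X : List (ℤ^ d)) → Vector ℚ (length X) → Fin (suc d) → ℚ
weighted X q j = sum λ i → q i ℚ.* toℚ (Vec.lookup (hat (List.lookup X i)) j)

cone-weights : ∀ {X : List (ℤ^ d)} {v} → Cone (Hat X) v →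
  Σ[ q ∈ Vector ℚ (length X) ] ((∀ i → 0ℚ ℚ.≤ q i) × (∀ j → weighted X q j ≡ toℚ (Vec.lookup v j)))
cone-weights {d} {X} = cone-fold P
  ((λ _ → 0ℚ) , (λ _ → ℚₚ.≤-refl) , λ j → trans (sum-zero _ (λ i → ℚₚ.*-zeroˡ (toℚ (Vec.lookup (hat (List.lookup X i)) j))))
    (trans (sym toℚ-0) (cong toℚ (sym (Vecₚ.lookup-replicate j 0ℤ)))))
  (λ {g} {v} → step {g} {v})
  where
  P : Pred (ℤ^ (suc d)) 0ℓ
  P v = Σ[ q ∈ Vector ℚ (length X) ] ((∀ i → 0ℚ ℚ.≤ q i) × (∀ j → weighted X q j ≡ toℚ (Vec.lookup v j)))
  step : ∀ {g v} → Hat X g → P v → P (g ⊕ v)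
  step {g} {v} (x , p , refl) (q , nn , w) = Vector.updateAt q i₀ (1ℚ ℚ.+_) , bump-nonneg q i₀ nn , λ j → begin
    weighted X (Vector.updateAt q i₀ (1ℚ ℚ.+_)) j
      ≡⟨ sum-bump q (λ i → toℚ (Vec.lookup (hat (List.lookup X i)) j)) i₀ ⟩
    toℚ (Vec.lookup (hat (List.lookup X i₀)) j) ℚ.+ weighted X q j
      ≡⟨ cong₂ (λ y t → toℚ (Vec.lookup (hat y) j) ℚ.+ t) (sym (Anyₚ.lookup-index p)) (w j) ⟩
    toℚ (Vec.lookup (hat x) j) ℚ.+ toℚ (Vec.lookup v j)
      ≡⟨ toℚ-+ (Vec.lookup (hat x) j) (Vec.lookup v j) ⟨
    toℚ (Vec.lookup (hat x) j ℤ.+ Vec.lookup v j)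
      ≡⟨ cong toℚ (Vecₚ.lookup-zipWith ℤ._+_ j (hat x) v) ⟨
    toℚ (Vec.lookup (hat x ⊕ v) j) ∎
    where
    open ≡-Reasoning
    i₀ = Any.index p

reciprocal : ∀ k → ∃[ s ] (0ℚ ℚ.≤ s × (∀ q → s ℚ.* (toℚ (+ suc k) ℚ.* q) ≡ q))
reciprocal k = ℚ.1/ r , ℚₚ.nonNegative⁻¹ (ℚ.1/ r) {{ℚₚ.pos⇒nonNeg (ℚ.1/ r) {{ℚₚ.1/pos⇒pos r}}}} , λ q →
  trans (sym (ℚₚ.*-assoc (ℚ.1/ r) r q)) (trans (cong (ℚ._* q) (ℚₚ.*-inverseˡ r)) (ℚₚ.*-identityˡ q))
  where
  r = toℚ (+ suc k)
  instance
    r-pos : ℚ.Positive r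
    r-pos = ℚ.positive (subst (ℚ._< r) toℚ-0 (toℚ-mono-< (ℤ.+<+ (ℕ.s≤s ℕ.z≤n))))
    r≢0 : ℚ.NonZero r
    r≢0 = ℚₚ.pos⇒nonZero r

module _ {d} (X : List (ℤ^ d)) (q : Vector ℚ (length X)) where

  private
    c : ℝ^ (length X)
    c i = fromℚ (q i)

  weights-∑ : ∀ m → seq (∑ c) m ≡ weighted X q zero
  weights-∑ m = trans (seq-∑ c m)
    (sum-cong-≗ λ i → sym (trans (cong (q i ℚ.*_) toℚ-1) (ℚₚ.*-identityʳ (q i))))

  weights-combination : ∀ j m → seq (combination X c j) m ≡ weighted X q (suc j)
  weights-combination j m = trans (seq-∑ (λ i → c i * ι (List.lookup X i) j) m)
    (sum-cong-≗ λ i → cong (q i ℚ.*_) (toℚ-def (Vec.lookup (List.lookup X i) j)))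

  weights⇒conv : ∀ z → (∀ i → 0ℚ ℚ.≤ q i) → (∀ j → weighted X q j ≡ toℚ (Vec.lookup (hat z) j)) → conv X (ι z)
  weights⇒conv z nn w = c , nonneg , total , point
    where
    nonneg : ∀ i → 0ℝ ≤ c i
    nonneg i = 0≲⇒≤ {0ℝ} {c i} (0≲-nonneg λ _ → subst (0ℚ ℚ.≤_) (sym (ℚₚ.+-identityʳ (q i))) (nn i))
    total : ∑ c ≈ 1ℝ
    total = ≗⇒≈ {∑ c} {1ℝ} λ m → trans (weights-∑ m) (trans (w zero) toℚ-1)
    point : ι z ≈ᵥ combination X c
    point j = ≗⇒≈ {ι z j} {combination X c j} λ m →
      trans (toℚ-def (Vec.lookup z j)) (sym (trans (weights-combination j m) (w (suc j))))

scaled-weights : ∀ (X : List (ℤ^ d)) q s k z → (∀ x → s ℚ.* (toℚ (+ suc k) ℚ.* x) ≡ x) →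
  (∀ j → weighted X q j ≡ toℚ (Vec.lookup (+ suc k ⊛ hat z) j)) →
  ∀ j → weighted X (λ i → s ℚ.* q i) j ≡ toℚ (Vec.lookup (hat z) j)
scaled-weights X q s k z cancel w j = begin
  weighted X (λ i → s ℚ.* q i) j                       ≡⟨ sum-cong-≗ (λ i → ℚₚ.*-assoc s (q i) _) ⟩
  sum (λ i → s ℚ.* (q i ℚ.* toℚ (Vec.lookup (hat (List.lookup X i)) j)))
                                                       ≡⟨ *-distribˡ-sum s (λ i → q i ℚ.* toℚ (Vec.lookup (hat (List.lookup X i)) j)) ⟨
  s ℚ.* weighted X q j                                 ≡⟨ cong (s ℚ.*_) (w j) ⟩
  s ℚ.* toℚ (Vec.lookup (+ suc k ⊛ hat z) j)           ≡⟨ cong (λ t → s ℚ.* toℚ t) (Vecₚ.lookup-map j (ℤ._*_ (+ suc k)) (hat z)) ⟩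
  s ℚ.* toℚ (+ suc k ℤ.* Vec.lookup (hat z) j)         ≡⟨ cong (s ℚ.*_) (toℚ-* (+ suc k) _) ⟩
  s ℚ.* (toℚ (+ suc k) ℚ.* toℚ (Vec.lookup (hat z) j)) ≡⟨ cancel _ ⟩
  toℚ (Vec.lookup (hat z) j)                           ∎
  where open ≡-Reasoning

0≤p*q : ∀ {p q} → 0ℚ ℚ.≤ p → 0ℚ ℚ.≤ q → 0ℚ ℚ.≤ p ℚ.* q
0≤p*q {p} {q} 0≤p 0≤q = ℚₚ.nonNegative⁻¹ (p ℚ.* q)
  {{ℚₚ.nonNeg*nonNeg⇒nonNeg p {{ℚ.nonNegative 0≤p}} q {{ℚ.nonNegative 0≤q}}}}

hull⇒conv : ∀ {X : List (ℤ^ d)} {z} → InHull X z → conv X (ι z)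
hull⇒conv {X = X} {z} (k , c) =
  let q , nn , w = cone-weights c
      s , 0≤s , cancel = reciprocal k
  in weights⇒conv X (λ i → s ℚ.* q i) z (λ i → 0≤p*q 0≤s (nn i)) (scaled-weights X q s k z cancel w)

member⇒hull : ∀ {X : List (ℤ^ d)} {x} → x ∈ X → InHull X x
member⇒hull {X = X} {x} p = 0 , subst (Cone (Hat X)) (sym (⊛-identity (hat x))) (cone-generator (x , p , refl))

-- Integral affine functionals at real points

evaluate : ℤ^ (suc d) → ℝ^ d → ℕ → ℚ
evaluate h p m = toℚ (Vec.head h) ℚ.+ sum (λ j → toℚ (Vec.lookup (Vec.tail h) j) ℚ.* seq (p j) m)

evaluate-lattice : ∀ (h : ℤ^ (suc d)) z → toℚ (h ∙ hat z) ≡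
  toℚ (Vec.head h) ℚ.+ sum (λ j → toℚ (Vec.lookup (Vec.tail h) j) ℚ.* toℚ (Vec.lookup z j))
evaluate-lattice (h₀ ∷ h) z = trans (cong (λ t → toℚ (t ℤ.+ h ∙ z)) (ℤₚ.*-identityʳ h₀))
  (trans (toℚ-+ h₀ (h ∙ z)) (cong (toℚ h₀ ℚ.+_) (toℚ-∙ h z)))

evaluate-ι : ∀ (h : ℤ^ (suc d)) z m → evaluate h (ι z) m ≡ toℚ (h ∙ hat z)
evaluate-ι h z m = trans
  (cong (toℚ (Vec.head h) ℚ.+_) (sum-cong-≗ λ j → cong (toℚ (Vec.lookup (Vec.tail h) j) ℚ.*_) (toℚ-def (Vec.lookup z j))))
  (sym (evaluate-lattice h z))

record Null (s : ℕ → ℚ) : Set where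
  constructor null
  field
    nonneg : 0≲ s
    nonpos : 0≲ λ m → ℚ.- s m

open Null

null-resp : ∀ {s t} → (∀ m → s m ≡ t m) → Null s → Null t
null-resp eq (null p q) = null (0≲-resp eq p) (0≲-resp (cong ℚ.-_ ∘ eq) q)

null-+ : ∀ {s t} → Null s → Null t → Null λ m → s m ℚ.+ t m
null-+ {s} {t} (null p q) (null p′ q′) = null (0≲-+ p p′)
  (0≲-resp (λ m → sym (ℚₚ.neg-distrib-+ (s m) (t m))) (0≲-+ q q′))

null-scale : ∀ i {s} → Null s → Null λ m → toℚ i ℚ.* s m
null-scale (+ k)      {s} (null p q) = null (0≲-scale k p)
  (0≲-resp (λ m → sym (ℚₚ.neg-distribʳ-* (toℚ (+ k)) (s m))) (0≲-scale k q))
null-scale ℤ.-[1+ k ] {s} (null p q) = null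
  (0≲-resp (λ m → trans (solve 2 (λ a b → a :* (:- b) := (:- a) :* b) refl (toℚ (+ suc k)) (s m))
    (cong (ℚ._* s m) (sym (toℚ-neg (+ suc k))))) (0≲-scale (suc k) q))
  (0≲-resp (λ m → trans (solve 2 (λ a b → a :* b := :- ((:- a) :* b)) refl (toℚ (+ suc k)) (s m))
    (cong (λ t → ℚ.- (t ℚ.* s m)) (sym (toℚ-neg (+ suc k))))) (0≲-scale (suc k) p))

null-zero : ∀ {s} → (∀ m → s m ≡ 0ℚ) → Null s
null-zero eq = null (0≲-nonneg λ m → ℚₚ.≤-reflexive (sym (eq m))) (0≲-nonneg λ m → ℚₚ.≤-reflexive (cong ℚ.-_ (sym (eq m))))

null-sum : ∀ {s : Fin n → ℕ → ℚ} → (∀ i → Null (s i)) → Null λ m → sum (λ i → s i m)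
null-sum {zero}  p = null-zero λ _ → refl
null-sum {suc n} p = null-+ (p zero) (null-sum (p ∘ suc))

0≲-sum : ∀ {s : Fin n → ℕ → ℚ} → (∀ i → 0≲ s i) → 0≲ λ m → sum (λ i → s i m)
0≲-sum {zero}  p = 0≲-nonneg λ _ → ℚₚ.≤-refl
0≲-sum {suc n} p = 0≲-+ (p zero) (0≲-sum (p ∘ suc))

≈⇒null : ∀ {x y} → x ≈ y → Null λ m → seq x m ℚ.- seq y m
≈⇒null {x} {y} p = null (≤⇒0≲ {y} {x} (≈⇒≤ {y} {x} (≈-sym {x} {y} p)))
  (0≲-resp (λ m → solve 2 (λ a b → b :- a := :- (a :- b)) refl (seq x m) (seq y m)) (≤⇒0≲ {x} {y} (≈⇒≤ {x} {y} p)))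

null⇒≈ : ∀ {x y} → (Null λ m → seq x m ℚ.- seq y m) → x ≈ y
null⇒≈ {x} {y} (null p q) = ≤-antisym {x} {y}
  (0≲⇒≤ {x} {y} (0≲-resp (λ m → solve 2 (λ a b → :- (a :- b) := b :- a) refl (seq x m) (seq y m)) q))
  (0≲⇒≤ {y} {x} p)

sum-combination : ∀ {l} (h₀ : ℚ) (h : Vector ℚ d) (c : Vector ℚ l) (x : Fin l → Fin d → ℚ) →
  sum (λ k → c k ℚ.* (h₀ ℚ.+ sum (λ j → h j ℚ.* x k j))) ≡
  h₀ ℚ.* sum c ℚ.+ sum (λ j → h j ℚ.* sum (λ k → c k ℚ.* x k j))
sum-combination h₀ h c x = begin
  sum (λ k → c k ℚ.* (h₀ ℚ.+ sum (λ j → h j ℚ.* x k j)))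
    ≡⟨ sum-cong-≗ (λ k → trans (ℚₚ.*-distribˡ-+ (c k) h₀ _) (cong₂ ℚ._+_ (ℚₚ.*-comm (c k) h₀)
         (trans (*-distribˡ-sum (c k) (λ j → h j ℚ.* x k j)) (sum-cong-≗ λ j →
           solve 3 (λ c h x → c :* (h :* x) := h :* (c :* x)) refl (c k) (h j) (x k j))))) ⟩
  sum (λ k → h₀ ℚ.* c k ℚ.+ sum (λ j → h j ℚ.* (c k ℚ.* x k j)))
    ≡⟨ ∑-distrib-+ (λ k → h₀ ℚ.* c k) (λ k → sum (λ j → h j ℚ.* (c k ℚ.* x k j))) ⟩
  sum (λ k → h₀ ℚ.* c k) ℚ.+ sum (λ k → sum (λ j → h j ℚ.* (c k ℚ.* x k j)))
    ≡⟨ cong₂ ℚ._+_ (*-distribˡ-sum h₀ c) (trans (sum-cong-≗ λ j → *-distribˡ-sum (h j) (λ k → c k ℚ.* x k j))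
         (∑-comm (λ j k → h j ℚ.* (c k ℚ.* x k j)))) ⟨
  h₀ ℚ.* sum c ℚ.+ sum (λ j → h j ℚ.* sum (λ k → c k ℚ.* x k j)) ∎
  where open ≡-Reasoning

-- The difference equals -h₀ (∑ c - 1) plus the sum of h′ⱼ times (p - `combination X c`)ⱼ, exactly
-- at each index, and both brackets tend to 0.
evaluate-combination : ∀ (X : List (ℤ^ d)) c {p} h → ∑ c ≈ 1ℝ → p ≈ᵥ combination X c →
  Null λ m → evaluate h p m ℚ.- sum (λ k → seq (c k) m ℚ.* toℚ (h ∙ hat (List.lookup X k)))
evaluate-combination {d} X c {p} h@(h₀ ∷ h′) Σc≈1 p≈ = null-resp identity (null-+
  (null-scale (ℤ.- h₀) (≈⇒null {∑ c} {1ℝ} Σc≈1))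
  (null-sum λ j → null-scale (Vec.lookup h′ j) (≈⇒null {p j} {combination X c j} (p≈ j))))
  where
  open ≡-Reasoning
  module _ (m : ℕ) where
    C : Vector ℚ (length X)
    C k = seq (c k) m
    P η : Vector ℚ d
    P j = seq (p j) m
    η j = toℚ (Vec.lookup h′ j)
    x : Fin (length X) → Fin d → ℚ
    x k j = toℚ (Vec.lookup (List.lookup X k) j)
    comb-seq : ∀ j → seq (combination X c j) m ≡ sum (λ k → C k ℚ.* x k j)
    comb-seq j = trans (seq-∑ (λ k → c k * ι (List.lookup X k) j) m) (sum-cong-≗ λ k → cong (C k ℚ.*_) (toℚ-def _))
    values : sum (λ k → C k ℚ.* toℚ (h ∙ hat (List.lookup X k))) ≡
             toℚ h₀ ℚ.* sum C ℚ.+ sum (λ j → η j ℚ.* sum (λ k → C k ℚ.* x k j))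
    values = trans (sum-cong-≗ λ k → cong (C k ℚ.*_) (evaluate-lattice h (List.lookup X k)))
      (sum-combination (toℚ h₀) η C x)
    split : sum (λ j → η j ℚ.* (P j ℚ.- seq (combination X c j) m)) ≡
            sum (λ j → η j ℚ.* P j) ℚ.+ ℚ.- 1ℚ ℚ.* sum (λ j → η j ℚ.* sum (λ k → C k ℚ.* x k j))
    split = begin
      sum (λ j → η j ℚ.* (P j ℚ.- seq (combination X c j) m))
        ≡⟨ sum-cong-≗ (λ j → trans (cong (λ t → η j ℚ.* (P j ℚ.- t)) (comb-seq j))
             (solve 3 (λ h p s → h :* (p :- s) := h :* p :+ con (ℚ.- 1ℚ) :* (h :* s)) refl (η j) (P j) _)) ⟩
      sum (λ j → η j ℚ.* P j ℚ.+ ℚ.- 1ℚ ℚ.* (η j ℚ.* sum (λ k → C k ℚ.* x k j)))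
        ≡⟨ ∑-distrib-+ (λ j → η j ℚ.* P j) (λ j → ℚ.- 1ℚ ℚ.* (η j ℚ.* sum (λ k → C k ℚ.* x k j))) ⟩
      sum (λ j → η j ℚ.* P j) ℚ.+ sum (λ j → ℚ.- 1ℚ ℚ.* (η j ℚ.* sum (λ k → C k ℚ.* x k j)))
        ≡⟨ cong (sum (λ j → η j ℚ.* P j) ℚ.+_) (*-distribˡ-sum (ℚ.- 1ℚ) (λ j → η j ℚ.* sum (λ k → C k ℚ.* x k j))) ⟨
      sum (λ j → η j ℚ.* P j) ℚ.+ ℚ.- 1ℚ ℚ.* sum (λ j → η j ℚ.* sum (λ k → C k ℚ.* x k j)) ∎
    identity : toℚ (ℤ.- h₀) ℚ.* (seq (∑ c) m ℚ.- 1ℚ) ℚ.+ sum (λ j → η j ℚ.* (P j ℚ.- seq (combination X c j) m)) ≡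
               evaluate h p m ℚ.- sum (λ k → C k ℚ.* toℚ (h ∙ hat (List.lookup X k)))
    identity = begin
      toℚ (ℤ.- h₀) ℚ.* (seq (∑ c) m ℚ.- 1ℚ) ℚ.+ sum (λ j → η j ℚ.* (P j ℚ.- seq (combination X c j) m))
        ≡⟨ cong₂ ℚ._+_ (cong₂ (λ a b → a ℚ.* (b ℚ.- 1ℚ)) (toℚ-neg h₀) (seq-∑ c m)) split ⟩
      (ℚ.- toℚ h₀) ℚ.* (sum C ℚ.- 1ℚ) ℚ.+ (sum (λ j → η j ℚ.* P j) ℚ.+ ℚ.- 1ℚ ℚ.* sum (λ j → η j ℚ.* sum (λ k → C k ℚ.* x k j)))
        ≡⟨ solve 4 (λ a s u w → (:- a) :* (s :- con 1ℚ) :+ (u :+ con (ℚ.- 1ℚ) :* w) := (a :+ u) :- (a :* s :+ w)) refl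
             (toℚ h₀) (sum C) (sum (λ j → η j ℚ.* P j)) (sum (λ j → η j ℚ.* sum (λ k → C k ℚ.* x k j))) ⟩
      (toℚ h₀ ℚ.+ sum (λ j → η j ℚ.* P j)) ℚ.- (toℚ h₀ ℚ.* sum C ℚ.+ sum (λ j → η j ℚ.* sum (λ k → C k ℚ.* x k j)))
        ≡⟨ cong (λ t → evaluate h p m ℚ.- t) values ⟨
      evaluate h p m ℚ.- sum (λ k → C k ℚ.* toℚ (h ∙ hat (List.lookup X k))) ∎

conv-nonneg : ∀ {X : List (ℤ^ d)} {p} h → conv X p → (∀ {x} → x ∈ X → 0ℤ ℤ.≤ h ∙ hat x) → 0≲ evaluate h p
conv-nonneg {X = X} {p} h (c , c≥0 , Σc≈1 , p≈) nn = 0≲-resp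
  (λ m → solve 2 (λ s e → s :+ (e :- s) := e) refl (sum (λ k → seq (c k) m ℚ.* toℚ (h ∙ hat (List.lookup X k)))) (evaluate h p m))
  (0≲-+ (0≲-sum term) (nonneg (evaluate-combination X c {p} h Σc≈1 p≈)))
  where
  scaled : ∀ k {i} → 0ℤ ℤ.≤ i → 0≲ λ m → seq (c k) m ℚ.* toℚ i
  scaled k {+ l} _ = 0≲-resp (λ m → trans (cong (toℚ (+ l) ℚ.*_) (ℚₚ.+-identityʳ (seq (c k) m))) (ℚₚ.*-comm (toℚ (+ l)) (seq (c k) m)))
    (0≲-scale l (≤⇒0≲ {0ℝ} {c k} (c≥0 k)))
  term : ∀ k → 0≲ λ m → seq (c k) m ℚ.* toℚ (h ∙ hat (List.lookup X k))
  term k = scaled k (nn (∈-lookup {xs = X} k))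

aff-zero : ∀ {X : List (ℤ^ d)} {p} h → aff X p → (∀ {x} → x ∈ X → h ∙ hat x ≡ 0ℤ) → Null (evaluate h p)
aff-zero {X = X} {p} h (c , Σc≈1 , p≈) zero-on = null-resp
  (λ m → trans (cong (λ t → evaluate h p m ℚ.- t) (sum-zero _ (λ k → begin
    seq (c k) m ℚ.* toℚ (h ∙ hat (List.lookup X k))  ≡⟨ cong (λ t → seq (c k) m ℚ.* toℚ t) (zero-on (∈-lookup {xs = X} k)) ⟩
    seq (c k) m ℚ.* toℚ 0ℤ                           ≡⟨ cong (seq (c k) m ℚ.*_) toℚ-0 ⟩
    seq (c k) m ℚ.* 0ℚ                               ≡⟨ ℚₚ.*-zeroʳ (seq (c k) m) ⟩
    0ℚ                                               ∎)))
    (ℚₚ.+-identityʳ (evaluate h p m)))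
  (evaluate-combination X c {p} h Σc≈1 p≈)
  where open ≡-Reasoning

hull-or-separated : ∀ (X : List (ℤ^ d)) z →
  InHull X z ⊎ ∃[ h ] ((∀ {x} → x ∈ X → 0ℤ ℤ.≤ h ∙ hat x) × h ∙ hat z ℤ.< 0ℤ)
hull-or-separated X z with farkas-list (List.map hat X) (hat z)
... | inj₂ (k , c) = inj₁ (k , cone-bind (cone-generator ∘ ∈-map⁻ hat) c)
... | inj₁ (h , nn , neg) = inj₂ (h , (λ q → nn (∈-map⁺ hat q)) , neg)

-- The real weights are not made rational. Farkas offers an integral combination or an integral
-- separating functional, and the real weights rule out the latter.
conv⇒hull : ∀ (X : List (ℤ^ d)) z → conv X (ι z) → InHull X z
conv⇒hull X z p = decide (hull-or-separated X z)
  where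
  lattice-value : ∀ h → (∀ {x} → x ∈ X → 0ℤ ℤ.≤ h ∙ hat x) → 0ℤ ℤ.≤ h ∙ hat z
  lattice-value h nn = toℚ-cancel-≤ (ℚₚ.≤-trans (ℚₚ.≤-reflexive toℚ-0)
    (0≲-const (0≲-resp (evaluate-ι h z) (conv-nonneg {X = X} {ι z} h p nn))))
  decide : InHull X z ⊎ ∃[ h ] ((∀ {x} → x ∈ X → 0ℤ ℤ.≤ h ∙ hat x) × h ∙ hat z ℤ.< 0ℤ) → InHull X z
  decide (inj₁ hull)           = hull
  decide (inj₂ (h , nn , neg)) = contradiction (lattice-value h nn) (ℤₚ.<⇒≱ neg)

latticeConvex⇒closed : ∀ {X : List (ℤ^ d)} → LatticeConvex X → ∀ {z} → InHull X z → z ∈ X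
latticeConvex⇒closed {X = X} lc {z} hull = Equivalence.to (lc z) (hull⇒conv {X = X} {z} hull)

-- Condition (a)

n<2^n : ∀ n → n ℕ.< 2 ℕ.^ n
n<2^n zero    = ℕ.s≤s ℕ.z≤n
n<2^n (suc n) = ℕₚ.≤-trans (ℕₚ.+-mono-≤ {1} {2 ℕ.^ n} (ℕₚ.m^n>0 2 n) (n<2^n n))
  (ℕₚ.≤-reflexive (cong (2 ℕ.^ n ℕ.+_) (sym (ℕₚ.+-identityʳ (2 ℕ.^ n)))))

divisible-by-powers⇒0 : ∀ i → (∀ n → ∃[ c ] i ≡ + (2 ℕ.^ n) ℤ.* c) → i ≡ 0ℤ
divisible-by-powers⇒0 i div = go (div ℤ.∣ i ∣)
  where
  N = 2 ℕ.^ ℤ.∣ i ∣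
  open ℕₚ.≤-Reasoning
  small-quotient : ∀ c m → ℤ.∣ c ∣ ≡ m → i ≡ + N ℤ.* c → m ≡ 0
  small-quotient c zero    abs eq = refl
  small-quotient c (suc m) abs eq = contradiction (n<2^n ℤ.∣ i ∣) (ℕₚ.≤⇒≯ (begin
    N                      ≤⟨ ℕₚ.m≤m*n N (suc m) ⟩
    N ℕ.* suc m            ≡⟨ cong (N ℕ.*_) abs ⟨
    N ℕ.* ℤ.∣ c ∣          ≡⟨ ℤₚ.abs-* (+ N) c ⟨
    ℤ.∣ + N ℤ.* c ∣        ≡⟨ cong ℤ.∣_∣ eq ⟨
    ℤ.∣ i ∣                ∎))
  go : ∃[ c ] i ≡ + N ℤ.* c → i ≡ 0ℤ
  go (c , eq) = trans eq (trans (cong (ℤ._*_ (+ N)) (ℤₚ.∣i∣≡0⇒i≡0 {c} (small-quotient c ℤ.∣ c ∣ refl eq))) (ℤₚ.*-zeroʳ (+ N)))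

congruent : ∀ (x z : ℤ^ n) → (∀ i → (+ 2) ℤ∣.∣ (Vec.lookup x i ℤ.- Vec.lookup z i)) → ∃[ q ] x ≡ z ⊕ (+ 2) ⊛ q
congruent []      []      _   = [] , refl
congruent (a ∷ x) (b ∷ z) div with congruent x z (div ∘ suc) | Signed.∣ᵤ⇒∣ (div zero)
... | q , eq | Signed.divides c eq′ = c ∷ q ,
  cong₂ _∷_ (trans (shift a b) (cong (ℤ._+_ b) (trans eq′ (ℤₚ.*-comm c (+ 2))))) eq
  where
  shift : ∀ a b → a ≡ b ℤ.+ (a ℤ.- b)
  shift = solve-∀

all-even : ∀ (v : ℤ^ n) → (∀ i → ∃[ c ] Vec.lookup v i ≡ + 2 ℤ.* c) → ∃[ g ] v ≡ (+ 2) ⊛ g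
all-even []      _    = [] , refl
all-even (a ∷ v) even with all-even v (even ∘ suc) | even zero
... | g , eq | c , eq′ = c ∷ g , cong₂ _∷_ eq′ eq

VanishesOn : List (ℤ^ d) → ℤ^ (suc d) → Set
VanishesOn X h = ∀ {x} → x ∈ X → h ∙ hat x ≡ 0ℤ

2⊛-double : ∀ (z q : ℤ^ n) → z ⊕ (z ⊕ (+ 2) ⊛ q) ≡ (+ 2) ⊛ (z ⊕ q)
2⊛-double []      []      = refl
2⊛-double (a ∷ z) (b ∷ q) = cong₂ _∷_ (lemma a b) (2⊛-double z q)
  where
  lemma : ∀ a b → a ℤ.+ (a ℤ.+ + 2 ℤ.* b) ≡ + 2 ℤ.* (a ℤ.+ b)
  lemma = solve-∀

module _ {X : List (ℤ^ d)} (parities : RepresentsAllParities X) where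

  representative : ∀ z → ∃[ q ] (z ⊕ (+ 2) ⊛ q ∈ X)
  representative z with parities z
  ... | x , x∈X , div with congruent x z div
  ...   | q , refl = q , x∈X

  -- Testing h on representatives of the classes of 𝟘 and of `unit j` shows that h₀ and h₀ + hⱼ are
  -- even.
  vanishing-even : ∀ h → VanishesOn X h → ∃[ g ] h ≡ (+ 2) ⊛ g
  vanishing-even (h₀ ∷ h) vanish = all-even (h₀ ∷ h) λ { zero → ℤ.- (h ∙ q₀) , head-even ; (suc j) → tail-even j }
    where
    open ≡-Reasoning
    expand : ∀ z q → h₀ ℤ.* 1ℤ ℤ.+ h ∙ (z ⊕ (+ 2) ⊛ q) ≡ h₀ ℤ.+ (h ∙ z ℤ.+ + 2 ℤ.* (h ∙ q))
    expand z q = cong₂ ℤ._+_ (ℤₚ.*-identityʳ h₀) (trans (∙-⊕ʳ h z ((+ 2) ⊛ q)) (cong (ℤ._+_ (h ∙ z)) (∙-⊛ʳ (+ 2) h q)))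
    relation : ∀ z → let q = proj₁ (representative z) in h₀ ℤ.+ (h ∙ z ℤ.+ + 2 ℤ.* (h ∙ q)) ≡ 0ℤ
    relation z = trans (sym (expand z (proj₁ (representative z)))) (vanish (proj₂ (representative z)))
    q₀ = proj₁ (representative 𝟘)
    head-even : h₀ ≡ + 2 ℤ.* (ℤ.- (h ∙ q₀))
    head-even = begin
      h₀                                                               ≡⟨ lemma h₀ (h ∙ q₀) ⟩
      h₀ ℤ.+ (0ℤ ℤ.+ + 2 ℤ.* (h ∙ q₀)) ℤ.+ + 2 ℤ.* (ℤ.- (h ∙ q₀))     ≡⟨ cong (λ t → h₀ ℤ.+ (t ℤ.+ + 2 ℤ.* (h ∙ q₀)) ℤ.+ + 2 ℤ.* (ℤ.- (h ∙ q₀))) (∙-𝟘ʳ h) ⟨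
      h₀ ℤ.+ (h ∙ 𝟘 ℤ.+ + 2 ℤ.* (h ∙ q₀)) ℤ.+ + 2 ℤ.* (ℤ.- (h ∙ q₀))  ≡⟨ cong (λ t → t ℤ.+ + 2 ℤ.* (ℤ.- (h ∙ q₀))) (relation 𝟘) ⟩
      0ℤ ℤ.+ + 2 ℤ.* (ℤ.- (h ∙ q₀))                                    ≡⟨ ℤₚ.+-identityˡ _ ⟩
      + 2 ℤ.* (ℤ.- (h ∙ q₀))                                           ∎
      where
      lemma : ∀ a b → a ≡ a ℤ.+ (0ℤ ℤ.+ + 2 ℤ.* b) ℤ.+ + 2 ℤ.* (ℤ.- b)
      lemma = solve-∀
    tail-even : ∀ j → ∃[ c ] Vec.lookup h j ≡ + 2 ℤ.* c
    tail-even j = h ∙ q₀ ℤ.- h ∙ q , (begin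
      Vec.lookup h j                               ≡⟨ trans (∙-comm h (unit j)) (unit-∙ j h) ⟨
      h ∙ unit j                                   ≡⟨ lemma h₀ (h ∙ unit j) (h ∙ q) ⟩
      h₀ ℤ.+ (h ∙ unit j ℤ.+ + 2 ℤ.* (h ∙ q)) ℤ.+ (ℤ.- h₀ ℤ.+ + 2 ℤ.* (ℤ.- (h ∙ q)))
                                                   ≡⟨ cong₂ (λ s t → s ℤ.+ (ℤ.- t ℤ.+ + 2 ℤ.* (ℤ.- (h ∙ q)))) (relation (unit j)) head-even ⟩
      0ℤ ℤ.+ (ℤ.- (+ 2 ℤ.* (ℤ.- (h ∙ q₀))) ℤ.+ + 2 ℤ.* (ℤ.- (h ∙ q)))
                                                   ≡⟨ lemma′ (h ∙ q₀) (h ∙ q) ⟩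
      + 2 ℤ.* (h ∙ q₀ ℤ.- h ∙ q)                   ∎)
      where
      q = proj₁ (representative (unit j))
      lemma : ∀ a b c → b ≡ a ℤ.+ (b ℤ.+ + 2 ℤ.* c) ℤ.+ (ℤ.- a ℤ.+ + 2 ℤ.* (ℤ.- c))
      lemma = solve-∀
      lemma′ : ∀ a b → 0ℤ ℤ.+ (ℤ.- (+ 2 ℤ.* (ℤ.- a)) ℤ.+ + 2 ℤ.* (ℤ.- b)) ≡ + 2 ℤ.* (a ℤ.- b)
      lemma′ = solve-∀

  -- A 2-adic descent: h is even and its half vanishes on X again. The values of h are then
  -- divisible by all powers of 2, hence 0, which makes X spanning.
  vanishing-divisible : ∀ n h → VanishesOn X h → ∃[ g ] h ≡ + (2 ℕ.^ n) ⊛ g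
  vanishing-divisible zero    h vanish = h , sym (⊛-identity h)
  vanishing-divisible (suc n) h vanish with vanishing-even h vanish
  ... | g , refl with vanishing-divisible n g (λ {x} p → ℤₚ.*-cancelˡ-≡ (+ 2) _ _
                        (trans (sym (∙-⊛ˡ (+ 2) g (hat x))) (trans (vanish p) (sym (ℤₚ.*-zeroʳ (+ 2))))))
  ...   | g′ , refl = g′ , trans (sym (⊛-assoc (+ 2) (+ (2 ℕ.^ n)) g′)) (cong (_⊛ g′) (sym (ℤₚ.pos-* 2 (2 ℕ.^ n))))

  parities⇒spanning : Spanning X
  parities⇒spanning h vanish y = divisible-by-powers⇒0 (h ∙ hat y) λ n → let g , eq = vanishing-divisible n h vanish in
    g ∙ hat y , trans (cong (_∙ hat y) eq) (∙-⊛ˡ (+ (2 ℕ.^ n)) g (hat y))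

  -- If the midpoint m of z and x lies in X, then z = 2 m - x has norm at most 2 + 1 times
  -- `maxNorm X`.
  parities⇒observersWithin : ObserversWithin X (3 ℕ.* maxNorm X)
  parities⇒observersWithin z z∉X R<z only with representative z
  ... | q , x∈X with only (z ⊕ q) (1 , subst (Cone (Hat (z ∷ X))) (2⊛-double (hat z) (0ℤ ∷ q))
                      (cone-⊕ (cone-generator (z , here refl , refl)) (cone-generator (z ⊕ (+ 2) ⊛ q , there x∈X , refl))))
  -- A midpoint equal to z forces x = z, so z would lie in X.
  ...   | inj₂ eq = z∉X (subst (_∈ X) (trans (cong (λ q → z ⊕ (+ 2) ⊛ q) q≡𝟘) (trans (cong (z ⊕_) (⊛-𝟘 (+ 2))) (⊕-identityʳ z))) x∈X)
    where
    recover : ∀ a b → b ≡ (a ℤ.+ b) ℤ.- a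
    recover = solve-∀
    cancel : ∀ {n} (z q : ℤ^ n) → z ⊕ q ≡ z → q ≡ 𝟘
    cancel []      []      _  = refl
    cancel (a ∷ z) (b ∷ q) eq = cong₂ _∷_
      (trans (recover a b) (trans (cong (ℤ._- a) (Vecₚ.∷-injectiveˡ eq)) (ℤₚ.+-inverseʳ a))) (cancel z q (Vecₚ.∷-injectiveʳ eq))
    q≡𝟘 = cancel z q eq
  ...   | inj₁ m∈X = ℕₚ.<⇒≱ R<z (norm≤ z λ c → begin
    ℤ.∣ Vec.lookup z c ∣                                       ≡⟨ cong ℤ.∣_∣ (entry c) ⟩
    ℤ.∣ + 2 ℤ.* Vec.lookup m c ℤ.- Vec.lookup x c ∣            ≤⟨ ℤₚ.∣i-j∣≤∣i∣+∣j∣ (+ 2 ℤ.* Vec.lookup m c) (Vec.lookup x c) ⟩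
    ℤ.∣ + 2 ℤ.* Vec.lookup m c ∣ ℕ.+ ℤ.∣ Vec.lookup x c ∣      ≡⟨ cong (ℕ._+ ℤ.∣ Vec.lookup x c ∣) (ℤₚ.abs-* (+ 2) (Vec.lookup m c)) ⟩
    2 ℕ.* ℤ.∣ Vec.lookup m c ∣ ℕ.+ ℤ.∣ Vec.lookup x c ∣        ≤⟨ ℕₚ.+-mono-≤ (ℕₚ.*-monoʳ-≤ 2 (small m m∈X c)) (small x x∈X c) ⟩
    2 ℕ.* maxNorm X ℕ.+ maxNorm X                              ≡⟨ ℕₚ.+-comm (2 ℕ.* maxNorm X) (maxNorm X) ⟩
    3 ℕ.* maxNorm X                                            ∎)
    where
    open ℕₚ.≤-Reasoning
    m = z ⊕ q
    x = z ⊕ (+ 2) ⊛ q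
    small : ∀ y → y ∈ X → ∀ c → ℤ.∣ Vec.lookup y c ∣ ℕ.≤ maxNorm X
    small y p c = ℕₚ.≤-trans (entry≤norm y c) (norm≤maxNorm p)
    entry : ∀ c → Vec.lookup z c ≡ + 2 ℤ.* Vec.lookup m c ℤ.- Vec.lookup x c
    entry c rewrite Vecₚ.lookup-zipWith ℤ._+_ c z q | Vecₚ.lookup-zipWith ℤ._+_ c z ((+ 2) ⊛ q) | Vecₚ.lookup-map c (ℤ._*_ (+ 2)) q
      = lemma (Vec.lookup z c) (Vec.lookup q c)
      where
      lemma : ∀ a b → a ≡ + 2 ℤ.* (a ℤ.+ b) ℤ.- (a ℤ.+ + 2 ℤ.* b)
      lemma = solve-∀

  parity-solvable : LatticeConvex X → Solvable X
  parity-solvable lc = solvable {X = X} {R = 3 ℕ.* maxNorm X} (proj₂ (representative 𝟘))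
    (latticeConvex⇒closed {X = X} lc) parities⇒spanning (ℕₚ.m≤m+n (maxNorm X) (2 ℕ.* maxNorm X)) parities⇒observersWithin

-- Condition (b)

lookup-ext : ∀ {u v : ℤ^ n} → (∀ c → Vec.lookup u c ≡ Vec.lookup v c) → u ≡ v
lookup-ext {u = u} {v} eq =
  trans (sym (Vecₚ.tabulate∘lookup u)) (trans (Vecₚ.tabulate-cong eq) (Vecₚ.tabulate∘lookup v))

same-quotient⇒close : ∀ a b M .{{_ : ℕ.NonZero M}} → a ℕ./ M ≡ b ℕ./ M → ℤ.∣ + a ℤ.- + b ∣ ℕ.≤ M
same-quotient⇒close a b M eq = begin
  ℤ.∣ + a ℤ.- + b ∣                              ≡⟨ cong ℤ.∣_∣ difference ⟩
  ℤ.∣ + (a ℕ.% M) ℤ.- + (b ℕ.% M) ∣              ≡⟨ cong ℤ.∣_∣ (ℤₚ.m-n≡m⊖n (a ℕ.% M) (b ℕ.% M)) ⟩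
  ℤ.∣ (a ℕ.% M) ℤ.⊖ (b ℕ.% M) ∣                  ≤⟨ ℤₚ.∣m⊝n∣≤m⊔n (a ℕ.% M) (b ℕ.% M) ⟩
  (a ℕ.% M) ℕ.⊔ (b ℕ.% M)                        ≤⟨ ℕₚ.⊔-lub (ℕₚ.<⇒≤ (ℕ/.m%n<n a M)) (ℕₚ.<⇒≤ (ℕ/.m%n<n b M)) ⟩
  M                                              ∎
  where
  open ℕₚ.≤-Reasoning
  split : ∀ a → + a ≡ + (a ℕ.% M) ℤ.+ + (a ℕ./ M ℕ.* M)
  split a = trans (cong +_ (ℕ/.m≡m%n+[m/n]*n a M)) (ℤₚ.pos-+ (a ℕ.% M) (a ℕ./ M ℕ.* M))
  cancel : ∀ x y q → (x ℤ.+ q) ℤ.- (y ℤ.+ q) ≡ x ℤ.- y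
  cancel = solve-∀
  difference : + a ℤ.- + b ≡ + (a ℕ.% M) ℤ.- + (b ℕ.% M)
  difference = trans (cong₂ ℤ._-_ (split a) (trans (split b) (cong (λ q → + (b ℕ.% M) ℤ.+ + (q ℕ.* M)) (sym eq))))
    (cancel (+ (a ℕ.% M)) (+ (b ℕ.% M)) (+ (a ℕ./ M ℕ.* M)))

-- Dirichlet's simultaneous approximation, by the pigeonhole principle on the multiples of w
-- modulo K M, classified into cells of side M.
module Dirichlet {d} (w : ℤ^ d) (K : ℕ) .{{_ : ℕ.NonZero K}} where

  M = K ℕ.^ d

  private
    instance
      M≢0 : ℕ.NonZero M
      M≢0 = ℕₚ.m^n≢0 K d
      KM≢0 : ℕ.NonZero (K ℕ.* M)
      KM≢0 = ℕₚ.m*n≢0 K M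

    multiple : ℕ → Fin d → ℤ
    multiple i c = + i ℤ.* Vec.lookup w c

    residue : ℕ → Fin d → ℕ
    residue i c = multiple i c ℤ.%ℕ (K ℕ.* M)

    cell : ℕ → Fin d → Fin K
    cell i c = fromℕ< (ℕ/.m<n*o⇒m/o<n {n = K} {M} (ℤ/.n%ℕd<d (multiple i c) (K ℕ.* M)))

    cell⇒close : ∀ i j c → cell i c ≡ cell j c → ℤ.∣ + residue i c ℤ.- + residue j c ∣ ℕ.≤ M
    cell⇒close i j c eq = same-quotient⇒close (residue i c) (residue j c) M
      (trans (sym (Finₚ.toℕ-fromℕ< _)) (trans (cong toℕ eq) (Finₚ.toℕ-fromℕ< _)))

    collision : ∃[ i ] ∃[ j ] (i ℕ.< j × j ℕ.≤ M × (∀ c → cell i c ≡ cell j c))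
    -- The multiples 0, ..., M are one more than the K ^ d = M cells.
    collision with Finₚ.pigeonhole (ℕₚ.n<1+n M) (λ i → funToFin (cell (toℕ i)))
    ... | i , j , i<j , eq = toℕ i , toℕ j , i<j , ℕ.s≤s⁻¹ (Finₚ.toℕ<n j) , λ c →
      trans (sym (Finₚ.finToFun-funToFin (cell (toℕ i)) c))
        (trans (cong (λ f → finToFun f c) eq) (Finₚ.finToFun-funToFin (cell (toℕ j)) c))

  -- After division by K M: the fraction t / (K M), positive and at most 1 / K, brings w within 1 /
  -- K of the lattice vector v in every coordinate.
  dirichlet : ∃[ t ] ∃[ v ] ∃[ r ] (1 ℕ.≤ t × t ℕ.≤ M × (∀ c → ℤ.∣ Vec.lookup r c ∣ ℕ.≤ M) ×
    + t ⊛ w ≡ (+ (K ℕ.* M)) ⊛ v ⊕ r)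
  dirichlet with collision
  ... | i , j , i<j , j≤M , same = t , v , r , ℕₚ.m<n⇒0<n∸m i<j , ℕₚ.≤-trans (ℕₚ.m∸n≤m j i) j≤M ,
      (λ c → subst (λ x → ℤ.∣ x ∣ ℕ.≤ M) (sym (Vecₚ.lookup∘tabulate _ c)) (cell⇒close j i c (sym (same c)))) ,
      lookup-ext λ c → begin
        Vec.lookup (+ t ⊛ w) c                              ≡⟨ Vecₚ.lookup-map c (ℤ._*_ (+ t)) w ⟩
        + t ℤ.* Vec.lookup w c                              ≡⟨ cong (ℤ._* Vec.lookup w c) t≡ ⟩
        (+ j ℤ.- + i) ℤ.* Vec.lookup w c                    ≡⟨ distrib (+ j) (+ i) (Vec.lookup w c) ⟩
        multiple j c ℤ.- multiple i c                       ≡⟨ cong₂ ℤ._-_ (ℤ/.a≡a%ℕn+[a/ℕn]*n (multiple j c) D)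
                                                                 (ℤ/.a≡a%ℕn+[a/ℕn]*n (multiple i c) D) ⟩
        (+ residue j c ℤ.+ (multiple j c ℤ./ℕ D) ℤ.* + D) ℤ.- (+ residue i c ℤ.+ (multiple i c ℤ./ℕ D) ℤ.* + D)
          ≡⟨ collect (+ residue j c) (multiple j c ℤ./ℕ D) (+ residue i c) (multiple i c ℤ./ℕ D) (+ D) ⟩
        + D ℤ.* (multiple j c ℤ./ℕ D ℤ.- multiple i c ℤ./ℕ D) ℤ.+ (+ residue j c ℤ.- + residue i c)
          ≡⟨ cong₂ (λ a b → + D ℤ.* a ℤ.+ b) (Vecₚ.lookup∘tabulate _ c) (Vecₚ.lookup∘tabulate _ c) ⟨
        + D ℤ.* Vec.lookup v c ℤ.+ Vec.lookup r c           ≡⟨ cong (λ a → a ℤ.+ Vec.lookup r c) (Vecₚ.lookup-map c (ℤ._*_ (+ D)) v) ⟨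
        Vec.lookup (+ D ⊛ v) c ℤ.+ Vec.lookup r c           ≡⟨ Vecₚ.lookup-zipWith ℤ._+_ c (+ D ⊛ v) r ⟨
        Vec.lookup (+ D ⊛ v ⊕ r) c                          ∎
    where
    open ≡-Reasoning
    D = K ℕ.* M
    t = j ℕ.∸ i
    v = Vec.tabulate λ c → multiple j c ℤ./ℕ D ℤ.- multiple i c ℤ./ℕ D
    r = Vec.tabulate λ c → + residue j c ℤ.- + residue i c
    t≡ : + t ≡ + j ℤ.- + i
    t≡ = trans (sym (ℤₚ.⊖-≥ (ℕₚ.<⇒≤ i<j))) (sym (ℤₚ.m-n≡m⊖n j i))
    distrib : ∀ a b x → (a ℤ.- b) ℤ.* x ≡ a ℤ.* x ℤ.- b ℤ.* x
    distrib = solve-∀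
    collect : ∀ a q b p e → (a ℤ.+ q ℤ.* e) ℤ.- (b ℤ.+ p ℤ.* e) ≡ e ℤ.* (q ℤ.- p) ℤ.+ (a ℤ.- b)
    collect = solve-∀

-- The one-norm and the bound on observers of a set with a margin

signum : ℤ → ℤ
signum (+ zero)    = 0ℤ
signum (+ suc n)   = 1ℤ
signum ℤ.-[1+ n ]  = -1ℤ

-1≤signum : ∀ i → -1ℤ ℤ.≤ signum i
-1≤signum (+ zero)   = ℤ.-≤+
-1≤signum (+ suc n)  = ℤ.-≤+
-1≤signum ℤ.-[1+ n ] = ℤₚ.≤-refl

signum≤1 : ∀ i → signum i ℤ.≤ 1ℤ
signum≤1 (+ zero)   = ℤ.+≤+ ℕ.z≤n
signum≤1 (+ suc n)  = ℤₚ.≤-refl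
signum≤1 ℤ.-[1+ n ] = ℤ.-≤+

i*signum : ∀ i → i ℤ.* signum i ≡ + ℤ.∣ i ∣
i*signum (+ zero)   = refl
i*signum (+ suc n)  = ℤₚ.*-identityʳ (+ suc n)
i*signum ℤ.-[1+ n ] = trans (ℤₚ.*-comm ℤ.-[1+ n ] -1ℤ) (ℤₚ.-1*i≡-i ℤ.-[1+ n ])

∥_∥₁ : ℤ^ n → ℕ
∥ [] ∥₁    = 0
∥ a ∷ v ∥₁ = ℤ.∣ a ∣ ℕ.+ ∥ v ∥₁

∙-signs : (v : ℤ^ n) → v ∙ Vec.map signum v ≡ + ∥ v ∥₁
∙-signs []      = refl
∙-signs (a ∷ v) = trans (cong₂ ℤ._+_ (i*signum a) (∙-signs v)) (sym (ℤₚ.pos-+ ℤ.∣ a ∣ ∥ v ∥₁))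

∙-bound : ∀ {B} (v r : ℤ^ n) → (∀ c → ℤ.∣ Vec.lookup r c ∣ ℕ.≤ B) → v ∙ r ℤ.≤ + (B ℕ.* ∥ v ∥₁)
∙-bound {B = B} []      []      _ = ℤₚ.≤-reflexive (cong +_ (sym (ℕₚ.*-zeroʳ B)))
∙-bound {B = B} (a ∷ v) (b ∷ r) bd = ℤₚ.≤-trans
  (ℤₚ.+-mono-≤ (ℤₚ.≤-trans (i≤∣i∣ (a ℤ.* b)) (ℤ.+≤+ (ℕₚ.≤-trans
    (ℕₚ.≤-reflexive (trans (ℤₚ.abs-* a b) (ℕₚ.*-comm ℤ.∣ a ∣ ℤ.∣ b ∣))) (ℕₚ.*-monoˡ-≤ ℤ.∣ a ∣ (bd zero)))))
    (∙-bound v r (bd ∘ suc)))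
  (ℤₚ.≤-reflexive (trans (sym (ℤₚ.pos-+ (B ℕ.* ℤ.∣ a ∣) (B ℕ.* ∥ v ∥₁))) (cong +_ (sym (ℕₚ.*-distribˡ-+ B ℤ.∣ a ∣ ∥ v ∥₁)))))

∥∥₁-zero : (v : ℤ^ n) → ∥ v ∥₁ ≡ 0 → v ≡ 𝟘
∥∥₁-zero []      _  = refl
∥∥₁-zero (a ∷ v) eq = cong₂ _∷_ (ℤₚ.∣i∣≡0⇒i≡0 (ℕₚ.m+n≡0⇒m≡0 ℤ.∣ a ∣ eq)) (∥∥₁-zero v (ℕₚ.m+n≡0⇒n≡0 ℤ.∣ a ∣ eq))

-- The integer form of "p lies in the interior of conv X".
Margin : List (ℤ^ d) → ℤ^ d → ℕ → Set
Margin {d} X p m = ∀ (h : ℤ^ (suc d)) → (∀ {x} → x ∈ X → 0ℤ ℤ.≤ h ∙ hat x) →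
  + ∥ Vec.tail h ∥₁ ℤ.≤ + suc m ℤ.* (h ∙ hat p)

module _ {X : List (ℤ^ d)} {p m} (margin : Margin X p m) where

  -- If h vanishes on X, the margin applies to h and to -h. The two right-hand sides cancel, so the
  -- linear part of h is 0, and the constant part is its value at x₀.
  margin⇒spanning : ∀ {x₀} → x₀ ∈ X → Spanning X
  margin⇒spanning {x₀} x₀∈X h@(h₀ ∷ h′) vanish y = begin
    h₀ ℤ.* 1ℤ ℤ.+ h′ ∙ y      ≡⟨ cong (λ t → h₀ ℤ.* 1ℤ ℤ.+ t) (trans (cong (_∙ y) h′≡𝟘) (∙-𝟘ˡ y)) ⟩
    h₀ ℤ.* 1ℤ ℤ.+ 0ℤ          ≡⟨ cong (λ t → h₀ ℤ.* 1ℤ ℤ.+ t) (trans (cong (_∙ x₀) h′≡𝟘) (∙-𝟘ˡ x₀)) ⟨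
    h₀ ℤ.* 1ℤ ℤ.+ h′ ∙ x₀     ≡⟨ vanish x₀∈X ⟩
    0ℤ                        ∎
    where
    open ≡-Reasoning
    opposite : ∀ k a → k ℤ.* a ℤ.+ k ℤ.* (ℤ.- a) ≡ 0ℤ
    opposite = solve-∀
    norms≤0 : + ∥ h′ ∥₁ ℤ.+ + ∥ ⊝ h′ ∥₁ ℤ.≤ 0ℤ
    norms≤0 = subst (+ ∥ h′ ∥₁ ℤ.+ + ∥ ⊝ h′ ∥₁ ℤ.≤_)
      (trans (cong (λ t → + suc m ℤ.* (h ∙ hat p) ℤ.+ + suc m ℤ.* t) (∙-⊝ˡ h (hat p))) (opposite (+ suc m) (h ∙ hat p)))
      (ℤₚ.+-mono-≤ (margin h (λ q → ℤₚ.≤-reflexive (sym (vanish q))))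
                   (margin (⊝ h) (λ {x} q → ℤₚ.≤-reflexive (sym (trans (∙-⊝ˡ h (hat x)) (cong ℤ.-_ (vanish q)))))))
    h′≡𝟘 : h′ ≡ 𝟘
    h′≡𝟘 = ∥∥₁-zero h′ (ℕₚ.n≤0⇒n≡0 (ℕₚ.m+n≤o⇒m≤o ∥ h′ ∥₁ (ℤₚ.drop‿+≤+ norms≤0)))

  private
    -- The factor `suc m` makes the rounding error small against the margin at p; the factor 2
    -- leaves room for t ≤ M, so that s = D - t is still at least M · `suc m`.
    K = 2 ℕ.* suc m
    M = K ℕ.^ d
    D = K ℕ.* M
    C = maxNorm X ℕ.+ ∥ p ∥

  -- From t (z - p) = D v + r with t ≥ 1, |v| ≤ C and |r| ≤ M follows |z - p| ≤ D C + M. The summand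
  -- `maxNorm X` makes the box contain X.
  observerBound : ℕ
  observerBound = maxNorm X ℕ.+ (D ℕ.* C ℕ.+ M ℕ.+ ∥ p ∥)

  module _ (z : ℤ^ d) where

    private
      w = z ⊕ ⊝ p
      open Dirichlet w K using (dirichlet)
      t = proj₁ dirichlet
      v = proj₁ (proj₂ dirichlet)
      r = proj₁ (proj₂ (proj₂ dirichlet))
      1≤t : 1 ℕ.≤ t
      1≤t = proj₁ (proj₂ (proj₂ (proj₂ dirichlet)))
      t≤M : t ℕ.≤ M
      t≤M = proj₁ (proj₂ (proj₂ (proj₂ (proj₂ dirichlet))))
      r≤M : ∀ c → ℤ.∣ Vec.lookup r c ∣ ℕ.≤ M
      r≤M = proj₁ (proj₂ (proj₂ (proj₂ (proj₂ (proj₂ dirichlet)))))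
      tw≡ : + t ⊛ w ≡ + D ⊛ v ⊕ r
      tw≡ = proj₂ (proj₂ (proj₂ (proj₂ (proj₂ (proj₂ dirichlet)))))
      s = D ℕ.∸ t
      D≥t+M*[1+m] : t ℕ.+ M ℕ.* suc m ℕ.≤ D
      D≥t+M*[1+m] = begin
        t ℕ.+ M ℕ.* suc m               ≤⟨ ℕₚ.+-monoˡ-≤ (M ℕ.* suc m) (ℕₚ.≤-trans t≤M (ℕₚ.m≤m*n M (suc m))) ⟩
        M ℕ.* suc m ℕ.+ M ℕ.* suc m     ≡⟨ cong₂ ℕ._+_ (ℕₚ.*-comm M (suc m)) (ℕₚ.*-comm M (suc m)) ⟩
        suc m ℕ.* M ℕ.+ suc m ℕ.* M     ≡⟨ cong (λ x → suc m ℕ.* M ℕ.+ x) (ℕₚ.+-identityʳ (suc m ℕ.* M)) ⟨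
        2 ℕ.* (suc m ℕ.* M)             ≡⟨ ℕₚ.*-assoc 2 (suc m) M ⟨
        D                               ∎
        where open ℕₚ.≤-Reasoning
      M*[1+m]≤s : M ℕ.* suc m ℕ.≤ s
      M*[1+m]≤s = ℕₚ.≤-trans (ℕₚ.≤-reflexive (sym (ℕₚ.m+n∸m≡n t (M ℕ.* suc m)))) (ℕₚ.∸-monoˡ-≤ t D≥t+M*[1+m])
      D≡t+s : + D ≡ + t ℤ.+ + s
      D≡t+s = trans (cong +_ (sym (ℕₚ.m+[n∸m]≡n (ℕₚ.≤-trans (ℕₚ.m≤m+n t _) D≥t+M*[1+m])))) (ℤₚ.pos-+ t s)

    approach : ℤ^ d
    approach = p ⊕ v

    private
      entrywise : ∀ c → + t ℤ.* (Vec.lookup z c ℤ.- Vec.lookup p c) ≡ + D ℤ.* Vec.lookup v c ℤ.+ Vec.lookup r c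
      entrywise c = begin
        + t ℤ.* (Vec.lookup z c ℤ.- Vec.lookup p c)    ≡⟨ cong (λ x → + t ℤ.* (Vec.lookup z c ℤ.+ x)) (Vecₚ.lookup-map c ℤ.-_ p) ⟨
        + t ℤ.* (Vec.lookup z c ℤ.+ Vec.lookup (⊝ p) c) ≡⟨ cong (ℤ._*_ (+ t)) (Vecₚ.lookup-zipWith ℤ._+_ c z (⊝ p)) ⟨
        + t ℤ.* Vec.lookup w c                         ≡⟨ Vecₚ.lookup-map c (ℤ._*_ (+ t)) w ⟨
        Vec.lookup (+ t ⊛ w) c                         ≡⟨ cong (λ u → Vec.lookup u c) tw≡ ⟩
        Vec.lookup (+ D ⊛ v ⊕ r) c                     ≡⟨ Vecₚ.lookup-zipWith ℤ._+_ c (+ D ⊛ v) r ⟩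
        Vec.lookup (+ D ⊛ v) c ℤ.+ Vec.lookup r c      ≡⟨ cong (λ x → x ℤ.+ Vec.lookup r c) (Vecₚ.lookup-map c (ℤ._*_ (+ D)) v) ⟩
        + D ℤ.* Vec.lookup v c ℤ.+ Vec.lookup r c      ∎
        where open ≡-Reasoning

      -- D (p + v) = t z + s p − r
      weighted-value : ∀ h → + D ℤ.* (h ∙ hat approach) ≡
        + t ℤ.* (h ∙ hat z) ℤ.+ + s ℤ.* (h ∙ hat p) ℤ.- Vec.tail h ∙ r
      weighted-value (h₀ ∷ h) = begin
        + D ℤ.* (h₀ ℤ.* 1ℤ ℤ.+ h ∙ (p ⊕ v))
          ≡⟨ cong (λ x → + D ℤ.* (h₀ ℤ.* 1ℤ ℤ.+ x)) (∙-⊕ʳ h p v) ⟩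
        + D ℤ.* (h₀ ℤ.* 1ℤ ℤ.+ (h ∙ p ℤ.+ h ∙ v))
          ≡⟨ rearrange (+ D) h₀ (h ∙ p) (h ∙ v) (h ∙ r) ⟩
        + D ℤ.* (h₀ ℤ.* 1ℤ ℤ.+ h ∙ p) ℤ.+ (+ D ℤ.* (h ∙ v) ℤ.+ h ∙ r) ℤ.- h ∙ r
          ≡⟨ cong₂ (λ x y → x ℤ.* (h₀ ℤ.* 1ℤ ℤ.+ h ∙ p) ℤ.+ y ℤ.- h ∙ r) D≡t+s h∙tw ⟩
        (+ t ℤ.+ + s) ℤ.* (h₀ ℤ.* 1ℤ ℤ.+ h ∙ p) ℤ.+ + t ℤ.* (h ∙ z ℤ.+ ℤ.- (h ∙ p)) ℤ.- h ∙ r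
          ≡⟨ collect (+ t) (+ s) h₀ (h ∙ p) (h ∙ z) (h ∙ r) ⟩
        + t ℤ.* (h₀ ℤ.* 1ℤ ℤ.+ h ∙ z) ℤ.+ + s ℤ.* (h₀ ℤ.* 1ℤ ℤ.+ h ∙ p) ℤ.- h ∙ r ∎
        where
        open ≡-Reasoning
        rearrange : ∀ D h p v r → D ℤ.* (h ℤ.* 1ℤ ℤ.+ (p ℤ.+ v)) ≡ D ℤ.* (h ℤ.* 1ℤ ℤ.+ p) ℤ.+ (D ℤ.* v ℤ.+ r) ℤ.- r
        rearrange = solve-∀
        collect : ∀ t s h p z r → (t ℤ.+ s) ℤ.* (h ℤ.* 1ℤ ℤ.+ p) ℤ.+ t ℤ.* (z ℤ.+ ℤ.- p) ℤ.- r ≡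
          t ℤ.* (h ℤ.* 1ℤ ℤ.+ z) ℤ.+ s ℤ.* (h ℤ.* 1ℤ ℤ.+ p) ℤ.- r
        collect = solve-∀
        h∙tw : + D ℤ.* (h ∙ v) ℤ.+ h ∙ r ≡ + t ℤ.* (h ∙ z ℤ.+ ℤ.- (h ∙ p))
        h∙tw = begin
          + D ℤ.* (h ∙ v) ℤ.+ h ∙ r              ≡⟨ cong (λ x → x ℤ.+ h ∙ r) (∙-⊛ʳ (+ D) h v) ⟨
          h ∙ (+ D ⊛ v) ℤ.+ h ∙ r                ≡⟨ ∙-⊕ʳ h (+ D ⊛ v) r ⟨
          h ∙ (+ D ⊛ v ⊕ r)                      ≡⟨ cong (h ∙_) tw≡ ⟨
          h ∙ (+ t ⊛ w)                          ≡⟨ ∙-⊛ʳ (+ t) h w ⟩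
          + t ℤ.* (h ∙ w)                        ≡⟨ cong (ℤ._*_ (+ t)) (trans (∙-⊕ʳ h z (⊝ p)) (cong (ℤ._+_ (h ∙ z)) (∙-⊝ʳ h p))) ⟩
          + t ℤ.* (h ∙ z ℤ.+ ℤ.- (h ∙ p))        ∎

    -- In D h(p + v) = t h(z) + s h(p) - h ∙ r, the error h ∙ r is at most M ∥h∥₁, by the margin at
    -- most M · `suc m` · h(p), and hence at most s h(p).
    approach-nonneg : ∀ h → (∀ {x} → x ∈ z ∷ X → 0ℤ ℤ.≤ h ∙ hat x) → 0ℤ ℤ.≤ h ∙ hat approach
    approach-nonneg h nn = scale-back (subst (0ℤ ℤ.≤_) (sym (weighted-value h)) (ℤₚ.≤-trans
      (0≤i+j (0≤i*j {+ t} (ℤ.+≤+ ℕ.z≤n) (nn (here refl))) (ℤₚ.i≤j⇒0≤j-i hr≤))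
      (ℤₚ.≤-reflexive (sym (ℤₚ.+-assoc (+ t ℤ.* (h ∙ hat z)) (+ s ℤ.* (h ∙ hat p)) (ℤ.- (Vec.tail h ∙ r)))))))
      where
      scale-back : 0ℤ ℤ.≤ + D ℤ.* (h ∙ hat approach) → 0ℤ ℤ.≤ h ∙ hat approach
      scale-back q = ℤₚ.*-cancelˡ-≤-pos 0ℤ (h ∙ hat approach) (+ D) {{D>0}} (subst (ℤ._≤ + D ℤ.* (h ∙ hat approach)) (sym (ℤₚ.*-zeroʳ (+ D))) q)
        where
        D>0 : ℤ.Positive (+ D)
        D>0 = ℤ.positive (ℤ.+<+ (ℕₚ.≤-trans 1≤t (ℕₚ.≤-trans (ℕₚ.m≤m+n t _) D≥t+M*[1+m])))
      L = ∥ Vec.tail h ∥₁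
      marginal : + L ℤ.≤ + suc m ℤ.* (h ∙ hat p)
      marginal = margin h (nn ∘ there)
      0≤hp : 0ℤ ℤ.≤ h ∙ hat p
      0≤hp = ℤₚ.*-cancelˡ-≤-pos 0ℤ (h ∙ hat p) (+ suc m)
        (ℤₚ.≤-trans (ℤₚ.≤-reflexive (ℤₚ.*-zeroʳ (+ suc m))) (ℤₚ.≤-trans (ℤ.+≤+ ℕ.z≤n) marginal))
      open ℤₚ.≤-Reasoning
      hr≤ : Vec.tail h ∙ r ℤ.≤ + s ℤ.* (h ∙ hat p)
      hr≤ = begin
        Vec.tail h ∙ r                            ≤⟨ ∙-bound (Vec.tail h) r r≤M ⟩
        + (M ℕ.* L)                               ≡⟨ ℤₚ.pos-* M L ⟩
        + M ℤ.* + L                               ≤⟨ ℤₚ.*-monoˡ-≤-nonNeg (+ M) marginal ⟩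
        + M ℤ.* (+ suc m ℤ.* (h ∙ hat p))         ≡⟨ ℤₚ.*-assoc (+ M) (+ suc m) (h ∙ hat p) ⟨
        + M ℤ.* + suc m ℤ.* (h ∙ hat p)           ≡⟨ cong (ℤ._* (h ∙ hat p)) (ℤₚ.pos-* M (suc m)) ⟨
        + (M ℕ.* suc m) ℤ.* (h ∙ hat p)           ≤⟨ ℤₚ.*-monoʳ-≤-nonNeg (h ∙ hat p) {{ℤ.nonNegative 0≤hp}} (ℤ.+≤+ M*[1+m]≤s) ⟩
        + s ℤ.* (h ∙ hat p)                       ∎

    approach∈hull : InHull (z ∷ X) approach
    approach∈hull with hull-or-separated (z ∷ X) approach
    ... | inj₁ hull           = hull
    ... | inj₂ (h , nn , neg) = contradiction (approach-nonneg h nn) (ℤₚ.<⇒≱ neg)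

    private
      approach-entry : ∀ c → Vec.lookup approach c ≡ Vec.lookup p c ℤ.+ Vec.lookup v c
      approach-entry c = Vecₚ.lookup-zipWith ℤ._+_ c p v
      near : ∀ c → ℤ.∣ Vec.lookup z c ℤ.- Vec.lookup p c ∣ ℕ.≤ D ℕ.* C ℕ.+ M → ℤ.∣ Vec.lookup z c ∣ ℕ.≤ observerBound
      near c q = begin
        ℤ.∣ Vec.lookup z c ∣                                       ≡⟨ cong ℤ.∣_∣ (restore (Vec.lookup z c) (Vec.lookup p c)) ⟩
        ℤ.∣ (Vec.lookup z c ℤ.- Vec.lookup p c) ℤ.+ Vec.lookup p c ∣ ≤⟨ ℤₚ.∣i+j∣≤∣i∣+∣j∣ (Vec.lookup z c ℤ.- Vec.lookup p c) (Vec.lookup p c) ⟩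
        ℤ.∣ Vec.lookup z c ℤ.- Vec.lookup p c ∣ ℕ.+ ℤ.∣ Vec.lookup p c ∣ ≤⟨ ℕₚ.+-mono-≤ q (entry≤norm p c) ⟩
        D ℕ.* C ℕ.+ M ℕ.+ ∥ p ∥                                    ≤⟨ ℕₚ.m≤n+m _ (maxNorm X) ⟩
        observerBound                                              ∎
        where
        open ℕₚ.≤-Reasoning
        restore : ∀ a b → a ≡ (a ℤ.- b) ℤ.+ b
        restore = solve-∀

    approach∈X⇒near : approach ∈ X → ∥ z ∥ ℕ.≤ observerBound
    approach∈X⇒near q = norm≤ z λ c → near c (begin
      ℤ.∣ Vec.lookup z c ℤ.- Vec.lookup p c ∣                       ≤⟨ ℕₚ.m≤n*m _ t {{ℕ.>-nonZero 1≤t}} ⟩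
      t ℕ.* ℤ.∣ Vec.lookup z c ℤ.- Vec.lookup p c ∣                 ≡⟨ ℤₚ.abs-* (+ t) (Vec.lookup z c ℤ.- Vec.lookup p c) ⟨
      ℤ.∣ + t ℤ.* (Vec.lookup z c ℤ.- Vec.lookup p c) ∣             ≡⟨ cong ℤ.∣_∣ (entrywise c) ⟩
      ℤ.∣ + D ℤ.* Vec.lookup v c ℤ.+ Vec.lookup r c ∣               ≤⟨ ℤₚ.∣i+j∣≤∣i∣+∣j∣ (+ D ℤ.* Vec.lookup v c) (Vec.lookup r c) ⟩
      ℤ.∣ + D ℤ.* Vec.lookup v c ∣ ℕ.+ ℤ.∣ Vec.lookup r c ∣         ≡⟨ cong (ℕ._+ ℤ.∣ Vec.lookup r c ∣) (ℤₚ.abs-* (+ D) (Vec.lookup v c)) ⟩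
      D ℕ.* ℤ.∣ Vec.lookup v c ∣ ℕ.+ ℤ.∣ Vec.lookup r c ∣           ≤⟨ ℕₚ.+-mono-≤ (ℕₚ.*-monoʳ-≤ D (v≤C c)) (r≤M c) ⟩
      D ℕ.* C ℕ.+ M                                                 ∎)
      where
      open ℕₚ.≤-Reasoning
      difference : ∀ a b → b ≡ (a ℤ.+ b) ℤ.- a
      difference = solve-∀
      v≤C : ∀ c → ℤ.∣ Vec.lookup v c ∣ ℕ.≤ C
      v≤C c = begin
        ℤ.∣ Vec.lookup v c ∣                                        ≡⟨ cong ℤ.∣_∣ (trans (difference (Vec.lookup p c) (Vec.lookup v c)) (cong (ℤ._- Vec.lookup p c) (sym (approach-entry c)))) ⟩
        ℤ.∣ Vec.lookup approach c ℤ.- Vec.lookup p c ∣              ≤⟨ ℤₚ.∣i-j∣≤∣i∣+∣j∣ (Vec.lookup approach c) (Vec.lookup p c) ⟩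
        ℤ.∣ Vec.lookup approach c ∣ ℕ.+ ℤ.∣ Vec.lookup p c ∣        ≤⟨ ℕₚ.+-mono-≤ (ℕₚ.≤-trans (entry≤norm approach c) (norm≤maxNorm q)) (entry≤norm p c) ⟩
        C                                                           ∎

    -- Now v = z - p, so t (z - p) = D v + r becomes s (z - p) = -r, where s ≥ 1.
    approach≡z⇒near : approach ≡ z → ∥ z ∥ ℕ.≤ observerBound
    approach≡z⇒near eq = norm≤ z λ c → near c (begin
      ℤ.∣ Vec.lookup z c ℤ.- Vec.lookup p c ∣                       ≤⟨ ℕₚ.m≤n*m _ s {{ℕ.>-nonZero 1≤s}} ⟩
      s ℕ.* ℤ.∣ Vec.lookup z c ℤ.- Vec.lookup p c ∣                 ≡⟨ ℤₚ.abs-* (+ s) (Vec.lookup z c ℤ.- Vec.lookup p c) ⟨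
      ℤ.∣ + s ℤ.* (Vec.lookup z c ℤ.- Vec.lookup p c) ∣             ≡⟨ cong ℤ.∣_∣ (remainder c) ⟩
      ℤ.∣ ℤ.- Vec.lookup r c ∣                                      ≡⟨ ℤₚ.∣-i∣≡∣i∣ (Vec.lookup r c) ⟩
      ℤ.∣ Vec.lookup r c ∣                                          ≤⟨ r≤M c ⟩
      M                                                             ≤⟨ ℕₚ.m≤n+m M (D ℕ.* C) ⟩
      D ℕ.* C ℕ.+ M                                                 ∎)
      where
      open ℕₚ.≤-Reasoning
      1≤s : 1 ℕ.≤ s
      1≤s = ℕₚ.≤-trans (ℕₚ.≤-trans 1≤t t≤M) (ℕₚ.≤-trans (ℕₚ.m≤m*n M (suc m)) M*[1+m]≤s)
      algebra : ∀ t s p v r → t ℤ.* ((p ℤ.+ v) ℤ.- p) ≡ (t ℤ.+ s) ℤ.* v ℤ.+ r → s ℤ.* ((p ℤ.+ v) ℤ.- p) ≡ ℤ.- r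
      algebra t s p v r e = trans (lemma t s p v r) (trans (cong (λ x → (t ℤ.+ s) ℤ.* v ℤ.- x) e) (lemma′ ((t ℤ.+ s) ℤ.* v) r))
        where
        lemma : ∀ t s p v r → s ℤ.* ((p ℤ.+ v) ℤ.- p) ≡ (t ℤ.+ s) ℤ.* v ℤ.- t ℤ.* ((p ℤ.+ v) ℤ.- p)
        lemma = solve-∀
        lemma′ : ∀ a r → a ℤ.- (a ℤ.+ r) ≡ ℤ.- r
        lemma′ = solve-∀
      zc : ∀ c → Vec.lookup z c ≡ Vec.lookup p c ℤ.+ Vec.lookup v c
      zc c = trans (cong (λ u → Vec.lookup u c) (sym eq)) (approach-entry c)
      remainder : ∀ c → + s ℤ.* (Vec.lookup z c ℤ.- Vec.lookup p c) ≡ ℤ.- Vec.lookup r c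
      remainder c = trans (cong (λ x → + s ℤ.* (x ℤ.- Vec.lookup p c)) (zc c))
        (algebra (+ t) (+ s) (Vec.lookup p c) (Vec.lookup v c) (Vec.lookup r c)
          (trans (cong (λ x → + t ℤ.* (x ℤ.- Vec.lookup p c)) (sym (zc c)))
            (trans (entrywise c) (cong (λ x → x ℤ.* Vec.lookup v c ℤ.+ Vec.lookup r c) D≡t+s))))

  margin⇒observersWithin : ObserversWithin X observerBound
  margin⇒observersWithin z _ R<z only = ℕₚ.<⇒≱ R<z
    (Sum.[ approach∈X⇒near z , approach≡z⇒near z ] (only (approach z) (approach∈hull z)))

-- From interior points to margins

toℚ-denominator : ∀ δ → toℚ (ℚ.↧ δ) ℚ.* δ ≡ toℚ (ℚ.↥ δ)
toℚ-denominator δ@(ℚ.mkℚ num den-1 _) = ℚₚ.toℚᵘ-injective (begin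
  ℚ.toℚᵘ (toℚ (ℚ.↧ δ) ℚ.* δ)               ≈⟨ ℚₚ.toℚᵘ-homo-* (toℚ (ℚ.↧ δ)) δ ⟩
  ℚ.toℚᵘ (toℚ (ℚ.↧ δ)) ℚᵘ.* ℚ.toℚᵘ δ       ≈⟨ ℚᵘₚ.*-congʳ {ℚ.toℚᵘ δ} (toℚᵘ-toℚ (ℚ.↧ δ)) ⟩
  ℚᵘ.mkℚᵘ (ℚ.↧ δ) 0 ℚᵘ.* ℚ.toℚᵘ δ          ≈⟨ ℚᵘ.*≡* lemma ⟩
  ℚᵘ.mkℚᵘ (ℚ.↥ δ) 0                        ≈⟨ toℚᵘ-toℚ (ℚ.↥ δ) ⟨
  ℚ.toℚᵘ (toℚ (ℚ.↥ δ))                     ∎)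
  where
  open ℚᵘₚ.≃-Reasoning
  lemma : + suc den-1 ℤ.* num ℤ.* 1ℤ ≡ num ℤ.* + (1 ℕ.* suc den-1)
  lemma = trans (ℤₚ.*-identityʳ _) (trans (ℤₚ.*-comm (+ suc den-1) num) (cong (λ k → num ℤ.* + k) (sym (ℕₚ.*-identityˡ (suc den-1)))))

-- Later r is both the step away from p and the rational gap that the strict order of the box
-- demands, hence r + r ≤ δ.
archimedean : ∀ {δ} → 0ℚ ℚ.< δ → ∃[ m ] ∃[ r ] (0ℚ ℚ.< r × r ℚ.+ r ℚ.≤ δ × (∀ x → r ℚ.* (toℚ (+ suc m) ℚ.* x) ≡ x))
archimedean {δ@(ℚ.mkℚ num den-1 _)} 0<δ = m , r , 0<r , r+r≤δ , cancel
  where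
  -- `suc m` is twice the denominator of δ, so r + r is the reciprocal of that denominator; it is at
  -- most δ because the numerator is at least 1.
  m = den-1 ℕ.+ suc (den-1 ℕ.+ 0)
  r = proj₁ (reciprocal m)
  0≤r = proj₁ (proj₂ (reciprocal m))
  cancel = proj₂ (proj₂ (reciprocal m))
  c = toℚ (+ suc m)
  0<c : 0ℚ ℚ.< c
  0<c = subst (ℚ._< c) toℚ-0 (toℚ-mono-< {0ℤ} (ℤ.+<+ (ℕ.s≤s ℕ.z≤n)))
  cr≡1 : c ℚ.* r ≡ 1ℚ
  cr≡1 = trans (ℚₚ.*-comm c r) (trans (cong (r ℚ.*_) (sym (ℚₚ.*-identityʳ c))) (cancel 1ℚ))
  r≢0 : r ≢ 0ℚ
  r≢0 eq = ℚₚ.1≢0 (trans (sym cr≡1) (trans (cong (c ℚ.*_) eq) (ℚₚ.*-zeroʳ c)))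
  0<r : 0ℚ ℚ.< r
  0<r = ℚₚ.≰⇒> λ r≤0 → r≢0 (ℚₚ.≤-antisym r≤0 0≤r)
  1≤num : 1ℤ ℤ.≤ num
  1≤num = ℤₚ.i<j⇒suc[i]≤j (ℤₚ.positive⁻¹ num {{ℚ.positive 0<δ}})
  c≡ : c ≡ toℚ (+ 2) ℚ.* toℚ (+ suc den-1)
  c≡ = trans (cong toℚ (ℤₚ.pos-* 2 (suc den-1))) (toℚ-* (+ 2) (+ suc den-1))
  open ℚₚ.≤-Reasoning
  two : toℚ (+ 2) ≡ 1ℚ ℚ.+ 1ℚ
  two = trans (toℚ-+ 1ℤ 1ℤ) (cong₂ ℚ._+_ toℚ-1 toℚ-1)
  r+r≤δ : r ℚ.+ r ℚ.≤ δ
  r+r≤δ = ℚₚ.*-cancelˡ-≤-pos c {{ℚ.positive 0<c}} (begin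
    c ℚ.* (r ℚ.+ r)                            ≡⟨ ℚₚ.*-distribˡ-+ c r r ⟩
    c ℚ.* r ℚ.+ c ℚ.* r                        ≡⟨ cong₂ ℚ._+_ cr≡1 cr≡1 ⟩
    1ℚ ℚ.+ 1ℚ                                  ≡⟨ trans (sym two) (sym (ℚₚ.*-identityʳ (toℚ (+ 2)))) ⟩
    toℚ (+ 2) ℚ.* 1ℚ                           ≡⟨ cong (toℚ (+ 2) ℚ.*_) toℚ-1 ⟨
    toℚ (+ 2) ℚ.* toℚ 1ℤ                       ≤⟨ ℚₚ.*-monoˡ-≤-nonNeg (toℚ (+ 2)) {{ℚ.nonNegative (toℚ-nonneg {+ 2} (ℤ.+≤+ ℕ.z≤n))}} (toℚ-mono-≤ 1≤num) ⟩
    toℚ (+ 2) ℚ.* toℚ num                      ≡⟨ cong (toℚ (+ 2) ℚ.*_) (toℚ-denominator δ) ⟨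
    toℚ (+ 2) ℚ.* (toℚ (+ suc den-1) ℚ.* δ)    ≡⟨ ℚₚ.*-assoc (toℚ (+ 2)) (toℚ (+ suc den-1)) δ ⟨
    toℚ (+ 2) ℚ.* toℚ (+ suc den-1) ℚ.* δ      ≡⟨ cong (ℚ._* δ) c≡ ⟨
    c ℚ.* δ                                    ∎)

-- From p to p − r · signs h, which still lies in conv X, the functional h decreases by r ∥h∥₁.
module _ {X : List (ℤ^ d)} {p : ℤ^ d} {δ r : ℚ} {m : ℕ} (ε : ℝ) (N : ℕ) (δ≤ε : ∀ n → N ℕ.≤ n → 0ℚ ℚ.+ δ ℚ.≤ seq ε n)
  (inside : ∀ q → (∀ i → ι p i - ε < q i × q i < ι p i + ε) → conv X q)
  (0<r : 0ℚ ℚ.< r) (r+r≤δ : r ℚ.+ r ℚ.≤ δ) (cancel : ∀ x → r ℚ.* (toℚ (+ suc m) ℚ.* x) ≡ x) where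

  private
    module _ (h : ℤ^ (suc d)) (nn : ∀ {x} → x ∈ X → 0ℤ ℤ.≤ h ∙ hat x) where

      s = Vec.map signum (Vec.tail h)
      σ : Fin d → ℚ
      σ i = toℚ (Vec.lookup s i)
      q : Vector ℚ d
      q i = toℚ (Vec.lookup p i) ℚ.- r ℚ.* σ i

      rr≤ε : ∀ n → N ℕ.≤ n → r ℚ.+ r ℚ.≤ seq ε n
      rr≤ε n N≤n = ℚₚ.≤-trans r+r≤δ (ℚₚ.≤-trans (ℚₚ.≤-reflexive (sym (ℚₚ.+-identityˡ δ))) (δ≤ε n N≤n))

      rσ≤r : ∀ i → r ℚ.* σ i ℚ.≤ r
      rσ≤r i = ℚₚ.≤-trans
        (ℚₚ.*-monoˡ-≤-nonNeg r {{ℚ.nonNegative (ℚₚ.<⇒≤ 0<r)}} (ℚₚ.≤-trans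
          (toℚ-mono-≤ (subst (ℤ._≤ 1ℤ) (sym (Vecₚ.lookup-map i signum (Vec.tail h))) (signum≤1 _))) (ℚₚ.≤-reflexive toℚ-1)))
        (ℚₚ.≤-reflexive (ℚₚ.*-identityʳ r))

      -r≤rσ : ∀ i → ℚ.- r ℚ.≤ r ℚ.* σ i
      -r≤rσ i = ℚₚ.≤-trans
        (ℚₚ.≤-reflexive (trans (solve 1 (λ r → :- r := r :* (:- con 1ℚ)) refl r)
          (cong (r ℚ.*_) (sym (trans (toℚ-neg 1ℤ) (cong ℚ.-_ toℚ-1))))))
        (ℚₚ.*-monoˡ-≤-nonNeg r {{ℚ.nonNegative (ℚₚ.<⇒≤ 0<r)}}
          (toℚ-mono-≤ (subst (-1ℤ ℤ.≤_) (sym (Vecₚ.lookup-map i signum (Vec.tail h))) (-1≤signum _))))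

      open ℚₚ.≤-Reasoning

      lower : ∀ i → ι p i - ε < fromℚ (q i)
      lower i = r , 0<r , N , λ n N≤n → begin
        (Vec.lookup p i ℚ./ 1 ℚ.+ ℚ.- seq ε n) ℚ.+ r   ≡⟨ cong (λ a → (a ℚ.+ ℚ.- seq ε n) ℚ.+ r) (toℚ-def (Vec.lookup p i)) ⟩
        (toℚ (Vec.lookup p i) ℚ.- seq ε n) ℚ.+ r       ≤⟨ ℚₚ.+-monoˡ-≤ r (ℚₚ.+-monoʳ-≤ (toℚ (Vec.lookup p i)) (ℚₚ.neg-antimono-≤ (rr≤ε n N≤n))) ⟩
        (toℚ (Vec.lookup p i) ℚ.- (r ℚ.+ r)) ℚ.+ r     ≡⟨ solve 2 (λ a r → (a :- (r :+ r)) :+ r := a :- r) refl (toℚ (Vec.lookup p i)) r ⟩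
        toℚ (Vec.lookup p i) ℚ.- r                     ≤⟨ ℚₚ.+-monoʳ-≤ (toℚ (Vec.lookup p i)) (ℚₚ.neg-antimono-≤ (rσ≤r i)) ⟩
        q i                                            ∎

      upper : ∀ i → fromℚ (q i) < ι p i + ε
      upper i = r , 0<r , N , λ n N≤n → begin
        q i ℚ.+ r                                      ≤⟨ ℚₚ.+-monoˡ-≤ r (ℚₚ.+-monoʳ-≤ (toℚ (Vec.lookup p i)) (ℚₚ.neg-antimono-≤ (-r≤rσ i))) ⟩
        (toℚ (Vec.lookup p i) ℚ.- ℚ.- r) ℚ.+ r         ≡⟨ solve 2 (λ a r → (a :- (:- r)) :+ r := a :+ (r :+ r)) refl (toℚ (Vec.lookup p i)) r ⟩
        toℚ (Vec.lookup p i) ℚ.+ (r ℚ.+ r)             ≤⟨ ℚₚ.+-monoʳ-≤ (toℚ (Vec.lookup p i)) (rr≤ε n N≤n) ⟩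
        toℚ (Vec.lookup p i) ℚ.+ seq ε n               ≡⟨ cong (ℚ._+ seq ε n) (toℚ-def (Vec.lookup p i)) ⟨
        Vec.lookup p i ℚ./ 1 ℚ.+ seq ε n               ∎

      value-at-q : evaluate h (fromℚ ∘ q) 0 ≡ toℚ (h ∙ hat p) ℚ.- r ℚ.* toℚ (Vec.tail h ∙ s)
      value-at-q = begin-equality
        toℚ (Vec.head h) ℚ.+ sum (λ j → η j ℚ.* (π j ℚ.- r ℚ.* σ j))
          ≡⟨ cong (toℚ (Vec.head h) ℚ.+_) (trans
               (sum-cong-≗ λ j → solve 4 (λ h p r s → h :* (p :- r :* s) := h :* p :+ (:- r) :* (h :* s)) refl (η j) (π j) r (σ j))
               (∑-distrib-+ (λ j → η j ℚ.* π j) (λ j → (ℚ.- r) ℚ.* (η j ℚ.* σ j)))) ⟩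
        toℚ (Vec.head h) ℚ.+ (sum (λ j → η j ℚ.* π j) ℚ.+ sum (λ j → (ℚ.- r) ℚ.* (η j ℚ.* σ j)))
          ≡⟨ cong (λ t → toℚ (Vec.head h) ℚ.+ (sum (λ j → η j ℚ.* π j) ℚ.+ t))
               (trans (sym (*-distribˡ-sum (ℚ.- r) (λ j → η j ℚ.* σ j))) (cong ((ℚ.- r) ℚ.*_) (sym (toℚ-∙ (Vec.tail h) s)))) ⟩
        toℚ (Vec.head h) ℚ.+ (sum (λ j → η j ℚ.* π j) ℚ.+ (ℚ.- r) ℚ.* toℚ (Vec.tail h ∙ s))
          ≡⟨ solve 4 (λ a b r c → a :+ (b :+ (:- r) :* c) := (a :+ b) :- r :* c) refl (toℚ (Vec.head h)) (sum (λ j → η j ℚ.* π j)) r (toℚ (Vec.tail h ∙ s)) ⟩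
        (toℚ (Vec.head h) ℚ.+ sum (λ j → η j ℚ.* π j)) ℚ.- r ℚ.* toℚ (Vec.tail h ∙ s)
          ≡⟨ cong (λ t → t ℚ.- r ℚ.* toℚ (Vec.tail h ∙ s)) (evaluate-lattice h p) ⟨
        toℚ (h ∙ hat p) ℚ.- r ℚ.* toℚ (Vec.tail h ∙ s) ∎
        where
        η π : Fin d → ℚ
        η j = toℚ (Vec.lookup (Vec.tail h) j)
        π j = toℚ (Vec.lookup p j)

      nonneg-at-q : 0ℚ ℚ.≤ toℚ (h ∙ hat p) ℚ.- r ℚ.* toℚ (Vec.tail h ∙ s)
      nonneg-at-q = subst (0ℚ ℚ.≤_) value-at-q (0≲-const {evaluate h (fromℚ ∘ q) 0}
        (conv-nonneg {X = X} {fromℚ ∘ q} h (inside (fromℚ ∘ q) (λ i → lower i , upper i)) nn))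

      margin-at : + ∥ Vec.tail h ∥₁ ℤ.≤ + suc m ℤ.* (h ∙ hat p)
      margin-at = toℚ-cancel-≤ (ℚₚ.*-cancelˡ-≤-pos r {{ℚ.positive 0<r}} (begin
        r ℚ.* toℚ (+ ∥ Vec.tail h ∥₁)                   ≡⟨ cong (λ t → r ℚ.* toℚ t) (∙-signs (Vec.tail h)) ⟨
        r ℚ.* toℚ (Vec.tail h ∙ s)                      ≡⟨ ℚₚ.+-identityˡ _ ⟨
        0ℚ ℚ.+ r ℚ.* toℚ (Vec.tail h ∙ s)               ≤⟨ ℚₚ.+-monoˡ-≤ (r ℚ.* toℚ (Vec.tail h ∙ s)) nonneg-at-q ⟩
        (toℚ (h ∙ hat p) ℚ.- r ℚ.* toℚ (Vec.tail h ∙ s)) ℚ.+ r ℚ.* toℚ (Vec.tail h ∙ s)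
                                                        ≡⟨ solve 2 (λ a b → (a :- b) :+ b := a) refl (toℚ (h ∙ hat p)) (r ℚ.* toℚ (Vec.tail h ∙ s)) ⟩
        toℚ (h ∙ hat p)                                 ≡⟨ cancel (toℚ (h ∙ hat p)) ⟨
        r ℚ.* (toℚ (+ suc m) ℚ.* toℚ (h ∙ hat p))       ≡⟨ cong (r ℚ.*_) (toℚ-* (+ suc m) (h ∙ hat p)) ⟨
        r ℚ.* toℚ (+ suc m ℤ.* (h ∙ hat p))             ∎))

  box⇒margin : Margin X p m
  box⇒margin h nn = margin-at h nn

interior⇒margin : ∀ {X : List (ℤ^ d)} {p} → interior (conv X) (ι p) → ∃[ m ] Margin X p m
interior⇒margin {X = X} {p} (ε , (δ , 0<δ , N , δ≤ε) , inside) =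
  let m , r , 0<r , r+r≤δ , cancel = archimedean 0<δ
  in m , box⇒margin {X = X} {p} {δ} {r} {m} ε N δ≤ε inside 0<r r+r≤δ cancel

conv⇒nonempty : ∀ {X : List (ℤ^ d)} {p} → conv X p → ∃[ x ] x ∈ X
conv⇒nonempty {X = []} {p} (c , _ , Σ≈1 , _) = contradiction
  (toℚ-cancel-≤ {1ℤ} {0ℤ} (subst₂ ℚ._≤_ (sym toℚ-1) (sym toℚ-0) 1≤0)) λ { (ℤ.+≤+ ()) }
  where
  1≤0 : 1ℚ ℚ.≤ 0ℚ
  1≤0 = subst₂ ℚ._≤_ (ℚₚ.+-identityʳ 1ℚ) refl (ℚₚ.+-monoʳ-≤ 1ℚ (0≲-const {ℚ.- 1ℚ}
    (0≲-resp (λ m → refl) (Null.nonneg (≈⇒null {∑ c} {1ℝ} Σ≈1)))))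
conv⇒nonempty {X = x ∷ X} _ = x , here refl

interior⊆ : ∀ {S : ℝ^ d → Set} {p} → interior S p → S p
interior⊆ {p = p} (ε , (δ , 0<δ , N , δ≤ε) , inside) = inside p λ i →
  (δ , 0<δ , N , λ n N≤n → ℚₚ.≤-trans (ℚₚ.+-monoʳ-≤ (seq (p i) n ℚ.+ ℚ.- seq ε n) (δ≤ n N≤n))
    (ℚₚ.≤-reflexive (solve 2 (λ a e → (a :+ (:- e)) :+ e := a) refl (seq (p i) n) (seq ε n)))) ,
  (δ , 0<δ , N , λ n N≤n → ℚₚ.+-monoʳ-≤ (seq (p i) n) (δ≤ n N≤n))
  where
  δ≤ : ∀ n → N ℕ.≤ n → δ ℚ.≤ seq ε n
  δ≤ n N≤n = ℚₚ.≤-trans (ℚₚ.≤-reflexive (sym (ℚₚ.+-identityˡ δ))) (δ≤ε n N≤n)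

interior-solvable : ∀ {X : List (ℤ^ d)} → LatticeConvex X → HasInteriorLatticePoint X → Solvable X
interior-solvable {X = X} lc (p , int) =
  let m , margin = interior⇒margin {X = X} {p} int
      x₀ , x₀∈X = conv⇒nonempty {X = X} {ι p} (interior⊆ {S = conv X} {ι p} int)
  in solvable {X = X} {R = observerBound {X = X} {p} {m} margin} x₀∈X (latticeConvex⇒closed {X = X} lc)
       (margin⇒spanning {X = X} {p} {m} margin x₀∈X) (ℕₚ.m≤m+n (maxNorm X) _)
       (margin⇒observersWithin {X = X} {p} {m} margin)

-- Condition (c)

⊛-zero-cancel : ∀ {a} (w : ℤ^ n) → a ≢ 0ℤ → a ⊛ w ≡ 𝟘 → w ≡ 𝟘
⊛-zero-cancel []      _   _  = refl
⊛-zero-cancel {a = a} (b ∷ w) a≢0 eq = cong₂ _∷_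
  (Sum.[ (λ a≡0 → contradiction a≡0 a≢0) , id ] (ℤₚ.i*j≡0⇒i≡0∨j≡0 a (Vecₚ.∷-injectiveˡ eq)))
  (⊛-zero-cancel w a≢0 (Vecₚ.∷-injectiveʳ eq))

find-pivot : (vs : List (ℤ^ (suc n))) → (∀ {v} → v ∈ vs → Vec.head v ≡ 0ℤ) ⊎
  (∃[ v ] ∃[ us ] (Vec.head v ≢ 0ℤ × length vs ≡ suc (length us) × (∀ {u} → u ∈ vs → u ≡ v ⊎ u ∈ us)))
find-pivot []       = inj₁ λ ()
find-pivot (v ∷ vs) with Vec.head v ℤₚ.≟ 0ℤ | find-pivot vs
... | no ≢0  | _       = inj₂ (v , vs , ≢0 , refl , λ { (here eq) → inj₁ eq ; (there p) → inj₂ p })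
... | yes ≡0 | inj₁ zs = inj₁ λ { (here refl) → ≡0 ; (there p) → zs p }
... | yes ≡0 | inj₂ (u , us , ≢0 , len , split) = inj₂ (u , v ∷ us , ≢0 , cong suc len ,
  λ { (here refl) → inj₂ (here refl) ; (there p) → Sum.map id there (split p) })

unit≢𝟘 : unit {suc n} zero ≢ 𝟘
unit≢𝟘 ()

reduce : ℤ → ℤ^ n → ℤ^ (suc n) → ℤ^ n
reduce a v (b ∷ u) = a ⊛ u ⊕ (ℤ.- b) ⊛ v

-- Fraction-free Gaussian elimination on the first coordinate: a solution w for the reduced vectors
-- is multiplied by the pivot a, and its new first entry makes it orthogonal to the pivot vector.
orthogonal : (vs : List (ℤ^ n)) → length vs ℕ.< n → ∃[ w ] (w ≢ 𝟘 × (∀ {v} → v ∈ vs → w ∙ v ≡ 0ℤ))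
orthogonal {suc n} vs len with find-pivot vs
... | inj₁ heads≡0 = unit zero , unit≢𝟘 , λ {v} p → trans (unit-∙ zero v) (trans (lookup-head v) (heads≡0 p))
  where
  lookup-head : ∀ (v : ℤ^ (suc n)) → Vec.lookup v zero ≡ Vec.head v
  lookup-head (_ ∷ _) = refl
... | inj₂ ((a ∷ v) , us , a≢0 , len′ , split)
    with orthogonal (List.map (reduce a v) us) (ℕ.s≤s⁻¹ (subst (ℕ._< suc n) (trans len′ (cong suc (sym (Listₚ.length-map (reduce a v) us)))) len))
...   | w , w≢𝟘 , perp = (ℤ.- (w ∙ v)) ∷ a ⊛ w ,
        (λ eq → w≢𝟘 (⊛-zero-cancel w a≢0 (Vecₚ.∷-injectiveʳ eq))) , λ p → zero-on (split p)
  where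
  open ≡-Reasoning
  cancel : ∀ x a → ℤ.- x ℤ.* a ℤ.+ a ℤ.* x ≡ 0ℤ
  cancel = solve-∀
  swap : ∀ x y a b → ℤ.- x ℤ.* b ℤ.+ a ℤ.* y ≡ a ℤ.* y ℤ.+ ℤ.- b ℤ.* x
  swap = solve-∀
  zero-on : ∀ {u} → u ≡ a ∷ v ⊎ u ∈ us → ((ℤ.- (w ∙ v)) ∷ a ⊛ w) ∙ u ≡ 0ℤ
  zero-on (inj₁ refl) = trans (cong (λ t → ℤ.- (w ∙ v) ℤ.* a ℤ.+ t) (∙-⊛ˡ a w v)) (cancel (w ∙ v) a)
  zero-on {b ∷ u} (inj₂ p) = begin
    ℤ.- (w ∙ v) ℤ.* b ℤ.+ (a ⊛ w) ∙ u           ≡⟨ cong (λ t → ℤ.- (w ∙ v) ℤ.* b ℤ.+ t) (∙-⊛ˡ a w u) ⟩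
    ℤ.- (w ∙ v) ℤ.* b ℤ.+ a ℤ.* (w ∙ u)         ≡⟨ swap (w ∙ v) (w ∙ u) a b ⟩
    a ℤ.* (w ∙ u) ℤ.+ ℤ.- b ℤ.* (w ∙ v)         ≡⟨ cong₂ ℤ._+_ (∙-⊛ʳ a w u) (∙-⊛ʳ (ℤ.- b) w v) ⟨
    w ∙ (a ⊛ u) ℤ.+ w ∙ ((ℤ.- b) ⊛ v)           ≡⟨ ∙-⊕ʳ w (a ⊛ u) ((ℤ.- b) ⊛ v) ⟨
    w ∙ reduce a v (b ∷ u)                          ≡⟨ perp (∈-map⁺ (reduce a v) p) ⟩
    0ℤ                                          ∎

rowCombination : ℤ^ k → (Fin k → ℤ^ n) → ℤ^ n
rowCombination []      U = 𝟘
rowCombination (a ∷ w) U = a ⊛ U zero ⊕ rowCombination w (U ∘ suc)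

rowCombination-∙ : ∀ (w : ℤ^ k) (U : Fin k → ℤ^ n) y → rowCombination w U ∙ y ≡ w ∙ Vec.tabulate (λ i → U i ∙ y)
rowCombination-∙ []      U y = ∙-𝟘ˡ y
rowCombination-∙ (a ∷ w) U y = trans (∙-⊕ˡ (a ⊛ U zero) (rowCombination w (U ∘ suc)) y)
  (cong₂ ℤ._+_ (∙-⊛ˡ a (U zero) y) (rowCombination-∙ w (U ∘ suc) y))

lookup-rowCombination : ∀ (w : ℤ^ k) (U : Fin k → ℤ^ n) j →
  Vec.lookup (rowCombination w U) j ≡ w ∙ Vec.tabulate (λ i → Vec.lookup (U i) j)
lookup-rowCombination []      U j = Vecₚ.lookup-replicate j 0ℤ
lookup-rowCombination (a ∷ w) U j = trans (Vecₚ.lookup-zipWith ℤ._+_ j (a ⊛ U zero) (rowCombination w (U ∘ suc)))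
  (cong₂ ℤ._+_ (Vecₚ.lookup-map j (ℤ._*_ a) (U zero)) (lookup-rowCombination w (U ∘ suc) j))

lookup-𝟘 : ∀ {v : ℤ^ n} → (∀ j → Vec.lookup v j ≡ 0ℤ) → v ≡ 𝟘
lookup-𝟘 eq = lookup-ext λ j → trans (eq j) (sym (Vecₚ.lookup-replicate j 0ℤ))

∙-single : ∀ (g y : ℤ^ n) i → (∀ j → j ≢ i → Vec.lookup g j ≡ 0ℤ) → g ∙ y ≡ Vec.lookup g i ℤ.* Vec.lookup y i
∙-single (a ∷ g) (b ∷ y) zero    zs = trans (cong (λ t → a ℤ.* b ℤ.+ t)
  (trans (cong (_∙ y) (lookup-𝟘 {v = g} (λ j → zs (suc j) λ ()))) (∙-𝟘ˡ y))) (ℤₚ.+-identityʳ (a ℤ.* b))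
∙-single (a ∷ g) (b ∷ y) (suc i) zs = trans
  (cong₂ ℤ._+_ (trans (cong (ℤ._* b) (zs zero λ ())) (ℤₚ.*-zeroˡ b)) (∙-single g y i (λ j j≢i → zs (suc j) (j≢i ∘ Finₚ.suc-injective))))
  (ℤₚ.+-identityˡ _)

nonzero-entry : ∀ (y : ℤ^ n) → y ≢ 𝟘 → ∃[ i ] Vec.lookup y i ≢ 0ℤ
nonzero-entry []      y≢𝟘 = contradiction refl y≢𝟘
nonzero-entry (a ∷ y) y≢𝟘 with a ℤₚ.≟ 0ℤ
... | no a≢0   = zero , a≢0
... | yes refl with nonzero-entry y (y≢𝟘 ∘ cong (0ℤ ∷_))
...   | i , ≢0 = suc i , ≢0

-- Choose i with yᵢ ≠ 0 and a nonzero w orthogonal to the d - 1 columns other than column i. Then wU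
-- can be nonzero at i only, and (wU) ∙ y = w ∙ (Uy) = 0 makes that entry 0 as well.
kernel⇒left-kernel : ∀ (U : Fin d → ℤ^ d) {y} → y ≢ 𝟘 → (∀ i → U i ∙ y ≡ 0ℤ) →
  ∃[ w ] (w ≢ 𝟘 × rowCombination w U ≡ 𝟘)
kernel⇒left-kernel {d} U {y} y≢𝟘 kernel with nonzero-entry y y≢𝟘
kernel⇒left-kernel {suc d} U {y} y≢𝟘 kernel | i , yᵢ≢0
  with orthogonal (List.map (column ∘ punchIn i) (List.allFin d))
         (ℕ.s≤s (ℕₚ.≤-reflexive (trans (Listₚ.length-map _ (List.allFin d)) (Listₚ.length-tabulate id))))
  where
  column : Fin (suc d) → ℤ^ (suc d)
  column j = Vec.tabulate λ i → Vec.lookup (U i) j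
... | w , w≢𝟘 , perp = w , w≢𝟘 , lookup-𝟘 entries
  where
  g = rowCombination w U
  others : ∀ j → j ≢ i → Vec.lookup g j ≡ 0ℤ
  others j j≢i = trans (lookup-rowCombination w U j)
    (subst (λ j → w ∙ Vec.tabulate (λ i → Vec.lookup (U i) j) ≡ 0ℤ) (Finₚ.punchIn-punchOut (j≢i ∘ sym))
      (perp (∈-map⁺ _ (∈-allFin (punchOut (j≢i ∘ sym))))))
  product≡0 : Vec.lookup g i ℤ.* Vec.lookup y i ≡ 0ℤ
  product≡0 = trans (sym (∙-single g y i others)) (trans (rowCombination-∙ w U y)
    (trans (cong (w ∙_) (lookup-𝟘 {v = Vec.tabulate (λ i → U i ∙ y)} (λ j → trans (Vecₚ.lookup∘tabulate (λ i → U i ∙ y) j) (kernel j)))) (∙-𝟘ʳ w)))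
  entries : ∀ j → Vec.lookup g j ≡ 0ℤ
  entries j with j Finₚ.≟ i
  ... | no j≢i   = others j j≢i
  ... | yes refl = Sum.[ id , (λ yᵢ≡0 → contradiction yᵢ≡0 yᵢ≢0) ] (ℤₚ.i*j≡0⇒i≡0∨j≡0 (Vec.lookup g i) product≡0)

-- Lattice embeddings and bounds on preimages

record LatticeEmbedding (Φ : ℤ^ n → ℤ^ k) : Set where
  field
    homomorphic : ∀ u v → Φ (u ⊕ v) ≡ Φ u ⊕ Φ v
    injective   : ∀ u → Φ u ≡ 𝟘 → u ≡ 𝟘

module _ {Φ : ℤ^ n → ℤ^ k} (embedding : LatticeEmbedding Φ) where

  open LatticeEmbedding embedding

  Φ-𝟘 : Φ 𝟘 ≡ 𝟘
  Φ-𝟘 = ⊕-cancelˡ (Φ 𝟘) (Φ 𝟘) (trans (sym (homomorphic 𝟘 𝟘)) (cong Φ (⊕-identityˡ 𝟘)))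

  Φ-⊝ : ∀ u → Φ (⊝ u) ≡ ⊝ Φ u
  Φ-⊝ u = ⊕-inverse-unique (Φ u) (Φ (⊝ u)) (trans (sym (homomorphic u (⊝ u))) (trans (cong Φ (⊕-inverseʳ u)) Φ-𝟘))

  Φ-⊛ : ∀ l u → Φ (+ l ⊛ u) ≡ + l ⊛ Φ u
  Φ-⊛ zero    u = trans (cong Φ (⊛-zero u)) (trans Φ-𝟘 (sym (⊛-zero (Φ u))))
  Φ-⊛ (suc l) u = trans (cong Φ (⊛-suc l u)) (trans (homomorphic u (+ l ⊛ u)) (trans (cong (Φ u ⊕_) (Φ-⊛ l u)) (sym (⊛-suc l (Φ u)))))

  Φ-cancel : ∀ u v → Φ u ≡ Φ v → u ≡ v
  Φ-cancel u v eq = ⊝-injective (⊕-inverse-unique u (⊝ v)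
    (injective (u ⊕ ⊝ v) (trans (homomorphic u (⊝ v)) (trans (cong₂ _⊕_ eq (Φ-⊝ v)) (⊕-inverseʳ (Φ v))))))
    where
    ⊝-injective : ∀ {n} {u v : ℤ^ n} → ⊝ v ≡ ⊝ u → u ≡ v
    ⊝-injective {u = []}    {[]}    _  = refl
    ⊝-injective {u = a ∷ u} {b ∷ v} eq = cong₂ _∷_ (sym (ℤₚ.neg-injective (Vecₚ.∷-injectiveˡ eq))) (⊝-injective (Vecₚ.∷-injectiveʳ eq))

  Φ-cone : ∀ {G H} → (∀ {g} → G g → H (Φ g)) → ∀ {v} → Cone G v → Cone H (Φ v)
  Φ-cone {G} {H} f = cone-fold (λ v → Cone H (Φ v)) (subst (Cone H) (sym Φ-𝟘) origin)
    λ {g} {v} p c → subst (Cone H) (sym (homomorphic g v)) (f p ◂ c)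

module _ {d : ℕ} where

  -- The pairs are candidates for the graph on X of an affine embedding.
  choices : List (ℤ^ d) → List (ℤ^ d) → List (List (ℤ^ d × ℤ^ d))
  choices []      L = [] ∷ []
  choices (x ∷ X) L = List.cartesianProductWith (λ y ps → (x , y) ∷ ps) L (choices X L)

  graph∈choices : ∀ (f : ℤ^ d → ℤ^ d) X {L} → (∀ {x} → x ∈ X → f x ∈ L) →
    List.map (λ x → x , f x) X ∈ choices X L
  graph∈choices f []      _  = here refl
  graph∈choices f (x ∷ X) f∈ = ∈-cartesianProductWith⁺ (λ y ps → (x , y) ∷ ps) (f∈ (here refl)) (graph∈choices f X (f∈ ∘ there))

  Extends : (ℤ^ (suc d) → ℤ^ (suc d)) → List (ℤ^ d × ℤ^ d) → Set
  Extends Φ ps = ∀ {x y} → (x , y) ∈ ps → Φ (hat x) ≡ hat y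

  -- The preimage is assembled from the pairs alone, so the same u serves for every embedding that
  -- extends them.
  lift : ∀ ps {v} → Cone (SignedHat (List.map proj₂ ps) (List.map proj₂ ps)) v →
    ∃[ u ] (∀ {Φ} → LatticeEmbedding Φ → Extends Φ ps → Φ u ≡ v)
  lift ps = cone-fold (λ v → ∃[ u ] (∀ {Φ} → LatticeEmbedding Φ → Extends Φ ps → Φ u ≡ v))
    (𝟘 , λ emb _ → Φ-𝟘 emb) λ {g} {v} → step {g} {v}
    where
    step : ∀ {g v} → SignedHat (List.map proj₂ ps) (List.map proj₂ ps) g →
      ∃[ u ] (∀ {Φ} → LatticeEmbedding Φ → Extends Φ ps → Φ u ≡ v) →
      ∃[ u ] (∀ {Φ} → LatticeEmbedding Φ → Extends Φ ps → Φ u ≡ g ⊕ v)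
    step (inj₁ (y , p , refl)) (u , eq) with ∈-map⁻ proj₂ p
    ... | (x , _) , q , refl = hat x ⊕ u , λ emb ext →
      trans (LatticeEmbedding.homomorphic emb (hat x) u) (cong₂ _⊕_ (ext q) (eq emb ext))
    step (inj₂ (y , p , refl)) (u , eq) with ∈-map⁻ proj₂ p
    ... | (x , _) , q , refl = ⊝ hat x ⊕ u , λ emb ext →
      trans (LatticeEmbedding.homomorphic emb (⊝ hat x) u) (cong₂ _⊕_ (trans (Φ-⊝ emb (hat x)) (cong ⊝_ (ext q))) (eq emb ext))

  -- B is fixed before Φ: there are infinitely many candidates for Φ and z, but only finitely many
  -- pairs `ps` and points y.
  PreimageBound : List (ℤ^ d) → List (ℤ^ d × ℤ^ d) → ℤ^ d → ℕ → Set
  PreimageBound X ps y B = ∀ {Φ} → LatticeEmbedding Φ → Extends Φ ps → (∀ {x} → x ∈ X → ∃[ x′ ] (x , x′) ∈ ps) →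
    ∀ z → Φ (hat z) ≡ hat y → ∥ z ∥ ℕ.≤ B

  -- A dependence of y on the second components carries over to the first ones, which determines z.
  preimageBound : ∀ {X} → Spanning X → ∀ ps y → ∃[ B ] PreimageBound X ps y B
  preimageBound {X} spanning ps y
    with farkas-list (List.map hat Y ++ List.map (⊝_ ∘ hat) Y) (hat y)
    where Y = List.map proj₂ ps
  -- The bound 0 is vacuous, since no z is mapped to y: a multiple of `hat z` lies in the signed
  -- cone of X, so h would be nonnegative at its image, a positive multiple of `hat y`.
  ... | inj₁ (h , nn , neg) = 0 , λ {Φ} emb ext total z eq → contradiction
        (subst (0ℤ ℤ.≤_) (value emb z eq (proj₁ (spanning-cone spanning z)))
          (cone-nonneg h (signed-nonneg {Φ} emb ext total) (proj₂ (transported emb z))))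
        (ℤₚ.<⇒≱ (neg*-neg (proj₁ (spanning-cone spanning z)) neg))
    where
    Y = List.map proj₂ ps
    transported : ∀ {Φ} (emb : LatticeEmbedding Φ) z → ∃[ v ] Cone (λ g → ∃[ g′ ] (SignedHat X X g′ × g ≡ Φ g′)) (Φ v)
    transported emb z = + suc (proj₁ (spanning-cone spanning z)) ⊛ hat z ,
      Φ-cone emb (λ {g} p → g , p , refl) (proj₂ (spanning-cone spanning z))
    value : ∀ {Φ} (emb : LatticeEmbedding Φ) z → Φ (hat z) ≡ hat y → ∀ l → h ∙ Φ (+ suc l ⊛ hat z) ≡ + suc l ℤ.* (h ∙ hat y)
    value emb z eq l = trans (cong (h ∙_) (trans (Φ-⊛ emb (suc l) (hat z)) (cong ((+ suc l) ⊛_) eq))) (∙-⊛ʳ (+ suc l) h (hat y))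
    signed-nonneg : ∀ {Φ} (emb : LatticeEmbedding Φ) → Extends Φ ps → (∀ {x} → x ∈ X → ∃[ x′ ] (x , x′) ∈ ps) →
      ∀ {g} → ∃[ g′ ] (SignedHat X X g′ × g ≡ Φ g′) → 0ℤ ℤ.≤ h ∙ g
    signed-nonneg emb ext total (_ , inj₁ (x , p , refl) , refl) = let x′ , q = total p in
      subst (λ v → 0ℤ ℤ.≤ h ∙ v) (sym (ext q)) (nn (∈-++⁺ˡ (∈-map⁺ hat (∈-map⁺ proj₂ q))))
    signed-nonneg emb ext total (_ , inj₂ (x , p , refl) , refl) = let x′ , q = total p in
      subst (λ v → 0ℤ ℤ.≤ h ∙ v) (sym (trans (Φ-⊝ emb (hat x)) (cong ⊝_ (ext q))))
        (nn (∈-++⁺ʳ (List.map hat Y) (∈-map⁺ (⊝_ ∘ hat) (∈-map⁺ proj₂ q))))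
  ... | inj₂ (l , c) with lift ps (cone-bind (cone-generator ∘ Sum.map (∈-map⁻ hat) (∈-map⁻ (⊝_ ∘ hat)) ∘ ∈-++⁻ (List.map hat (List.map proj₂ ps))) c)
  -- Both u and `+ suc l ⊛ hat z` are mapped to `+ suc l ⊛ hat y`, so they agree by injectivity.
  ...   | u , Φu≡ = ∥ u ∥ , λ {Φ} emb ext _ z eq → norm≤ z λ i → begin
        ℤ.∣ Vec.lookup z i ∣                          ≤⟨ ℕₚ.m≤n*m _ (suc l) ⟩
        suc l ℕ.* ℤ.∣ Vec.lookup z i ∣                ≡⟨ ℤₚ.abs-* (+ suc l) (Vec.lookup z i) ⟨
        ℤ.∣ + suc l ℤ.* Vec.lookup z i ∣              ≡⟨ cong ℤ.∣_∣ (Vecₚ.lookup-map (suc i) (ℤ._*_ (+ suc l)) (hat z)) ⟨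
        ℤ.∣ Vec.lookup (+ suc l ⊛ hat z) (suc i) ∣    ≡⟨ cong (λ v → ℤ.∣ Vec.lookup v (suc i) ∣) (Φ-cancel emb u (+ suc l ⊛ hat z)
                                                           (trans (Φu≡ emb ext) (sym (trans (Φ-⊛ emb (suc l) (hat z)) (cong ((+ suc l) ⊛_) eq))))) ⟨
        ℤ.∣ Vec.lookup u (suc i) ∣                    ≤⟨ entry≤norm u (suc i) ⟩
        ∥ u ∥                                         ∎
    where open ℕₚ.≤-Reasoning

  preimageBound-all : ∀ {X} → Spanning X → ∀ L → ∃[ B ] (∀ {ps} → ps ∈ choices X L → ∀ {y} → y ∈ L → PreimageBound X ps y B)
  preimageBound-all {X} spanning L = uniform {P = λ ps B → ∀ {y} → y ∈ L → PreimageBound X ps y B}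
    (λ l≤m b p emb ext total z eq → ℕₚ.≤-trans (b p emb ext total z eq) l≤m) (choices X L)
    λ {ps} _ → uniform {P = λ y B → PreimageBound X ps y B}
      (λ l≤m b emb ext total z eq → ℕₚ.≤-trans (b emb ext total z eq) l≤m) L (λ {y} _ → preimageBound spanning ps y)

-- Spanning sets and full dimension

record Weights (X : List (ℤ^ d)) (v : ℤ^ (suc d)) : Set where
  constructor mkWeights
  field
    weights   : Vector ℚ (length X)
    represent : ∀ j → weighted X weights j ≡ toℚ (Vec.lookup v j)

open Weights

cone⇒weights : ∀ {X : List (ℤ^ d)} {v} → Cone (Hat X) v → Weights X v
cone⇒weights c = let q , _ , w = cone-weights c in mkWeights q w

weights-difference : ∀ {X : List (ℤ^ d)} {u v} → Weights X u → Weights X v → Weights X (u ⊕ ⊝ v)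
weights-difference {X = X} {u} {v} (mkWeights q w) (mkWeights q′ w′) = mkWeights (λ i → q i ℚ.- q′ i) λ j → begin
  weighted X (λ i → q i ℚ.- q′ i) j
    ≡⟨ sum-cong-≗ (λ i → solve 3 (λ a b x → (a :- b) :* x := a :* x :+ con (ℚ.- 1ℚ) :* (b :* x)) refl (q i) (q′ i) _) ⟩
  sum (λ i → q i ℚ.* e j i ℚ.+ ℚ.- 1ℚ ℚ.* (q′ i ℚ.* e j i))
    ≡⟨ ∑-distrib-+ (λ i → q i ℚ.* e j i) (λ i → ℚ.- 1ℚ ℚ.* (q′ i ℚ.* e j i)) ⟩
  weighted X q j ℚ.+ sum (λ i → ℚ.- 1ℚ ℚ.* (q′ i ℚ.* e j i))
    ≡⟨ cong (weighted X q j ℚ.+_) (*-distribˡ-sum (ℚ.- 1ℚ) (λ i → q′ i ℚ.* e j i)) ⟨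
  weighted X q j ℚ.+ ℚ.- 1ℚ ℚ.* weighted X q′ j
    ≡⟨ cong₂ (λ a b → a ℚ.+ ℚ.- 1ℚ ℚ.* b) (w j) (w′ j) ⟩
  toℚ (Vec.lookup u j) ℚ.+ ℚ.- 1ℚ ℚ.* toℚ (Vec.lookup v j)
    ≡⟨ solve 2 (λ a b → a :+ con (ℚ.- 1ℚ) :* b := a :+ (:- b)) refl (toℚ (Vec.lookup u j)) (toℚ (Vec.lookup v j)) ⟩
  toℚ (Vec.lookup u j) ℚ.+ ℚ.- toℚ (Vec.lookup v j)
    ≡⟨ cong (toℚ (Vec.lookup u j) ℚ.+_) (toℚ-neg (Vec.lookup v j)) ⟨
  toℚ (Vec.lookup u j) ℚ.+ toℚ (ℤ.- Vec.lookup v j)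
    ≡⟨ toℚ-+ (Vec.lookup u j) (ℤ.- Vec.lookup v j) ⟨
  toℚ (Vec.lookup u j ℤ.+ ℤ.- Vec.lookup v j)
    ≡⟨ cong toℚ (trans (Vecₚ.lookup-zipWith ℤ._+_ j u (⊝ v)) (cong (λ t → Vec.lookup u j ℤ.+ t) (Vecₚ.lookup-map j ℤ.-_ v))) ⟨
  toℚ (Vec.lookup (u ⊕ ⊝ v) j) ∎
  where
  open ≡-Reasoning
  e : ∀ j i → ℚ
  e j i = toℚ (Vec.lookup (hat (List.lookup X i)) j)

IsDifference : List (ℤ^ d) → Pred (ℤ^ (suc d)) 0ℓ
IsDifference X v = ∃[ a ] ∃[ b ] (Cone (Hat X) a × Cone (Hat X) b × v ≡ a ⊕ ⊝ b)

signedCone-difference : ∀ {X : List (ℤ^ d)} {v} → Cone (SignedHat X X) v → IsDifference X v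
signedCone-difference {X = X} = cone-fold (IsDifference X) (𝟘 , 𝟘 , origin , origin , lookup-ext zero-entry) (λ {g} {v} → step {g} {v})
  where
  zero-entry : ∀ {n} (c : Fin n) → Vec.lookup 𝟘 c ≡ Vec.lookup (𝟘 ⊕ ⊝ 𝟘) c
  zero-entry zero    = refl
  zero-entry (suc c) = zero-entry c
  lemma : ∀ y a b → ℤ.- y ℤ.+ (a ℤ.+ ℤ.- b) ≡ a ℤ.+ ℤ.- (y ℤ.+ b)
  lemma = solve-∀
  entry : ∀ {n} c (y a b : ℤ^ n) → Vec.lookup (⊝ y ⊕ (a ⊕ ⊝ b)) c ≡ Vec.lookup (a ⊕ ⊝ (y ⊕ b)) c
  entry zero    (y ∷ _)  (a ∷ _)  (b ∷ _)  = lemma y a b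
  entry (suc c) (_ ∷ ys) (_ ∷ as) (_ ∷ bs) = entry c ys as bs
  step : ∀ {g v} → SignedHat X X g → IsDifference X v → IsDifference X (g ⊕ v)
  step (inj₁ p@(x , _ , refl)) (a , b , ca , cb , refl) = hat x ⊕ a , b , p ◂ ca , cb , sym (⊕-assoc (hat x) a (⊝ b))
  step (inj₂ (y , p , refl)) (a , b , ca , cb , refl) = a , hat y ⊕ b , ca , (y , p , refl) ◂ cb , lookup-ext (λ c → entry c (hat y) a b)

spanning⇒weights : ∀ {X : List (ℤ^ d)} → Spanning X → ∀ y → Weights X (hat y)
spanning⇒weights {X = X} spanning y =
  let k , c = spanning-cone spanning y
      a , b , ca , cb , eq = signedCone-difference c
      mkWeights q w = weights-difference (cone⇒weights ca) (cone⇒weights cb)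
      s , _ , cancel = reciprocal k
  in mkWeights (λ i → s ℚ.* q i) (scaled-weights X q s k y cancel λ j → trans (w j) (cong (λ v → toℚ (Vec.lookup v j)) (sym eq)))

-- The direction is written as `unit i` minus the origin, so its weights sum to 0.
directionWeights : ∀ {X : List (ℤ^ d)} → Spanning X → ∀ i → Weights X (0ℤ ∷ unit i)
directionWeights {X = X} spanning i = subst (Weights X) (lookup-ext entry)
  (weights-difference (spanning⇒weights spanning (unit i)) (spanning⇒weights spanning 𝟘))
  where
  entry : ∀ c → Vec.lookup (hat (unit i) ⊕ ⊝ hat 𝟘) c ≡ Vec.lookup (0ℤ ∷ unit i) c
  entry zero    = refl
  entry (suc c) = trans (Vecₚ.lookup-zipWith ℤ._+_ c (unit i) (⊝ 𝟘))
    (trans (cong (λ t → Vec.lookup (unit i) c ℤ.+ t) (trans (Vecₚ.lookup-map c ℤ.-_ 𝟘) (cong ℤ.-_ (Vecₚ.lookup-replicate c 0ℤ))))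
      (ℤₚ.+-identityʳ (Vec.lookup (unit i) c)))

lookup-unit-sum : ∀ (P : Vector ℚ n) j → sum (λ i → P i ℚ.* toℚ (Vec.lookup (unit i) j)) ≡ P j
lookup-unit-sum {suc n} P zero = trans (cong₂ ℚ._+_ (trans (cong (P zero ℚ.*_) toℚ-1) (ℚₚ.*-identityʳ (P zero)))
  (sum-zero _ λ i → trans (cong (P (suc i) ℚ.*_) toℚ-0) (ℚₚ.*-zeroʳ (P (suc i))))) (ℚₚ.+-identityʳ (P zero))
lookup-unit-sum {suc n} P (suc j) = trans (cong₂ ℚ._+_
  (trans (cong (λ t → P zero ℚ.* toℚ t) (Vecₚ.lookup-replicate j 0ℤ)) (trans (cong (P zero ℚ.*_) toℚ-0) (ℚₚ.*-zeroʳ (P zero))))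
  (lookup-unit-sum (P ∘ suc) j)) (ℚₚ.+-identityˡ (P (suc j)))

weighted-linear : ∀ (X : List (ℤ^ d)) q (P : Vector ℚ n) (δ : Fin n → Vector ℚ (length X)) j →
  weighted X (λ k → q k ℚ.+ sum (λ i → P i ℚ.* δ i k)) j ≡ weighted X q j ℚ.+ sum (λ i → P i ℚ.* weighted X (δ i) j)
weighted-linear X q P δ j = begin
  sum (λ k → (q k ℚ.+ sum (λ i → P i ℚ.* δ i k)) ℚ.* e k)
    ≡⟨ sum-cong-≗ (λ k → trans (ℚₚ.*-distribʳ-+ (e k) (q k) _) (cong (q k ℚ.* e k ℚ.+_)
         (trans (*-distribʳ-sum (e k) (λ i → P i ℚ.* δ i k)) (sum-cong-≗ λ i → ℚₚ.*-assoc (P i) (δ i k) (e k))))) ⟩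
  sum (λ k → q k ℚ.* e k ℚ.+ sum (λ i → P i ℚ.* (δ i k ℚ.* e k)))
    ≡⟨ ∑-distrib-+ (λ k → q k ℚ.* e k) (λ k → sum (λ i → P i ℚ.* (δ i k ℚ.* e k))) ⟩
  weighted X q j ℚ.+ sum (λ k → sum (λ i → P i ℚ.* (δ i k ℚ.* e k)))
    ≡⟨ cong (weighted X q j ℚ.+_) (trans (∑-comm (λ k i → P i ℚ.* (δ i k ℚ.* e k)))
         (sum-cong-≗ λ i → sym (*-distribˡ-sum (P i) (λ k → δ i k ℚ.* e k)))) ⟩
  weighted X q j ℚ.+ sum (λ i → P i ℚ.* weighted X (δ i) j) ∎
  where
  open ≡-Reasoning
  e : Vector ℚ (length X)
  e k = toℚ (Vec.lookup (hat (List.lookup X k)) j)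

module _ {X : List (ℤ^ d)} (spanning : Spanning X) (p : ℝ^ d) where

  private
    q₀ : Vector ℚ (length X)
    q₀ = weights (spanning⇒weights spanning 𝟘)
    δ : Fin d → Vector ℚ (length X)
    δ i = weights (directionWeights spanning i)
    c : ℝ^ (length X)
    c k = fromℚ (q₀ k) + ∑ λ i → p i * fromℚ (δ i k)
    P : ℕ → Vector ℚ d
    P m i = seq (p i) m

    c-seq : ∀ m k → seq (c k) m ≡ q₀ k ℚ.+ sum (λ i → P m i ℚ.* δ i k)
    c-seq m k = cong (q₀ k ℚ.+_) (seq-∑ (λ i → p i * fromℚ (δ i k)) m)

    c-weighted : ∀ m j → weighted X (λ k → seq (c k) m) j ≡
      toℚ (Vec.lookup (hat 𝟘) j) ℚ.+ sum (λ i → P m i ℚ.* toℚ (Vec.lookup (0ℤ ∷ unit i) j))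
    c-weighted m j = trans (sum-cong-≗ λ k → cong (ℚ._* _) (c-seq m k)) (trans (weighted-linear X q₀ (P m) δ j)
      (cong₂ ℚ._+_ (represent (spanning⇒weights spanning 𝟘) j)
        (sum-cong-≗ λ i → cong (P m i ℚ.*_) (represent (directionWeights spanning i) j))))

    total : ∀ m → seq (∑ c) m ≡ 1ℚ
    total m = trans (seq-∑ c m) (trans
      (sum-cong-≗ λ k → sym (trans (cong (seq (c k) m ℚ.*_) toℚ-1) (ℚₚ.*-identityʳ (seq (c k) m))))
      (trans (c-weighted m zero) (trans
        (cong₂ ℚ._+_ toℚ-1 (sum-zero _ λ i → trans (cong (P m i ℚ.*_) toℚ-0) (ℚₚ.*-zeroʳ (P m i)))) (ℚₚ.+-identityʳ 1ℚ))))

    point : ∀ j m → seq (combination X c j) m ≡ seq (p j) m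
    point j m = trans (seq-∑ (λ k → c k * ι (List.lookup X k) j) m) (trans
      (sum-cong-≗ λ k → cong (seq (c k) m ℚ.*_) (toℚ-def (Vec.lookup (List.lookup X k) j)))
      (trans (c-weighted m (suc j)) (trans
        (cong₂ ℚ._+_ (trans (cong toℚ (Vecₚ.lookup-replicate j 0ℤ)) toℚ-0) (lookup-unit-sum (P m) j)) (ℚₚ.+-identityˡ _))))

  -- Barycentric coordinates of p: the weights of the origin plus p i times those of the i-th
  -- direction. They are affine in p with rational coefficients, so the required identities hold
  -- exactly at every index.
  spanning⇒aff : aff X p
  spanning⇒aff = c , ≗⇒≈ {∑ c} {1ℝ} total , λ j → ≗⇒≈ {p j} {combination X c j} λ m → sym (point j m)

spanning⇒fullDimensional : ∀ {X : List (ℤ^ d)} → Spanning X → FullDimensional X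
spanning⇒fullDimensional {X = X} spanning p = spanning⇒aff {X = X} spanning p

-- The order of the reals and the lattice-width

≈-trans : ∀ {x y z} → x ≈ y → y ≈ z → x ≈ z
≈-trans {x} {y} {z} p q = null⇒≈ {x} {z} (null-resp
  (λ m → solve 3 (λ a b c → (a :- b) :+ (b :- c) := a :- c) refl (seq x m) (seq y m) (seq z m))
  (null-+ (≈⇒null {x} {y} p) (≈⇒null {y} {z} q)))

≤-trans : ∀ {x y z} → x ≤ y → y ≤ z → x ≤ z
≤-trans {x} {y} {z} p q = 0≲⇒≤ {x} {z} (0≲-resp
  (λ m → solve 3 (λ a b c → (b :- a) :+ (c :- b) := c :- a) refl (seq x m) (seq y m) (seq z m))
  (0≲-+ (≤⇒0≲ {x} {y} p) (≤⇒0≲ {y} {z} q)))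

-‿mono-≤ : ∀ {x y x′ y′} → x ≤ x′ → y′ ≤ y → x - y ≤ x′ - y′
-‿mono-≤ {x} {y} {x′} {y′} p q = 0≲⇒≤ {x - y} {x′ - y′} (0≲-resp
  (λ m → solve 4 (λ a b c e → (c :- a) :+ (b :- e) := (c :- e) :- (a :- b)) refl (seq x m) (seq y m) (seq x′ m) (seq y′ m))
  (0≲-+ (≤⇒0≲ {x} {x′} p) (≤⇒0≲ {y′} {y} q)))

<⇒≰ : ∀ {x y} → x < y → ¬ (y ≤ x)
<⇒≰ {x} {y} (ε , 0<ε , N , h) p =
  let M , g = p (½ ℚ.* ε) (½-pos 0<ε)
      K = M ℕ.⊔ N
  in <⇒≱ (½<1 0<ε) (subst₂ ℚ._≤_
       (solve 2 (λ a e → :- a :+ (a :+ e) := e) refl (seq x K) ε)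
       (solve 2 (λ a e → :- a :+ (a :+ e) := e) refl (seq x K) (½ ℚ.* ε))
       (ℚₚ.+-monoʳ-≤ (ℚ.- seq x K) (ℚₚ.≤-trans (h K (ℕₚ.m≤n⊔m M N)) (g K (ℕₚ.m≤m⊔n M N)))))

conv-resp : ∀ {X : List (ℤ^ d)} {p q} → p ≈ᵥ q → conv X q → conv X p
conv-resp {X = X} {p} {q} p≈q (c , c≥0 , Σc≈1 , q≈) = c , c≥0 , Σc≈1 , λ i → ≈-trans {p i} {q i} {combination X c i} (p≈q i) (q≈ i)

member⇒conv : ∀ {X : List (ℤ^ d)} {x} → x ∈ X → conv X (ι x)
member⇒conv {X = X} {x} p = hull⇒conv {X = X} {x} (member⇒hull p)

⟦⟧⊆conv : ∀ {X : List (ℤ^ d)} {p} → ⟦ X ⟧ p → conv X p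
⟦⟧⊆conv {X = X} {p} (x , x∈X , p≈x) = conv-resp {X = X} {p} {ι x} p≈x (member⇒conv {X = X} x∈X)

member⇒⟦⟧ : ∀ {X : List (ℤ^ d)} {x} → x ∈ X → ⟦ X ⟧ (ι x)
member⇒⟦⟧ {x = x} p = x , p , λ i → ≗⇒≈ {ι x i} {ι x i} λ _ → refl

seq-dot : ∀ u (p : ℝ^ d) m → seq (ι u · p) m ≡ sum (λ j → toℚ (Vec.lookup u j) ℚ.* seq (p j) m)
seq-dot u p m = trans (seq-∑ (λ j → ι u j * p j) m) (sum-cong-≗ λ j → cong (ℚ._* seq (p j) m) (toℚ-def (Vec.lookup u j)))

seq-dot-lattice : ∀ (u z : ℤ^ d) m → seq (ι u · ι z) m ≡ toℚ (u ∙ z)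
seq-dot-lattice u z m = trans (seq-dot u (ι z) m)
  (trans (sum-cong-≗ λ j → cong (toℚ (Vec.lookup u j) ℚ.*_) (toℚ-def (Vec.lookup z j))) (sym (toℚ-∙ u z)))

conv-upper : ∀ {X : List (ℤ^ d)} {p} u y → conv X p → (∀ {x} → x ∈ X → u ∙ x ℤ.≤ u ∙ y) → ι u · p ≤ ι u · ι y
conv-upper {X = X} {p} u y p∈ upper = 0≲⇒≤ {ι u · p} {ι u · ι y} (0≲-resp value
  (conv-nonneg {X = X} {p} h p∈ λ {x} q → subst (0ℤ ℤ.≤_) (sym (lattice x)) (ℤₚ.i≤j⇒0≤j-i (upper q))))
  where
  h = (u ∙ y) ∷ ⊝ u
  lattice : ∀ x → h ∙ hat x ≡ u ∙ y ℤ.- u ∙ x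
  lattice x = cong₂ ℤ._+_ (ℤₚ.*-identityʳ (u ∙ y)) (∙-⊝ˡ u x)
  open ≡-Reasoning
  value : ∀ m → evaluate h p m ≡ seq (ι u · ι y) m ℚ.- seq (ι u · p) m
  value m = cong₂ ℚ._+_ (sym (seq-dot-lattice u y m)) (begin
    sum (λ j → toℚ (Vec.lookup (⊝ u) j) ℚ.* seq (p j) m)
      ≡⟨ sum-cong-≗ (λ j → trans (cong (λ t → toℚ t ℚ.* seq (p j) m) (Vecₚ.lookup-map j ℤ.-_ u))
           (trans (cong (ℚ._* seq (p j) m) (toℚ-neg (Vec.lookup u j)))
             (solve 2 (λ a b → (:- a) :* b := con (ℚ.- 1ℚ) :* (a :* b)) refl (toℚ (Vec.lookup u j)) (seq (p j) m)))) ⟩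
    sum (λ j → ℚ.- 1ℚ ℚ.* (toℚ (Vec.lookup u j) ℚ.* seq (p j) m))
      ≡⟨ *-distribˡ-sum (ℚ.- 1ℚ) (λ j → toℚ (Vec.lookup u j) ℚ.* seq (p j) m) ⟨
    ℚ.- 1ℚ ℚ.* sum (λ j → toℚ (Vec.lookup u j) ℚ.* seq (p j) m)
      ≡⟨ cong (ℚ.- 1ℚ ℚ.*_) (seq-dot u p m) ⟨
    ℚ.- 1ℚ ℚ.* seq (ι u · p) m
      ≡⟨ solve 1 (λ a → con (ℚ.- 1ℚ) :* a := :- a) refl (seq (ι u · p) m) ⟩
    ℚ.- seq (ι u · p) m ∎)

conv-lower : ∀ {X : List (ℤ^ d)} {p} u y → conv X p → (∀ {x} → x ∈ X → u ∙ y ℤ.≤ u ∙ x) → ι u · ι y ≤ ι u · p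
conv-lower {X = X} {p} u y p∈ lower = 0≲⇒≤ {ι u · ι y} {ι u · p} (0≲-resp value
  (conv-nonneg {X = X} {p} h p∈ λ {x} q → subst (0ℤ ℤ.≤_) (sym (lattice x)) (ℤₚ.i≤j⇒0≤j-i (lower q))))
  where
  h = (ℤ.- (u ∙ y)) ∷ u
  lattice : ∀ x → h ∙ hat x ≡ u ∙ x ℤ.- u ∙ y
  lattice x = trans (cong (λ t → t ℤ.+ u ∙ x) (ℤₚ.*-identityʳ (ℤ.- (u ∙ y)))) (ℤₚ.+-comm (ℤ.- (u ∙ y)) (u ∙ x))
  value : ∀ m → evaluate h p m ≡ seq (ι u · p) m ℚ.- seq (ι u · ι y) m
  value m = trans (cong₂ ℚ._+_ (trans (toℚ-neg (u ∙ y)) (cong ℚ.-_ (sym (seq-dot-lattice u y m)))) (sym (seq-dot u p m)))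
    (ℚₚ.+-comm (ℚ.- seq (ι u · ι y) m) (seq (ι u · p) m))

highest : ∀ (u : ℤ^ d) X {x} → x ∈ X → ∃[ y ] (y ∈ X × (∀ {x} → x ∈ X → u ∙ x ℤ.≤ u ∙ y))
highest u (x ∷ [])     _ = x , here refl , λ { (here refl) → ℤₚ.≤-refl }
highest u (x ∷ y ∷ X)  _ with highest u (y ∷ X) (here refl)
... | z , z∈ , upper with ℤₚ.≤-total (u ∙ x) (u ∙ z)
...   | inj₁ x≤z = z , there z∈ , λ { (here refl) → x≤z ; (there p) → upper p }
...   | inj₂ z≤x = x , here refl , λ { (here refl) → ℤₚ.≤-refl ; (there p) → ℤₚ.≤-trans (upper p) z≤x }

lowest : ∀ (u : ℤ^ d) X {x} → x ∈ X → ∃[ y ] (y ∈ X × (∀ {x} → x ∈ X → u ∙ y ℤ.≤ u ∙ x))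
lowest u X p = let y , y∈ , upper = highest (⊝ u) X p in
  y , y∈ , λ {x} q → ℤₚ.neg-cancel-≤ (subst₂ ℤ._≤_ (∙-⊝ˡ u x) (∙-⊝ˡ u y) (upper q))

module _ {X : List (ℤ^ d)} {w} {r : ℝ} (r-width : IsLatticeWidth ⟦ X ⟧ r) (w<r : fromℤ (+ w) < r) where

  wide⇒nonempty : ∃[ x ] x ∈ X
  wide⇒nonempty = let (_ , _ , _ , _ , (x , x∈X , _) , _) , _ = r-width in x , x∈X

  width-≤ : ∀ u → NonZeroᵥ u → ∃[ x ] ∃[ y ] (x ∈ X × y ∈ X × r ≤ ι u · ι x - ι u · ι y)
  width-≤ u u≢𝟘 =
    let x , x∈ , upper = highest u X (proj₂ wide⇒nonempty)
        y , y∈ , lower = lowest u X (proj₂ wide⇒nonempty)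
    in x , y , x∈ , y∈ , proj₂ r-width u (ι u · ι x - ι u · ι y) u≢𝟘
         (ι x , ι y , member⇒⟦⟧ {X = X} x∈ , member⇒⟦⟧ {X = X} y∈ ,
          (λ p p∈ → conv-upper {X = X} {p} u x (⟦⟧⊆conv {X = X} {p} p∈) upper) ,
          (λ p p∈ → conv-lower {X = X} {p} u y (⟦⟧⊆conv {X = X} {p} p∈) lower) ,
          ≗⇒≈ {ι u · ι x - ι u · ι y} {ι u · ι x - ι u · ι y} λ _ → refl)

  ¬r≤w : ¬ (r ≤ fromℤ (+ w))
  ¬r≤w = <⇒≰ {fromℤ (+ w)} {r} w<r

  -- A nonzero direction that is constant on X would show that the lattice-width is at most 0, hence
  -- at most w.
  flat-direction-𝟘 : ∀ {c} u → (∀ {x} → x ∈ X → u ∙ x ≡ c) → u ≡ 𝟘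
  flat-direction-𝟘 {c} u flat = decidable-stable (u ≟ 𝟘) λ u≢𝟘 →
    let x , y , x∈ , y∈ , r≤ = width-≤ u u≢𝟘
    in ¬r≤w (≤-trans {r} {ι u · ι x - ι u · ι y} {fromℤ (+ w)} r≤
      (0≲⇒≤ {ι u · ι x - ι u · ι y} {fromℤ (+ w)} (0≲-nonneg λ m → nonneg-difference (difference x y x∈ y∈ m))))
    where
    difference : ∀ x y → x ∈ X → y ∈ X → ∀ m → seq (ι u · ι x - ι u · ι y) m ≡ 0ℚ
    difference x y x∈ y∈ m = trans (cong₂ ℚ._-_ (seq-dot-lattice u x m) (seq-dot-lattice u y m))
      (trans (cong (λ t → toℚ t ℚ.- toℚ (u ∙ y)) (trans (flat x∈) (sym (flat y∈)))) (ℚₚ.+-inverseʳ (toℚ (u ∙ y))))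
    nonneg-difference : ∀ {b} → b ≡ 0ℚ → 0ℚ ℚ.≤ (+ w ℚ./ 1) ℚ.- b
    nonneg-difference refl = ℚₚ.≤-trans (toℚ-nonneg {+ w} (ℤ.+≤+ ℕ.z≤n))
      (ℚₚ.≤-reflexive (trans (sym (toℚ-def (+ w))) (sym (ℚₚ.+-identityʳ (+ w ℚ./ 1)))))

  wide⇒spanning : Spanning X
  wide⇒spanning (h₀ ∷ u) zero-on y = trans (constant y) (trans (sym (constant (proj₁ wide⇒nonempty))) (zero-on (proj₂ wide⇒nonempty)))
    where
    recover : ∀ a b → b ≡ (a ℤ.+ b) ℤ.- a
    recover = solve-∀
    constant : ∀ z → h₀ ℤ.* 1ℤ ℤ.+ u ∙ z ≡ h₀ ℤ.* 1ℤ
    constant z = trans (cong (λ u → h₀ ℤ.* 1ℤ ℤ.+ u ∙ z) (flat-direction-𝟘 u λ {x} p →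
        trans (recover (h₀ ℤ.* 1ℤ) (u ∙ x)) (cong (ℤ._- h₀ ℤ.* 1ℤ) (zero-on p))))
      (trans (cong (λ t → h₀ ℤ.* 1ℤ ℤ.+ t) (∙-𝟘ˡ z)) (ℤₚ.+-identityʳ (h₀ ℤ.* 1ℤ)))

  -- Lattice-width is monotone: along the direction that attains the width of conv V, its subset X
  -- already extends by at least r, which exceeds w.
  ¬narrow : ∀ {V} → (∀ {x} → x ∈ X → x ∈ V) → ¬ LatticeWidth≤ (conv V) w
  ¬narrow {V} X⊆V (s , ((u , u≢𝟘 , p , q , _ , _ , p-max , q-min , s≈) , _) , s≤w) = compare (width-≤ u u≢𝟘)
    where
    compare : ¬ (∃[ x ] ∃[ y ] (x ∈ X × y ∈ X × r ≤ ι u · ι x - ι u · ι y))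
    compare (x , y , x∈ , y∈ , r≤) = ¬r≤w (≤-trans {r} {ι u · ι x - ι u · ι y} {fromℤ (+ w)} r≤
      (≤-trans {ι u · ι x - ι u · ι y} {ι u · p - ι u · q} {fromℤ (+ w)}
        (-‿mono-≤ {ι u · ι x} {ι u · ι y} {ι u · p} {ι u · q}
          (p-max (ι x) (member⇒conv {X = V} (X⊆V x∈))) (q-min (ι y) (member⇒conv {X = V} (X⊆V y∈))))
        (≤-trans {ι u · p - ι u · q} {s} {fromℤ (+ w)} (≈⇒≤ {ι u · p - ι u · q} {s} (≈-sym {s} {ι u · p - ι u · q} s≈)) s≤w)))

-- Unimodular maps as embeddings of the homogenised lattice

null-lattice : ∀ (h : ℤ^ (suc d)) x → Null (evaluate h (ι x)) → h ∙ hat x ≡ 0ℤ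
null-lattice h x (null p q) = toℚ-injective (ℚₚ.≤-antisym
  (subst₂ ℚ._≤_ (solve 1 (λ a → :- (:- a) := a) refl (toℚ (h ∙ hat x))) (sym toℚ-0)
    (ℚₚ.neg-antimono-≤ (0≲-const (0≲-resp (cong ℚ.-_ ∘ evaluate-ι h x) q))))
  (ℚₚ.≤-trans (ℚₚ.≤-reflexive toℚ-0) (0≲-const (0≲-resp (evaluate-ι h x) p))))

homogenise : Matrix ℤ d d → ℤ^ d → ℤ^ (suc d) → ℤ^ (suc d)
homogenise U t v = Vec.head v ∷ Vec.tabulate λ i → (Vec.lookup t i ∷ Vec.tabulate (U i)) ∙ v

affineMap : Matrix ℤ d d → ℤ^ d → ℤ^ d → ℤ^ d
affineMap U t x = Vec.tail (homogenise U t (hat x))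

homogenise-⊕ : ∀ (U : Matrix ℤ d d) t u v → homogenise U t (u ⊕ v) ≡ homogenise U t u ⊕ homogenise U t v
homogenise-⊕ U t u@(_ ∷ _) v@(_ ∷ _) = cong (_ ∷_) (lookup-ext λ i → trans (Vecₚ.lookup∘tabulate (λ i → R i ∙ (u ⊕ v)) i)
  (trans (∙-⊕ʳ (R i) u v) (sym (trans (Vecₚ.lookup-zipWith ℤ._+_ i (Vec.tabulate (λ i → R i ∙ u)) (Vec.tabulate (λ i → R i ∙ v)))
    (cong₂ ℤ._+_ (Vecₚ.lookup∘tabulate (λ i → R i ∙ u) i) (Vecₚ.lookup∘tabulate (λ i → R i ∙ v) i))))))
  where
  R = λ i → Vec.lookup t i ∷ Vec.tabulate (U i)

IsImage : ∀ {d} → Matrix ℤ d d → ℤ^ d → List (ℤ^ d) → List (ℤ^ d) → Set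
IsImage U t V W = ∀ p → conv W p ⇔ (∃[ q ] (conv V q × (∀ i → p i ≈ (λ j → fromℤ (U i j)) · q + ι t i)))

seq-affine : ∀ (U : Matrix ℤ d d) t q i m → seq ((λ j → fromℤ (U i j)) · q + ι t i) m ≡
  sum (λ j → toℚ (U i j) ℚ.* seq (q j) m) ℚ.+ toℚ (Vec.lookup t i)
seq-affine U t q i m = cong₂ ℚ._+_
  (trans (seq-∑ (λ j → fromℤ (U i j) * q j) m) (sum-cong-≗ λ j → cong (ℚ._* seq (q j) m) (toℚ-def (U i j))))
  (toℚ-def (Vec.lookup t i))

module _ {U : Matrix ℤ d d} {t : ℤ^ d} {V W : List (ℤ^ d)} (image : IsImage U t V W) where

  affineMap∈conv : ∀ {x} → conv V (ι x) → conv W (ι (affineMap U t x))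
  affineMap∈conv {x} x∈ = Equivalence.from (image (ι (affineMap U t x))) (ι x , x∈ , λ i →
    ≗⇒≈ {ι (affineMap U t x) i} {(λ j → fromℤ (U i j)) · ι x + ι t i} (value i))
    where
    open ≡-Reasoning
    value : ∀ i m → seq (ι (affineMap U t x) i) m ≡ seq ((λ j → fromℤ (U i j)) · ι x + ι t i) m
    value i m = begin
      seq (ι (affineMap U t x) i) m
        ≡⟨ toℚ-def (Vec.lookup (affineMap U t x) i) ⟩
      toℚ (Vec.lookup (affineMap U t x) i)
        ≡⟨ cong toℚ (Vecₚ.lookup∘tabulate (λ i → (Vec.lookup t i ∷ Vec.tabulate (U i)) ∙ hat x) i) ⟩
      toℚ (Vec.lookup t i ℤ.* 1ℤ ℤ.+ Vec.tabulate (U i) ∙ x)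
        ≡⟨ cong (λ a → toℚ (a ℤ.+ Vec.tabulate (U i) ∙ x)) (ℤₚ.*-identityʳ (Vec.lookup t i)) ⟩
      toℚ (Vec.lookup t i ℤ.+ Vec.tabulate (U i) ∙ x)
        ≡⟨ trans (toℚ-+ (Vec.lookup t i) (Vec.tabulate (U i) ∙ x)) (ℚₚ.+-comm (toℚ (Vec.lookup t i)) (toℚ (Vec.tabulate (U i) ∙ x))) ⟩
      toℚ (Vec.tabulate (U i) ∙ x) ℚ.+ toℚ (Vec.lookup t i)
        ≡⟨ cong (ℚ._+ toℚ (Vec.lookup t i)) (trans (toℚ-∙ (Vec.tabulate (U i)) x) (sum-cong-≗ λ j →
             cong₂ ℚ._*_ (cong toℚ (Vecₚ.lookup∘tabulate (U i) j)) (sym (toℚ-def (Vec.lookup x j))))) ⟩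
      sum (λ j → toℚ (U i j) ℚ.* seq (ι x j) m) ℚ.+ toℚ (Vec.lookup t i)
        ≡⟨ seq-affine U t (ι x) i m ⟨
      seq ((λ j → fromℤ (U i j)) · ι x + ι t i) m ∎

  private
    module _ (w : ℤ^ d) (wU≡𝟘 : rowCombination w (λ i → Vec.tabulate (U i)) ≡ 𝟘) where

      h : ℤ^ (suc d)
      h = (ℤ.- (w ∙ t)) ∷ w

      column-zero : ∀ j → sum (λ i → toℚ (Vec.lookup w i) ℚ.* toℚ (U i j)) ≡ 0ℚ
      column-zero j = begin
        sum (λ i → toℚ (Vec.lookup w i) ℚ.* toℚ (U i j))
          ≡⟨ sum-cong-≗ (λ i → cong (λ a → toℚ (Vec.lookup w i) ℚ.* toℚ a)
               (trans (Vecₚ.lookup∘tabulate (λ i → Vec.lookup (Vec.tabulate (U i)) j) i) (Vecₚ.lookup∘tabulate (U i) j))) ⟨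
        sum (λ i → toℚ (Vec.lookup w i) ℚ.* toℚ (Vec.lookup (Vec.tabulate (λ i → Vec.lookup (Vec.tabulate (U i)) j)) i))
          ≡⟨ toℚ-∙ w (Vec.tabulate λ i → Vec.lookup (Vec.tabulate (U i)) j) ⟨
        toℚ (w ∙ Vec.tabulate λ i → Vec.lookup (Vec.tabulate (U i)) j)
          ≡⟨ cong toℚ (lookup-rowCombination w (λ i → Vec.tabulate (U i)) j) ⟨
        toℚ (Vec.lookup (rowCombination w (λ i → Vec.tabulate (U i))) j)
          ≡⟨ cong toℚ (trans (cong (λ v → Vec.lookup v j) wU≡𝟘) (Vecₚ.lookup-replicate j 0ℤ)) ⟩
        toℚ 0ℤ
          ≡⟨ toℚ-0 ⟩
        0ℚ ∎
        where open ≡-Reasoning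

      linear-zero : ∀ (q : Vector ℚ d) → sum (λ i → toℚ (Vec.lookup w i) ℚ.* sum (λ j → toℚ (U i j) ℚ.* q j)) ≡ 0ℚ
      linear-zero q = begin
        sum (λ i → ω i ℚ.* sum (λ j → toℚ (U i j) ℚ.* q j))
          ≡⟨ sum-cong-≗ (λ i → trans (*-distribˡ-sum (ω i) (λ j → toℚ (U i j) ℚ.* q j))
               (sum-cong-≗ λ j → sym (ℚₚ.*-assoc (ω i) (toℚ (U i j)) (q j)))) ⟩
        sum (λ i → sum (λ j → ω i ℚ.* toℚ (U i j) ℚ.* q j))
          ≡⟨ ∑-comm (λ i j → ω i ℚ.* toℚ (U i j) ℚ.* q j) ⟩
        sum (λ j → sum (λ i → ω i ℚ.* toℚ (U i j) ℚ.* q j))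
          ≡⟨ sum-zero _ (λ j → trans (sym (*-distribʳ-sum (q j) (λ i → ω i ℚ.* toℚ (U i j))))
               (trans (cong (ℚ._* q j) (column-zero j)) (ℚₚ.*-zeroˡ (q j)))) ⟩
        0ℚ ∎
        where
        open ≡-Reasoning
        ω : Vector ℚ d
        ω i = toℚ (Vec.lookup w i)

      evaluate-image : ∀ {p} → ∃[ q ] (conv V q × (∀ i → p i ≈ (λ j → fromℤ (U i j)) · q + ι t i)) → Null (evaluate h p)
      evaluate-image {p} (q , _ , p≈) = null-resp value
        (null-sum λ i → null-scale (Vec.lookup w i) (≈⇒null {p i} {(λ j → fromℤ (U i j)) · q + ι t i} (p≈ i)))
        where
        open ≡-Reasoning
        module _ (m : ℕ) where
          ω τ π σ : Vector ℚ d
          ω i = toℚ (Vec.lookup w i)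
          τ i = toℚ (Vec.lookup t i)
          π i = seq (p i) m
          σ i = sum (λ j → toℚ (U i j) ℚ.* seq (q j) m)
          value : sum (λ i → ω i ℚ.* (π i ℚ.- seq ((λ j → fromℤ (U i j)) · q + ι t i) m)) ≡ evaluate h p m
          value = begin
            sum (λ i → ω i ℚ.* (π i ℚ.- seq ((λ j → fromℤ (U i j)) · q + ι t i) m))
              ≡⟨ sum-cong-≗ (λ i → trans (cong (λ a → ω i ℚ.* (π i ℚ.- a)) (seq-affine U t q i m))
                   (solve 4 (λ w p s t → w :* (p :- (s :+ t)) := (con (ℚ.- 1ℚ) :* (w :* t) :+ w :* p) :+ con (ℚ.- 1ℚ) :* (w :* s)) refl (ω i) (π i) (σ i) (τ i))) ⟩
            sum (λ i → (ℚ.- 1ℚ ℚ.* (ω i ℚ.* τ i) ℚ.+ ω i ℚ.* π i) ℚ.+ ℚ.- 1ℚ ℚ.* (ω i ℚ.* σ i))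
              ≡⟨ trans (∑-distrib-+ (λ i → ℚ.- 1ℚ ℚ.* (ω i ℚ.* τ i) ℚ.+ ω i ℚ.* π i) (λ i → ℚ.- 1ℚ ℚ.* (ω i ℚ.* σ i)))
                   (cong (ℚ._+ sum (λ i → ℚ.- 1ℚ ℚ.* (ω i ℚ.* σ i))) (∑-distrib-+ (λ i → ℚ.- 1ℚ ℚ.* (ω i ℚ.* τ i)) (λ i → ω i ℚ.* π i))) ⟩
            sum (λ i → ℚ.- 1ℚ ℚ.* (ω i ℚ.* τ i)) ℚ.+ sum (λ i → ω i ℚ.* π i) ℚ.+ sum (λ i → ℚ.- 1ℚ ℚ.* (ω i ℚ.* σ i))
              ≡⟨ cong₂ (λ a b → a ℚ.+ sum (λ i → ω i ℚ.* π i) ℚ.+ b)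
                   (trans (sym (*-distribˡ-sum (ℚ.- 1ℚ) (λ i → ω i ℚ.* τ i))) (cong (ℚ.- 1ℚ ℚ.*_) (sym (toℚ-∙ w t))))
                   (trans (sym (*-distribˡ-sum (ℚ.- 1ℚ) (λ i → ω i ℚ.* σ i))) (cong (ℚ.- 1ℚ ℚ.*_) (linear-zero (λ j → seq (q j) m)))) ⟩
            ℚ.- 1ℚ ℚ.* toℚ (w ∙ t) ℚ.+ sum (λ i → ω i ℚ.* π i) ℚ.+ ℚ.- 1ℚ ℚ.* 0ℚ
              ≡⟨ solve 2 (λ a b → con (ℚ.- 1ℚ) :* a :+ b :+ con (ℚ.- 1ℚ) :* con 0ℚ := (:- a) :+ b) refl (toℚ (w ∙ t)) (sum λ i → ω i ℚ.* π i) ⟩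
            ℚ.- toℚ (w ∙ t) ℚ.+ sum (λ i → ω i ℚ.* π i)
              ≡⟨ cong (ℚ._+ sum (λ i → ω i ℚ.* π i)) (toℚ-neg (w ∙ t)) ⟨
            evaluate h p m ∎

      zero-on-image : ∀ {x} → x ∈ W → h ∙ hat x ≡ 0ℤ
      zero-on-image {x} p = null-lattice h x (evaluate-image {ι x} (Equivalence.to (image (ι x)) (member⇒conv {X = W} p)))

  -- If wU = 𝟘, then w takes the constant value w ∙ t on the image of q ↦ U q + t. So w - w ∙ t
  -- vanishes on W, and by full dimension everywhere.
  left-kernel-trivial : FullDimensional W → ∀ w → rowCombination w (λ i → Vec.tabulate (U i)) ≡ 𝟘 → w ≡ 𝟘
  left-kernel-trivial full w wU≡𝟘 = lookup-𝟘 λ i → begin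
    Vec.lookup w i                            ≡⟨ trans (sym (unit-∙ i w)) (∙-comm (unit i) w) ⟩
    w ∙ unit i                                ≡⟨ difference (ℤ.- (w ∙ t) ℤ.* 1ℤ) (w ∙ unit i) (w ∙ 𝟘) (∙-𝟘ʳ w) ⟩
    h w wU≡𝟘 ∙ hat (unit i) ℤ.- h w wU≡𝟘 ∙ hat 𝟘   ≡⟨ cong₂ ℤ._-_ (vanishes (unit i)) (vanishes 𝟘) ⟩
    0ℤ                                        ∎
    where
    open ≡-Reasoning
    vanishes : ∀ y → h w wU≡𝟘 ∙ hat y ≡ 0ℤ
    vanishes y = null-lattice (h w wU≡𝟘) y (aff-zero {X = W} {ι y} (h w wU≡𝟘) (full (ι y)) (zero-on-image w wU≡𝟘))
    difference : ∀ c a b → b ≡ 0ℤ → a ≡ (c ℤ.+ a) ℤ.- (c ℤ.+ b)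
    difference c a .0ℤ refl = lemma c a
      where
      lemma : ∀ c a → a ≡ (c ℤ.+ a) ℤ.- (c ℤ.+ 0ℤ)
      lemma = solve-∀

  -- A kernel vector has first entry 0, so its tail lies in the kernel of U. If the tail were
  -- nonzero, U would have a nonzero left kernel vector too, against the full dimension of the
  -- image.
  homogenise-embedding : FullDimensional W → LatticeEmbedding (homogenise U t)
  homogenise-embedding full = record { homomorphic = homogenise-⊕ U t ; injective = λ v → injective v }
    where
    row-zero : ∀ a v → homogenise U t (a ∷ v) ≡ 𝟘 → a ≡ 0ℤ → ∀ i → Vec.tabulate (U i) ∙ v ≡ 0ℤ
    row-zero .0ℤ v eq refl i = begin
      Vec.tabulate (U i) ∙ v                                ≡⟨ trans (cong (λ a → a ℤ.+ Vec.tabulate (U i) ∙ v) (ℤₚ.*-zeroʳ (Vec.lookup t i))) (ℤₚ.+-identityˡ _) ⟨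
      Vec.lookup t i ℤ.* 0ℤ ℤ.+ Vec.tabulate (U i) ∙ v      ≡⟨ Vecₚ.lookup∘tabulate (λ i → (Vec.lookup t i ∷ Vec.tabulate (U i)) ∙ (0ℤ ∷ v)) i ⟨
      Vec.lookup (homogenise U t (0ℤ ∷ v)) (suc i)          ≡⟨ cong (λ u → Vec.lookup u (suc i)) eq ⟩
      Vec.lookup 𝟘 i                                        ≡⟨ Vecₚ.lookup-replicate i 0ℤ ⟩
      0ℤ                                                    ∎
      where open ≡-Reasoning
    injective : ∀ v → homogenise U t v ≡ 𝟘 → v ≡ 𝟘
    injective (a ∷ v) eq = cong₂ _∷_ a≡0 (decidable-stable (v ≟ 𝟘) λ v≢𝟘 →
      let w , w≢𝟘 , wU≡𝟘 = kernel⇒left-kernel (λ i → Vec.tabulate (U i)) v≢𝟘 (row-zero a v eq a≡0)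
      in w≢𝟘 (left-kernel-trivial full w wU≡𝟘))
      where
      a≡0 : a ≡ 0ℤ
      a≡0 = Vecₚ.∷-injectiveˡ eq

-- Observers of wide sets

all-lattice-points : ∀ {Vs : List (List (ℤ^ d))} {n} → (∀ {V} → V ∈ Vs → LatticePointCount V n) →
  ∃[ L ] (∀ {V} → V ∈ Vs → ∀ z → conv V (ι z) → z ∈ L)
all-lattice-points {Vs = []}     _      = [] , λ ()
all-lattice-points {Vs = V ∷ Vs} counts =
  let L , _ , _ , points = counts (here refl)
      L′ , covers = all-lattice-points {Vs = Vs} (counts ∘ there)
  in L ++ L′ , λ { (here refl) z p → ∈-++⁺ˡ (Equivalence.from (points z) p) ; (there q) z p → ∈-++⁺ʳ L (covers q z p) }

-- The count is the same for all observers z, so a single n in the definition of the threshold width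
-- covers them all. Lists may repeat points, hence `deduplicate`.
observer-count : ∀ {X : List (ℤ^ d)} {z} → z ∉ X → (∀ z′ → InHull (z ∷ X) z′ → z′ ∈ X ⊎ z′ ≡ z) →
  LatticePointCount (z ∷ X) (suc (length (List.deduplicate _≟_ X)))
observer-count {X = X} {z} z∉X only = z ∷ List.deduplicate _≟_ X , new AllPairs.∷ Uniqueₚ.deduplicate-! _≟_ X , refl ,
  λ z′ → mk⇔ (λ p → member⇒conv {X = z ∷ X} (old p)) (λ p → listed (only z′ (conv⇒hull (z ∷ X) z′ p)))
  where
  new : All (z ≢_) (List.deduplicate _≟_ X)
  new = All.tabulate λ p eq → z∉X (subst (_∈ X) (sym eq) (∈-deduplicate⁻ _≟_ X p))
  old : ∀ {z′} → z′ ∈ z ∷ List.deduplicate _≟_ X → z′ ∈ z ∷ X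
  old (here eq) = here eq
  old (there p) = there (∈-deduplicate⁻ _≟_ X p)
  listed : ∀ {z′} → z′ ∈ X ⊎ z′ ≡ z → z′ ∈ z ∷ List.deduplicate _≟_ X
  listed (inj₁ p)  = there (∈-deduplicate⁺ _≟_ p)
  listed (inj₂ eq) = here eq

-- The equivalence maps X and z into L. Its graph on X is therefore one of the finitely many
-- `choices X L` and the image of z one of finitely many y, for all of which B is a common bound.
image-bound : ∀ {X L W : List (ℤ^ d)} {z B} →
  (∀ {ps} → ps ∈ choices X L → ∀ {y} → y ∈ L → PreimageBound X ps y B) →
  FullDimensional W → (∀ z′ → conv W (ι z′) → z′ ∈ L) → UnimodularlyEquivalent (conv (z ∷ X)) (conv W) → ∥ z ∥ ℕ.≤ B
image-bound {X = X} {L} {W} {z} bounds full W⊆L (U , t , _ , image) =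
  bounds (graph∈choices (affineMap U t) X (inside ∘ there)) (inside (here refl))
    (homogenise-embedding {U = U} {t} {z ∷ X} {W} image full)
    (λ p → extends (∈-map⁻ (λ x → x , affineMap U t x) p))
    (λ {x} p → affineMap U t x , ∈-map⁺ (λ x → x , affineMap U t x) p) z refl
  where
  inside : ∀ {x} → x ∈ z ∷ X → affineMap U t x ∈ L
  inside {x} p = W⊆L (affineMap U t x) (affineMap∈conv {U = U} {t} {z ∷ X} {W} image {x} (member⇒conv {X = z ∷ X} p))
  extends : ∀ {x y} → ∃[ x′ ] (x′ ∈ X × (x , y) ≡ (x′ , affineMap U t x′)) → homogenise U t (hat x) ≡ hat y
  extends (_ , _ , refl) = refl

some-image-bound : ∀ {X L : List (ℤ^ d)} {Vs z B} →
  (∀ {ps} → ps ∈ choices X L → ∀ {y} → y ∈ L → PreimageBound X ps y B) →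
  (∀ {V} → V ∈ Vs → FullDimensional V) → (∀ {V} → V ∈ Vs → ∀ z′ → conv V (ι z′) → z′ ∈ L) →
  Any.Any (λ W → UnimodularlyEquivalent (conv (z ∷ X)) (conv W)) Vs → ∥ z ∥ ℕ.≤ B
some-image-bound {X = X} {L} {V ∷ Vs} {z} {B} bounds full covers (here equivalent) =
  image-bound {X = X} {L} {V} {z} {B} bounds (full (here refl)) (covers (here refl)) equivalent
some-image-bound {X = X} {L} {V ∷ Vs} {z} {B} bounds full covers (there p) =
  some-image-bound {X = X} {L} {Vs} {z} {B} bounds (full ∘ there) (covers ∘ there) p

WideWithPoints : ℕ → ℕ → Pred (List (ℤ^ d)) 0ℓ
WideWithPoints w n V = FullDimensional V × LatticePointCount V n × ¬ LatticeWidth≤ (conv V) w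

module _ {X : List (ℤ^ d)} {w r} (r-width : IsLatticeWidth ⟦ X ⟧ r) (w<r : fromℤ (+ w) < r) where

  observer-wide : ∀ {z} → z ∉ X → (∀ z′ → InHull (z ∷ X) z′ → z′ ∈ X ⊎ z′ ≡ z) →
    WideWithPoints w (suc (length (List.deduplicate _≟_ X))) (z ∷ X)
  observer-wide {z} z∉X only =
    spanning⇒fullDimensional {X = z ∷ X} (λ h zero-on → wide⇒spanning {X = X} {w} {r} r-width w<r h (zero-on ∘ there)) ,
    observer-count {X = X} {z} z∉X only ,
    ¬narrow {X = X} {w} {r} r-width w<r {z ∷ X} there

  -- The summand `maxNorm X` makes the box contain X, so that `hull-shrinks` applies beyond it.
  wide⇒observersWithin : FinitelyManyUpToEquivalence (WideWithPoints w (suc (length (List.deduplicate _≟_ X)))) →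
    ∃[ B ] ObserversWithin X (maxNorm X ℕ.+ B)
  wide⇒observersWithin (Vs , good , exhaustive) =
    let L , covers = all-lattice-points {Vs = Vs} (λ {V} p → proj₁ (proj₂ (All.lookup good p)))
        B , bounds = preimageBound-all {X = X} (wide⇒spanning {X = X} {w} {r} r-width w<r) L
    in B , λ z z∉X R<z only → ℕₚ.<⇒≱ R<z (ℕₚ.≤-trans
         (some-image-bound {X = X} {L} {Vs} {z} {B} bounds (λ {V} p → proj₁ (All.lookup good p)) covers
           (exhaustive (z ∷ X) (observer-wide {z} z∉X only)))
         (ℕₚ.m≤n+m B (maxNorm X)))

width-solvable : ∀ {X : List (ℤ^ d)} → LatticeConvex X → WiderThanThreshold X → Solvable X
width-solvable {X = X} lc (w , (finite , _) , r , r-width , w<r) =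
  let B , observers = wide⇒observersWithin {X = X} {w} {r} r-width w<r (finite (suc (length (List.deduplicate _≟_ X))) (ℕ.s≤s ℕ.z≤n))
  in solvable {X = X} {R = maxNorm X ℕ.+ B} (proj₂ (wide⇒nonempty {X = X} {w} {r} r-width w<r)) (latticeConvex⇒closed {X = X} lc)
       (wide⇒spanning {X = X} {w} {r} r-width w<r) (ℕₚ.m≤m+n (maxNorm X) B) observers

theorem1p4 : Σ[ alg ∈ Algorithm (Σ[ d ∈ ℕ ] List (ℤ^ d)) ℕ ]
    (∀ d (X : List (ℤ^ d)) →
    LatticeConvex X →
    RepresentsAllParities X ⊎ HasInteriorLatticePoint X ⊎ WiderThanThreshold X →
    ∃[ k ] (IsRc X k × IsRcℚ X k × alg outputs k on (d , X)))
theorem1p4 = algorithm , λ d X lc → Sum.[ (λ parities → parity-solvable {X = X} parities lc) ,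
  Sum.[ interior-solvable {X = X} lc , width-solvable {X = X} lc ] ]
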